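{- A random matching $\mathbb{RM}_n$ contains, asymptotically almost surely, stacks and waves of size at least $\frac{1-o(1)}{e\sqrt2}\sqrt n$ each, as well as lines of size at least $\frac18\sqrt n$. That is, there is a sequence $\varepsilon_n\to 0$ such that the probability that $\mathbb{RM}_n$ contains a stack of size at least $\frac{1-\varepsilon_n}{e\sqrt2}\sqrt n$, a wave of size at least $\frac{1-\varepsilon_n}{e\sqrt2}\sqrt n$, and a line of size at least $\frac18\sqrt n$ tends to $1$ as $n\to\infty$.
   Context: An ordered matching of size $n$ is a graph on a linearly ordered vertex set of $2n$ vertices consisting of $n$ pairwise vertex-disjoint edges. $\mathbb{RM}_n$ denotes a random ordered matching of size $n$, selected uniformly at random from all $(2n)!/(n!2^n)$ matchings of size $n$ on the vertex set $\{1,\dots,2n\}$ with its natural order. The size of a matching is its number of edges; a sub-matching is a subset of the edges, its vertices inheriting the linear order. A matching with $k$ edges $\{a_i,b_i\}$, $a_i<b_i$, $i=1,\dots,k$, numbered so that $a_1<\cdots<a_k$, is called: a line if $a_1<b_1<a_2<b_2<\cdots<a_k<b_k$; a stack if $a_1<a_2<\cdots<a_k<b_k<b_{k-1}<\cdots<b_1$; a wave if $a_1<a_2<\cdots<a_k<b_1<b_2<\cdots<b_k$. A matching contains a line (stack, wave) if some sub-matching of it is a line (stack, wave). "Asymptotically almost surely" (a.a.s.) means with probability tending to $1$ as $n\to\infty$. -}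

module Defs where

open import Data.Fin.Base as Fin using (Fin)
import Data.Fin.Properties as Fin
open import Data.Integer.Base as ℤ using (+_)
import Data.Integer.Properties as ℤ
open import Data.List.Base
  using (List; []; _∷_; _++_; length; map; reverse; concatMap; filter; allFin; cartesianProduct; cartesianProductWith)
open import Data.List.Membership.Propositional using (_∈_)
open import Data.List.Membership.Propositional.Properties
  using (∈-filter⁺; ∈-cartesianProduct⁺; ∈-cartesianProductWith⁺; ∈-allFin; ∈-length; ∈-map⁻)
open import Data.List.Properties using (length-map; length-tabulate; map-∘)
open import Data.List.Relation.Binary.Sublist.Propositional using (_⊆_)
open import Data.List.Relation.Unary.All as All using (All)
import Data.List.Relation.Unary.All.Properties as All
import Data.List.Relation.Unary.AllPairs.Properties as AllPairs
open import Data.List.Relation.Unary.Any using (here)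
open import Data.List.Relation.Unary.Linked as Linked using (Linked)
import Data.List.Relation.Unary.Linked.Properties as Linked
open import Data.List.Relation.Unary.Unique.Propositional using (Unique)
import Data.List.Relation.Unary.Unique.Propositional.Properties as Unique
open import Data.Nat.Base as ℕ using (ℕ; zero; suc; _!)
import Data.Nat.Properties as ℕ
open import Data.Nat.Solver using (module +-*-Solver)
open import Data.Product.Base using (Σ-syntax; ∃-syntax; _×_; _,_; proj₁; proj₂; uncurry)
open import Data.Rational.Base as ℚ using (ℚ; mkℚ; 0ℚ; 1ℚ; ½)
import Data.Rational.Properties as ℚ
import Data.Rational.Solver as ℚS
open import Data.Rational.Unnormalised.Base as ℚᵘ using (mkℚᵘ)
import Data.Rational.Unnormalised.Properties as ℚᵘ
open import Data.Sum.Base using (inj₁; inj₂)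
open import Function.Base using (_∘_; id)
open import Level using (0ℓ)
open import Relation.Binary.PropositionalEquality
  using (_≡_; refl; sym; trans; cong; cong₂; subst; subst₂)
open import Relation.Nullary using (Dec; yes; no; contradiction)
open import Relation.Nullary.Decidable using (map′; _×-dec_)
open import Relation.Unary using (Pred; Decidable)

------------------------------------------------------------------------
-- Real numbers, as Cauchy sequences of rationals

Eventually : Pred ℕ 0ℓ → Set
Eventually P = ∃[ N ] ∀ n → N ℕ.≤ n → P n

_∧_ : {P Q : Pred ℕ 0ℓ} → Eventually P → Eventually Q → Eventually (λ n → P n × Q n)
(M , p) ∧ (N , q) = M ℕ.⊔ N , λ n h →
  p n (ℕ.≤-trans (ℕ.m≤m⊔n M N) h) , q n (ℕ.≤-trans (ℕ.m≤n⊔m M N) h)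

IsCauchy : (ℕ → ℚ) → Set
IsCauchy s = ∀ δ → 0ℚ ℚ.< δ →
  ∃[ N ] ∀ m n → N ℕ.≤ m → N ℕ.≤ n → ℚ.∣ s m ℚ.- s n ∣ ℚ.≤ δ

record ℝ : Set where
  no-eta-equality
  field
    seq    : ℕ → ℚ
    cauchy : IsCauchy seq

open ℝ public

module Rational where

  open ℚ.≤-Reasoning

  p-q≤r : ∀ {p q r} → p ℚ.≤ q ℚ.+ r → p ℚ.- q ℚ.≤ r
  p-q≤r {p} {q} {r} h = begin
    p ℚ.- q          ≤⟨ ℚ.+-monoˡ-≤ (ℚ.- q) h ⟩
    q ℚ.+ r ℚ.- q    ≡⟨ solve 2 (λ q r → q :+ r :- q := r) refl q r ⟩
    r                ∎
    where open ℚS.+-*-Solver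

  p≡q+[p-q] : ∀ p q → p ≡ q ℚ.+ (p ℚ.- q)
  p≡q+[p-q] = solve 2 (λ p q → p := q :+ (p :- q)) refl
    where open ℚS.+-*-Solver

  p≤∣p∣ : ∀ p → p ℚ.≤ ℚ.∣ p ∣
  p≤∣p∣ p with ℚ.≤-total 0ℚ p
  ... | inj₁ 0≤p = ℚ.≤-reflexive (sym (ℚ.0≤p⇒∣p∣≡p 0≤p))
  ... | inj₂ p≤0 = ℚ.≤-trans p≤0 (ℚ.0≤∣p∣ p)

  ∣p-q∣≡∣q-p∣ : ∀ p q → ℚ.∣ p ℚ.- q ∣ ≡ ℚ.∣ q ℚ.- p ∣
  ∣p-q∣≡∣q-p∣ p q = trans (sym (ℚ.∣-p∣≡∣p∣ (p ℚ.- q)))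
    (cong ℚ.∣_∣ (solve 2 (λ p q → :- (p :- q) := q :- p) refl p q))
    where open ℚS.+-*-Solver

  ∣p-q∣≤r : ∀ {p q r} → p ℚ.≤ q ℚ.+ r → q ℚ.≤ p ℚ.+ r → ℚ.∣ p ℚ.- q ∣ ℚ.≤ r
  ∣p-q∣≤r {p} {q} {r} h k with ℚ.∣p∣≡p∨∣p∣≡-p (p ℚ.- q)
  ... | inj₁ eq = ℚ.≤-trans (ℚ.≤-reflexive eq) (p-q≤r h)
  ... | inj₂ eq = ℚ.≤-trans
    (ℚ.≤-reflexive (trans eq (solve 2 (λ p q → :- (p :- q) := q :- p) refl p q)))
    (p-q≤r k)
    where open ℚS.+-*-Solver

  p≤q+r : ∀ {p q r} → ℚ.∣ p ℚ.- q ∣ ℚ.≤ r → p ℚ.≤ q ℚ.+ r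
  p≤q+r {p} {q} {r} h = begin
    p                        ≡⟨ p≡q+[p-q] p q ⟩
    q ℚ.+ (p ℚ.- q)          ≤⟨ ℚ.+-monoʳ-≤ q (p≤∣p∣ (p ℚ.- q)) ⟩
    q ℚ.+ ℚ.∣ p ℚ.- q ∣      ≤⟨ ℚ.+-monoʳ-≤ q h ⟩
    q ℚ.+ r                  ∎

  ∣p∣≤∣q∣+r : ∀ {p q r} → ℚ.∣ p ℚ.- q ∣ ℚ.≤ r → ℚ.∣ p ∣ ℚ.≤ ℚ.∣ q ∣ ℚ.+ r
  ∣p∣≤∣q∣+r {p} {q} {r} h = begin
    ℚ.∣ p ∣                        ≡⟨ cong ℚ.∣_∣ (p≡q+[p-q] p q) ⟩
    ℚ.∣ q ℚ.+ (p ℚ.- q) ∣          ≤⟨ ℚ.∣p+q∣≤∣p∣+∣q∣ q (p ℚ.- q) ⟩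
    ℚ.∣ q ∣ ℚ.+ ℚ.∣ p ℚ.- q ∣      ≤⟨ ℚ.+-monoʳ-≤ ℚ.∣ q ∣ h ⟩
    ℚ.∣ q ∣ ℚ.+ r                  ∎

  *-mono-≤ : ∀ {p q r s} → 0ℚ ℚ.≤ q → 0ℚ ℚ.≤ r → p ℚ.≤ q → r ℚ.≤ s → p ℚ.* r ℚ.≤ q ℚ.* s
  *-mono-≤ {p} {q} {r} {s} 0≤q 0≤r h k = ℚ.≤-trans
    (ℚ.*-monoʳ-≤-nonNeg r {{ℚ.nonNegative 0≤r}} h)
    (ℚ.*-monoˡ-≤-nonNeg q {{ℚ.nonNegative 0≤q}} k)

  0<* : ∀ {p q} → 0ℚ ℚ.< p → 0ℚ ℚ.< q → 0ℚ ℚ.< p ℚ.* q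
  0<* {p} {q} h k = ℚ.positive⁻¹ (p ℚ.* q)
    {{ℚ.pos*pos⇒pos p {{ℚ.positive h}} q {{ℚ.positive k}}}}

  -- For every b > 0 some positive multiple of b equals δ > 0.
  split : ∀ δ b → 0ℚ ℚ.< δ → 0ℚ ℚ.< b → ∃[ η ] (0ℚ ℚ.< η) × (b ℚ.* η ≡ δ)
  split δ b 0<δ 0<b =
    δ ℚ.* c , 0<* 0<δ (ℚ.positive⁻¹ c {{ℚ.1/pos⇒pos b}}) , eq
    where
    instance
      b>0 = ℚ.positive 0<b
      b≢0 = ℚ.pos⇒nonZero b
    c = ℚ.1/ b
    open ℚS.+-*-Solver
    eq : b ℚ.* (δ ℚ.* c) ≡ δ
    eq = begin-equality
      b ℚ.* (δ ℚ.* c)    ≡⟨ solve 3 (λ b δ c → b :* (δ :* c) := δ :* (b :* c)) refl b δ c ⟩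
      δ ℚ.* (b ℚ.* c)    ≡⟨ cong (δ ℚ.*_) (ℚ.*-inverseʳ b) ⟩
      δ ℚ.* 1ℚ           ≡⟨ ℚ.*-identityʳ δ ⟩
      δ                  ∎

  /-mono-≤ : ∀ a b m n .{{_ : ℕ.NonZero m}} .{{_ : ℕ.NonZero n}} →
             a ℕ.* n ℕ.≤ b ℕ.* m → + a ℚ./ m ℚ.≤ + b ℚ./ n
  /-mono-≤ a b (suc m) (suc n) h = ℚ.toℚᵘ-cancel-≤
    (ℚᵘ.≤-respˡ-≃ (ℚᵘ.≃-sym (ℚ.toℚᵘ-fromℚᵘ (mkℚᵘ (+ a) m)))
    (ℚᵘ.≤-respʳ-≃ (ℚᵘ.≃-sym (ℚ.toℚᵘ-fromℚᵘ (mkℚᵘ (+ b) n)))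
    (ℚᵘ.*≤* (subst₂ ℤ._≤_ (ℤ.pos-* a (suc n)) (ℤ.pos-* b (suc m)) (ℤ.+≤+ h)))))

  /-+ : ∀ a b m .{{_ : ℕ.NonZero m}} → + a ℚ./ m ℚ.+ + b ℚ./ m ≡ + (a ℕ.+ b) ℚ./ m
  /-+ a b (suc m) = ℚ.toℚᵘ-injective (ℚᵘ.≃-trans
    (ℚ.toℚᵘ-homo-+ (+ a ℚ./ suc m) (+ b ℚ./ suc m)) (ℚᵘ.≃-trans
    (ℚᵘ.+-cong (ℚ.toℚᵘ-fromℚᵘ (mkℚᵘ (+ a) m)) (ℚ.toℚᵘ-fromℚᵘ (mkℚᵘ (+ b) m))) (ℚᵘ.≃-trans
    (ℚᵘ.*≡* eq)
    (ℚᵘ.≃-sym (ℚ.toℚᵘ-fromℚᵘ (mkℚᵘ (+ (a ℕ.+ b)) m))))))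
    where
    M = + suc m
    eq : ((+ a) ℤ.* M ℤ.+ (+ b) ℤ.* M) ℤ.* M ≡ + (a ℕ.+ b) ℤ.* (M ℤ.* M)
    eq = trans (cong (ℤ._* M) (sym (ℤ.*-distribʳ-+ M (+ a) (+ b)))) (ℤ.*-assoc (+ (a ℕ.+ b)) M M)

  archimedean : ∀ δ → 0ℚ ℚ.< δ → ∃[ d ] + 1 ℚ./ suc d ℚ.≤ δ
  archimedean (mkℚ (+ suc a) d c) _ = d , subst (+ 1 ℚ./ suc d ℚ.≤_)
    (ℚ.↥p/↧p≡p (mkℚ (+ suc a) d c))
    (/-mono-≤ 1 (suc a) (suc d) (suc d) (ℕ.*-monoˡ-≤ (suc d) (ℕ.s≤s (ℕ.z≤n {a}))))
  archimedean (mkℚ (+ zero) d c) (ℚ.*<* (ℤ.+<+ ()))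
  archimedean (mkℚ ℤ.-[1+ n ] d c) (ℚ.*<* ())

open Rational

isCauchy : ∀ {s} → (∀ δ → 0ℚ ℚ.< δ →
  ∃[ N ] ∀ m n → N ℕ.≤ m → N ℕ.≤ n → s m ℚ.≤ s n ℚ.+ δ) → IsCauchy s
isCauchy h δ 0<δ with h δ 0<δ
... | N , k = N , λ m n N≤m N≤n → ∣p-q∣≤r (k m n N≤m N≤n) (k n m N≤n N≤m)

bounded : ∀ x → ∃[ b ] (0ℚ ℚ.< b) × Eventually (λ n → ℚ.∣ seq x n ∣ ℚ.≤ b)
bounded x with cauchy x 1ℚ (ℚ.positive⁻¹ 1ℚ)
... | N , h = ℚ.∣ seq x N ∣ ℚ.+ 1ℚ
            , ℚ.+-mono-≤-< (ℚ.0≤∣p∣ (seq x N)) (ℚ.positive⁻¹ 1ℚ)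
            , N , λ n N≤n → ∣p∣≤∣q∣+r (h n N N≤n ℕ.≤-refl)

fromℚ : ℚ → ℝ
seq    (fromℚ q) _ = q
cauchy (fromℚ q) δ 0<δ = 0 , λ _ _ _ _ →
  ℚ.≤-trans (ℚ.≤-reflexive (cong ℚ.∣_∣ (ℚ.+-inverseʳ q))) (ℚ.<⇒≤ 0<δ)

fromℕ : ℕ → ℝ
fromℕ n = fromℚ (+ n ℚ./ 1)

0ℝ 1ℝ : ℝ
0ℝ = fromℕ 0
1ℝ = fromℕ 1

infix  4 _≤_ _⟶_
infixl 6 _-_
infixl 7 _*_ _÷_

_≤_ : ℝ → ℝ → Set
x ≤ y = ∀ δ → 0ℚ ℚ.< δ → Eventually (λ n → seq x n ℚ.≤ seq y n ℚ.+ δ)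

_-_ : ℝ → ℝ → ℝ
seq    (x - y) n = seq x n ℚ.- seq y n
cauchy (x - y) = isCauchy {seq (x - y)} λ δ 0<δ →
  let η , 0<η , eq = split δ (1ℚ ℚ.+ 1ℚ) 0<δ (ℚ.positive⁻¹ (1ℚ ℚ.+ 1ℚ))
      M , h = cauchy x η 0<η
      N , k = cauchy y η 0<η
  in M ℕ.⊔ N , λ m n hm hn → begin
    seq x m ℚ.- seq y m
      ≤⟨ ℚ.+-mono-≤
           (p≤q+r {seq x m} {seq x n} (h m n (ℕ.m⊔n≤o⇒m≤o M N hm) (ℕ.m⊔n≤o⇒m≤o M N hn)))
           (ℚ.neg-antimono-≤ (p-q≤r {seq y n} {η} (ℚ.≤-trans
             (p≤q+r {seq y n} {seq y m} (k n m (ℕ.m⊔n≤o⇒n≤o M N hn) (ℕ.m⊔n≤o⇒n≤o M N hm)))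
             (ℚ.≤-reflexive (ℚ.+-comm (seq y m) η))))) ⟩
    seq x n ℚ.+ η ℚ.+ ℚ.- (seq y n ℚ.- η)
      ≡⟨ solve 3 (λ x y η → x :+ η :+ :- (y :- η) := x :- y :+ (con 1ℚ :+ con 1ℚ) :* η) refl
           (seq x n) (seq y n) η ⟩
    seq x n ℚ.- seq y n ℚ.+ (1ℚ ℚ.+ 1ℚ) ℚ.* η
      ≡⟨ cong (seq x n ℚ.- seq y n ℚ.+_) eq ⟩
    seq x n ℚ.- seq y n ℚ.+ δ ∎
  where
  open ℚ.≤-Reasoning
  open ℚS.+-*-Solver

_*_ : ℝ → ℝ → ℝ
seq    (x * y) n = seq x n ℚ.* seq y n
cauchy (x * y) δ 0<δ =
  let a , 0<a , A , ha = bounded x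
      b , 0<b , B , hb = bounded y
      η , 0<η , eq = split δ (a ℚ.+ b) 0<δ (ℚ.+-mono-< 0<a 0<b)
      M , h = cauchy x η 0<η
      N , k = cauchy y η 0<η
  in (A ℕ.⊔ B) ℕ.⊔ (M ℕ.⊔ N) , λ m n hm hn →
    let hm₁ = ℕ.m⊔n≤o⇒m≤o (A ℕ.⊔ B) (M ℕ.⊔ N) hm
        hm₂ = ℕ.m⊔n≤o⇒n≤o (A ℕ.⊔ B) (M ℕ.⊔ N) hm
        hn₁ = ℕ.m⊔n≤o⇒m≤o (A ℕ.⊔ B) (M ℕ.⊔ N) hn
        hn₂ = ℕ.m⊔n≤o⇒n≤o (A ℕ.⊔ B) (M ℕ.⊔ N) hn
        p = seq x m ; p′ = seq x n
        q = seq y m ; q′ = seq y n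
    in begin
    ℚ.∣ p ℚ.* q ℚ.- p′ ℚ.* q′ ∣
      ≡⟨ cong ℚ.∣_∣ (solve 4 (λ p p′ q q′ →
           p :* q :- p′ :* q′ := p :* (q :- q′) :+ q′ :* (p :- p′)) refl p p′ q q′) ⟩
    ℚ.∣ p ℚ.* (q ℚ.- q′) ℚ.+ q′ ℚ.* (p ℚ.- p′) ∣
      ≤⟨ ℚ.∣p+q∣≤∣p∣+∣q∣ (p ℚ.* (q ℚ.- q′)) (q′ ℚ.* (p ℚ.- p′)) ⟩
    ℚ.∣ p ℚ.* (q ℚ.- q′) ∣ ℚ.+ ℚ.∣ q′ ℚ.* (p ℚ.- p′) ∣
      ≡⟨ cong₂ ℚ._+_ (ℚ.∣p*q∣≡∣p∣*∣q∣ p (q ℚ.- q′)) (ℚ.∣p*q∣≡∣p∣*∣q∣ q′ (p ℚ.- p′)) ⟩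
    ℚ.∣ p ∣ ℚ.* ℚ.∣ q ℚ.- q′ ∣ ℚ.+ ℚ.∣ q′ ∣ ℚ.* ℚ.∣ p ℚ.- p′ ∣
      ≤⟨ ℚ.+-mono-≤
           (*-mono-≤ (ℚ.<⇒≤ 0<a) (ℚ.0≤∣p∣ (q ℚ.- q′)) (ha m (ℕ.m⊔n≤o⇒m≤o A B hm₁))
             (k m n (ℕ.m⊔n≤o⇒n≤o M N hm₂) (ℕ.m⊔n≤o⇒n≤o M N hn₂)))
           (*-mono-≤ (ℚ.<⇒≤ 0<b) (ℚ.0≤∣p∣ (p ℚ.- p′)) (hb n (ℕ.m⊔n≤o⇒n≤o A B hn₁))
             (h m n (ℕ.m⊔n≤o⇒m≤o M N hm₂) (ℕ.m⊔n≤o⇒m≤o M N hn₂))) ⟩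
    a ℚ.* η ℚ.+ b ℚ.* η
      ≡⟨ ℚ.*-distribʳ-+ η a b ⟨
    (a ℚ.+ b) ℚ.* η
      ≡⟨ eq ⟩
    δ ∎
  where
  open ℚ.≤-Reasoning
  open ℚS.+-*-Solver using (solve; _:=_; _:+_; _:*_; _:-_)

∣_∣ : ℝ → ℝ
seq    ∣ x ∣ n = ℚ.∣ seq x n ∣
cauchy ∣ x ∣ = isCauchy {seq ∣ x ∣} λ δ 0<δ →
  let N , h = cauchy x δ 0<δ
  in N , λ m n hm hn → ∣p∣≤∣q∣+r {seq x m} {seq x n} (h m n hm hn)

record Positive (x : ℝ) : Set where
  field
    bound   : ℚ
    bound>0 : 0ℚ ℚ.< bound
    bound≤  : Eventually (λ n → bound ℚ.≤ seq x n)

open Positive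

-- Only finitely many terms of a sequence bounded away from zero are
-- affected by the convention 1/0 = 0.
reciprocal : ℚ → ℚ
reciprocal q with q ℚ.≟ 0ℚ
... | yes _   = 0ℚ
... | no  q≢0 = ℚ.1/_ q {{ℚ.≢-nonZero q≢0}}

*-reciprocal : ∀ {q} → 0ℚ ℚ.< q → q ℚ.* reciprocal q ≡ 1ℚ
*-reciprocal {q} 0<q with q ℚ.≟ 0ℚ
... | yes q≡0 = contradiction (sym q≡0) (ℚ.<⇒≢ 0<q)
... | no  q≢0 = ℚ.*-inverseʳ q {{ℚ.≢-nonZero q≢0}}

reciprocal-≤ : ∀ {d δ p q} → 0ℚ ℚ.< d → 0ℚ ℚ.< δ → d ℚ.≤ p → d ℚ.≤ q →
  q ℚ.≤ p ℚ.+ d ℚ.* d ℚ.* δ → reciprocal p ℚ.≤ reciprocal q ℚ.+ δ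
reciprocal-≤ {d} {δ} {p} {q} 0<d 0<δ d≤p d≤q h =
  ℚ.*-cancelˡ-≤-pos (p ℚ.* q) {{ℚ.positive (0<* 0<p 0<q)}} (begin
    p ℚ.* q ℚ.* p⁻¹
      ≡⟨ solve 3 (λ p q p⁻¹ → p :* q :* p⁻¹ := q :* (p :* p⁻¹)) refl p q p⁻¹ ⟩
    q ℚ.* (p ℚ.* p⁻¹)
      ≡⟨ cong (q ℚ.*_) (*-reciprocal 0<p) ⟩
    q ℚ.* 1ℚ
      ≡⟨ ℚ.*-identityʳ q ⟩
    q
      ≤⟨ h ⟩
    p ℚ.+ d ℚ.* d ℚ.* δ
      ≤⟨ ℚ.+-monoʳ-≤ p (ℚ.*-monoʳ-≤-nonNeg δ {{ℚ.nonNegative (ℚ.<⇒≤ 0<δ)}}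
           (*-mono-≤ (ℚ.<⇒≤ 0<p) (ℚ.<⇒≤ 0<d) d≤p d≤q)) ⟩
    p ℚ.+ p ℚ.* q ℚ.* δ
      ≡⟨ cong (ℚ._+ p ℚ.* q ℚ.* δ) (sym (trans (cong (p ℚ.*_) (*-reciprocal 0<q)) (ℚ.*-identityʳ p))) ⟩
    p ℚ.* (q ℚ.* q⁻¹) ℚ.+ p ℚ.* q ℚ.* δ
      ≡⟨ solve 4 (λ p q q⁻¹ δ → p :* (q :* q⁻¹) :+ p :* q :* δ := p :* q :* (q⁻¹ :+ δ)) refl p q q⁻¹ δ ⟩
    p ℚ.* q ℚ.* (q⁻¹ ℚ.+ δ) ∎)
  where
  open ℚ.≤-Reasoning
  open ℚS.+-*-Solver using (solve; _:=_; _:+_; _:*_)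
  p⁻¹ = reciprocal p
  q⁻¹ = reciprocal q
  0<p = ℚ.<-≤-trans 0<d d≤p
  0<q = ℚ.<-≤-trans 0<d d≤q

inverse : (x : ℝ) → Positive x → ℝ
seq    (inverse x _) n = reciprocal (seq x n)
cauchy (inverse x record { bound = d ; bound>0 = 0<d ; bound≤ = M , h }) = isCauchy λ δ 0<δ →
  let N , k = cauchy x (d ℚ.* d ℚ.* δ) (0<* (0<* 0<d 0<d) 0<δ)
  in M ℕ.⊔ N , λ m n hm hn → reciprocal-≤ 0<d 0<δ
    (h m (ℕ.m⊔n≤o⇒m≤o M N hm)) (h n (ℕ.m⊔n≤o⇒m≤o M N hn))
    (p≤q+r {seq x n} {seq x m} (k n m (ℕ.m⊔n≤o⇒n≤o M N hn) (ℕ.m⊔n≤o⇒n≤o M N hm)))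

_÷_ : (x y : ℝ) → {{Positive y}} → ℝ
_÷_ x y {{y>0}} = x * inverse y y>0

_⟶_ : (ℕ → ℝ) → ℝ → Set
a ⟶ l = ∀ δ → 0ℚ ℚ.< δ → Eventually (λ n → ∣ a n - l ∣ ≤ fromℚ δ)

-- The integer part of the square root of n.
⌊√_⌋ : ℕ → ℕ
⌊√ zero  ⌋ = 0
⌊√ suc n ⌋ with suc ⌊√ n ⌋ ℕ.* suc ⌊√ n ⌋ ℕ.≤? suc n
... | yes _ = suc ⌊√ n ⌋
... | no  _ = ⌊√ n ⌋

⌊√⌋-lower : ∀ n → ⌊√ n ⌋ ℕ.* ⌊√ n ⌋ ℕ.≤ n
⌊√⌋-lower zero = ℕ.z≤n
⌊√⌋-lower (suc n) with suc ⌊√ n ⌋ ℕ.* suc ⌊√ n ⌋ ℕ.≤? suc n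
... | yes h = h
... | no  _ = ℕ.m≤n⇒m≤1+n (⌊√⌋-lower n)

⌊√⌋-upper : ∀ n → n ℕ.< suc ⌊√ n ⌋ ℕ.* suc ⌊√ n ⌋
⌊√⌋-upper zero = ℕ.s≤s ℕ.z≤n
⌊√⌋-upper (suc n) with suc ⌊√ n ⌋ ℕ.* suc ⌊√ n ⌋ ℕ.≤? suc n
... | yes _ = ℕ.≤-<-trans (⌊√⌋-upper n) (ℕ.*-mono-< (ℕ.n<1+n (suc ⌊√ n ⌋)) (ℕ.n<1+n (suc ⌊√ n ⌋)))
... | no  h = ℕ.≰⇒> h

square-cancel-≤ : ∀ {a b} → a ℕ.* a ℕ.≤ b ℕ.* b → a ℕ.≤ b
square-cancel-≤ {a} {b} h with a ℕ.≤? b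
... | yes a≤b = a≤b
... | no  a≰b = contradiction h (ℕ.<⇒≱ (ℕ.*-mono-< (ℕ.≰⇒> a≰b) (ℕ.≰⇒> a≰b)))

⌊√⌋-cross : ∀ n i j → ⌊√ n ℕ.* (suc i ℕ.* suc i) ⌋ ℕ.* suc j ℕ.≤
  (⌊√ n ℕ.* (suc j ℕ.* suc j) ⌋ ℕ.+ 1) ℕ.* suc i
⌊√⌋-cross n i j = square-cancel-≤ (begin
  (r i ℕ.* J) ℕ.* (r i ℕ.* J)
    ≡⟨ solve 2 (λ r J → (r :* J) :* (r :* J) := (r :* r) :* (J :* J)) refl (r i) J ⟩
  (r i ℕ.* r i) ℕ.* (J ℕ.* J)
    ≤⟨ ℕ.*-monoˡ-≤ (J ℕ.* J) (⌊√⌋-lower (n ℕ.* (I ℕ.* I))) ⟩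
  (n ℕ.* (I ℕ.* I)) ℕ.* (J ℕ.* J)
    ≡⟨ solve 3 (λ n I J → (n :* (I :* I)) :* (J :* J) := (n :* (J :* J)) :* (I :* I)) refl n I J ⟩
  (n ℕ.* (J ℕ.* J)) ℕ.* (I ℕ.* I)
    ≤⟨ ℕ.*-monoˡ-≤ (I ℕ.* I) (ℕ.<⇒≤ (⌊√⌋-upper (n ℕ.* (J ℕ.* J)))) ⟩
  (suc (r j) ℕ.* suc (r j)) ℕ.* (I ℕ.* I)
    ≡⟨ solve 2 (λ r I → ((con 1 :+ r) :* (con 1 :+ r)) :* (I :* I)
           := ((r :+ con 1) :* I) :* ((r :+ con 1) :* I)) refl (r j) I ⟩
  ((r j ℕ.+ 1) ℕ.* I) ℕ.* ((r j ℕ.+ 1) ℕ.* I) ∎)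
  where
  open ℕ.≤-Reasoning
  open +-*-Solver
  I = suc i
  J = suc j
  r : ℕ → ℕ
  r j = ⌊√ n ℕ.* (suc j ℕ.* suc j) ⌋

-- The j-th term is √n rounded down to a multiple of 1/(j+1).
√_ : ℕ → ℝ
seq    (√ n) j = + ⌊√ n ℕ.* (suc j ℕ.* suc j) ⌋ ℚ./ suc j
cauchy (√ n) = isCauchy λ δ 0<δ →
  let N , h = archimedean δ 0<δ in N , λ i j _ N≤j → begin
    seq (√ n) i
      ≤⟨ /-mono-≤ (r i) (r j ℕ.+ 1) (suc i) (suc j) (⌊√⌋-cross n i j) ⟩
    + (r j ℕ.+ 1) ℚ./ suc j
      ≡⟨ /-+ (r j) 1 (suc j) ⟨
    seq (√ n) j ℚ.+ + 1 ℚ./ suc j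
      ≤⟨ ℚ.+-monoʳ-≤ (seq (√ n) j) (ℚ.≤-trans
           (/-mono-≤ 1 1 (suc j) (suc N) (ℕ.*-monoʳ-≤ 1 (ℕ.s≤s N≤j))) h) ⟩
    seq (√ n) j ℚ.+ δ ∎
  where
  open ℚ.≤-Reasoning
  r : ℕ → ℕ
  r j = ⌊√ n ℕ.* (suc j ℕ.* suc j) ⌋

1/_! : ℕ → ℚ
1/ k ! = ℚ._/_ (+ 1) (k !) {{ℕ._!≢0 k}}

∑1/_! : ℕ → ℚ
∑1/ zero  ! = 1/ 0 !
∑1/ suc k ! = ∑1/ k ! ℚ.+ 1/ suc k !

0≤1/_! : ∀ k → 0ℚ ℚ.≤ 1/ k !
0≤1/ k ! = /-mono-≤ 0 1 1 (k !) {{_}} {{k ℕ.!≢0}} ℕ.z≤n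

1/!-halves : ∀ k → 1 ℕ.≤ k → 1/ suc k ! ℚ.+ 1/ suc k ! ℚ.≤ 1/ k !
1/!-halves k 1≤k = ℚ.≤-trans
  (ℚ.≤-reflexive (/-+ 1 1 (suc k !)))
  (/-mono-≤ 2 1 (suc k !) (k !) (ℕ.≤-trans
    (ℕ.*-monoˡ-≤ (k !) (ℕ.s≤s 1≤k))
    (ℕ.≤-reflexive (sym (ℕ.*-identityˡ (suc k !))))))
  where
  instance
    k!≢0   = k ℕ.!≢0
    k+1!≢0 = suc k ℕ.!≢0

∑1/!-increases : ∀ n k → ∑1/ n ! ℚ.≤ ∑1/ (k ℕ.+ n) !
∑1/!-increases n zero    = ℚ.≤-refl
∑1/!-increases n (suc k) = begin
  ∑1/ n !                                       ≤⟨ ∑1/!-increases n k ⟩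
  ∑1/ (k ℕ.+ n) !                               ≡⟨ ℚ.+-identityʳ (∑1/ (k ℕ.+ n) !) ⟨
  ∑1/ (k ℕ.+ n) ! ℚ.+ 0ℚ                        ≤⟨ ℚ.+-monoʳ-≤ (∑1/ (k ℕ.+ n) !) 0≤1/ suc k ℕ.+ n ! ⟩
  ∑1/ (k ℕ.+ n) ! ℚ.+ 1/ (suc k ℕ.+ n) !        ∎
  where open ℚ.≤-Reasoning

∑1/!-tail : ∀ n k → 1 ℕ.≤ n →
  ∑1/ (k ℕ.+ n) ! ℚ.+ 1/ (k ℕ.+ n) ! ℚ.≤ ∑1/ n ! ℚ.+ 1/ n !
∑1/!-tail n zero    1≤n = ℚ.≤-refl
∑1/!-tail n (suc k) 1≤n = begin
  ∑1/ (k ℕ.+ n) ! ℚ.+ u ℚ.+ u          ≡⟨ ℚ.+-assoc (∑1/ (k ℕ.+ n) !) u u ⟩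
  ∑1/ (k ℕ.+ n) ! ℚ.+ (u ℚ.+ u)        ≤⟨ ℚ.+-monoʳ-≤ (∑1/ (k ℕ.+ n) !)
                                            (1/!-halves (k ℕ.+ n) (ℕ.≤-trans 1≤n (ℕ.m≤n+m n k))) ⟩
  ∑1/ (k ℕ.+ n) ! ℚ.+ 1/ (k ℕ.+ n) !   ≤⟨ ∑1/!-tail n k 1≤n ⟩
  ∑1/ n ! ℚ.+ 1/ n !                   ∎
  where
  open ℚ.≤-Reasoning
  u = 1/ (suc k ℕ.+ n) !

1/!-small : ∀ d n → suc d ℕ.≤ n → 1/ n ! ℚ.≤ + 1 ℚ./ suc d
1/!-small d (suc n) d<n = /-mono-≤ 1 1 (suc n !) (suc d) (ℕ.*-monoʳ-≤ 1
  (ℕ.≤-trans d<n (ℕ.m≤m*n (suc n) (n !))))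
  where
  instance
    n!≢0   = n ℕ.!≢0
    n+1!≢0 = suc n ℕ.!≢0

e : ℝ
seq    e = ∑1/_!
cauchy e = isCauchy λ δ 0<δ →
  let d , h = archimedean δ 0<δ
  in suc d , λ m n _ N≤n →
    ℚ.≤-trans (below m n (ℕ.≤-trans (ℕ.s≤s ℕ.z≤n) N≤n))
      (ℚ.+-monoʳ-≤ (∑1/ n !) (ℚ.≤-trans (1/!-small d n N≤n) h))
  where
  open ℚ.≤-Reasoning
  below : ∀ m n → 1 ℕ.≤ n → ∑1/ m ! ℚ.≤ ∑1/ n ! ℚ.+ 1/ n !
  below m n 1≤n with ℕ.≤-total m n
  ... | inj₁ m≤n = begin
    ∑1/ m !                        ≤⟨ ∑1/!-increases m (n ℕ.∸ m) ⟩
    ∑1/ (n ℕ.∸ m ℕ.+ m) !          ≡⟨ cong ∑1/_! (ℕ.m∸n+n≡m m≤n) ⟩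
    ∑1/ n !                        ≡⟨ ℚ.+-identityʳ (∑1/ n !) ⟨
    ∑1/ n ! ℚ.+ 0ℚ                 ≤⟨ ℚ.+-monoʳ-≤ (∑1/ n !) 0≤1/ n ! ⟩
    ∑1/ n ! ℚ.+ 1/ n !             ∎
  ... | inj₂ n≤m = begin
    ∑1/ m !                        ≡⟨ ℚ.+-identityʳ (∑1/ m !) ⟨
    ∑1/ m ! ℚ.+ 0ℚ                 ≤⟨ ℚ.+-monoʳ-≤ (∑1/ m !) 0≤1/ m ! ⟩
    ∑1/ m ! ℚ.+ 1/ m !             ≡⟨ cong (λ k → ∑1/ k ! ℚ.+ 1/ k !) (ℕ.m∸n+n≡m n≤m) ⟨
    ∑1/ (m ℕ.∸ n ℕ.+ n) ! ℚ.+ 1/ (m ℕ.∸ n ℕ.+ n) !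
                                   ≤⟨ ∑1/!-tail n (m ℕ.∸ n) 1≤n ⟩
    ∑1/ n ! ℚ.+ 1/ n !             ∎

instance
  e-positive : Positive e
  e-positive = record
    { bound   = 1ℚ
    ; bound>0 = ℚ.positive⁻¹ 1ℚ
    ; bound≤  = 0 , λ n _ → subst (λ k → 1ℚ ℚ.≤ ∑1/ k !) (ℕ.+-identityʳ n) (∑1/!-increases 0 n)
    }

  √-positive : ∀ {n} → Positive (√ suc n)
  √-positive {n} = record
    { bound   = 1ℚ
    ; bound>0 = ℚ.positive⁻¹ 1ℚ
    ; bound≤  = 0 , λ j _ → /-mono-≤ 1 ⌊√ suc n ℕ.* (suc j ℕ.* suc j) ⌋ 1 (suc j)
        (subst₂ ℕ._≤_ (sym (ℕ.*-identityˡ (suc j))) (sym (ℕ.*-identityʳ _))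
          (large (suc j) (suc n ℕ.* (suc j ℕ.* suc j)) (ℕ.m≤n*m (suc j ℕ.* suc j) (suc n))))
    }
    where
    large : ∀ k m → k ℕ.* k ℕ.≤ m → k ℕ.≤ ⌊√ m ⌋
    large k m h with k ℕ.≤? ⌊√ m ⌋
    ... | yes k≤r = k≤r
    ... | no  k≰r = contradiction
      (ℕ.<-≤-trans (⌊√⌋-upper m) (ℕ.*-mono-≤ (ℕ.≰⇒> k≰r) (ℕ.≰⇒> k≰r)))
      (ℕ.≤⇒≯ h)

  *-positive : ∀ {x y} → {{Positive x}} → {{Positive y}} → Positive (x * y)
  *-positive {{x>0}} {{y>0}} = record
    { bound   = bound x>0 ℚ.* bound y>0
    ; bound>0 = 0<* (bound>0 x>0) (bound>0 y>0)
    ; bound≤  = N , λ n N≤n → let a≤x , b≤y = h n N≤n in *-mono-≤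
        (ℚ.≤-trans (ℚ.<⇒≤ (bound>0 x>0)) a≤x) (ℚ.<⇒≤ (bound>0 y>0)) a≤x b≤y
    }
    where
    both = bound≤ x>0 ∧ bound≤ y>0
    N = proj₁ both
    h = proj₂ both

------------------------------------------------------------------------
-- Ordered matchings

Edge : ℕ → Set
Edge v = Fin v × Fin v

left right : ∀ {v} → Edge v → Fin v
left  = proj₁
right = proj₂

-- A set of edges {a, b} with a < b, pairwise disjoint, is listed in
-- increasing order of a.  Hence each matching is exactly one list, and its
-- sub-matchings are exactly the sublists of that list.
record IsMatching (n : ℕ) (M : List (Edge (2 ℕ.* n))) : Set where
  field
    size     : length M ≡ n
    oriented : All (λ (a , b) → a Fin.< b) M
    numbered : Linked Fin._<_ (map left M)
    disjoint : Unique (map left M ++ map right M)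

Line Stack Wave : ∀ {v} → Pred (List (Edge v)) 0ℓ
Line  M = Linked Fin._<_ (concatMap (λ (a , b) → a ∷ b ∷ []) M)
Stack M = Linked Fin._<_ (map left M ++ reverse (map right M))
Wave  M = Linked Fin._<_ (map left M ++ map right M)

ContainsOfSizeAtLeast : ∀ {v} → Pred (List (Edge v)) 0ℓ → ℝ → Pred (List (Edge v)) 0ℓ
ContainsOfSizeAtLeast P x M = ∃[ S ] (S ⊆ M) × P S × (x ≤ fromℕ (length S))

------------------------------------------------------------------------
-- Uniformly random ordered matchings

isMatching? : ∀ n → Decidable (IsMatching n)
isMatching? n M = map′
  (λ (s , o , m , d) → record { size = s ; oriented = o ; numbered = m ; disjoint = d })
  (λ m → let open IsMatching m in size , oriented , numbered , disjoint)
  (length M ℕ.≟ n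
    ×-dec All.all? (λ (a , b) → a Fin.<? b) M
    ×-dec Linked.linked? Fin._<?_ (map left M)
    ×-dec unique? (map left M ++ map right M))
  where open import Data.List.Relation.Unary.Unique.DecPropositional Fin._≟_ using (unique?)

listsOver : {A : Set} → List A → ℕ → List (List A)
listsOver xs zero    = [] ∷ []
listsOver xs (suc k) = cartesianProductWith _∷_ xs (listsOver xs k)

matchings : ∀ n → List (List (Edge (2 ℕ.* n)))
matchings n = filter (isMatching? n) (listsOver (cartesianProduct (allFin _) (allFin _)) n)

∈-listsOver : {A : Set} {xs : List A} → (∀ x → x ∈ xs) → ∀ ys → ys ∈ listsOver xs (length ys)
∈-listsOver all []       = here refl
∈-listsOver all (y ∷ ys) = ∈-cartesianProductWith⁺ _∷_ (all y) (∈-listsOver all ys)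

∈-matchings : ∀ n {M} → IsMatching n M → M ∈ matchings n
∈-matchings n {M} m = ∈-filter⁺ (isMatching? n)
  (subst (λ k → M ∈ listsOver (cartesianProduct (allFin _) (allFin _)) k) (IsMatching.size m)
    (∈-listsOver (λ (a , b) → ∈-cartesianProduct⁺ (∈-allFin a) (∈-allFin b)) M))
  m

canonical : ∀ n → List (Edge (2 ℕ.* n))
canonical n = map (λ i → i Fin.↑ˡ (n ℕ.+ 0) , n Fin.↑ʳ (i Fin.↑ˡ 0)) (allFin n)

canonical-isMatching : ∀ n → IsMatching n (canonical n)
canonical-isMatching n = record
  { size     = trans (length-map _ (allFin n)) (length-tabulate id)
  ; oriented = All.map⁺ (All.tabulate⁺ {f = id} λ i → a<b i i)
  ; numbered = subst (Linked Fin._<_) (map-∘ (allFin n)) (Linked.map⁺ (Linked.AllPairs⇒Linked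
      (AllPairs.tabulate⁺-< {f = id} λ {i} {j} i<j → subst₂ ℕ._<_
        (sym (Fin.toℕ-↑ˡ i (n ℕ.+ 0))) (sym (Fin.toℕ-↑ˡ j (n ℕ.+ 0))) i<j)))
  ; disjoint = Unique.++⁺
      (subst Unique (map-∘ (allFin n)) (Unique.map⁺ (Fin.↑ˡ-injective (n ℕ.+ 0) _ _) (Unique.allFin⁺ n)))
      (subst Unique (map-∘ (allFin n)) (Unique.map⁺
        (λ eq → Fin.↑ˡ-injective 0 _ _ (Fin.↑ʳ-injective n _ _ eq)) (Unique.allFin⁺ n)))
      λ (l , r) → apart
        (subst (_ ∈_) (sym (map-∘ (allFin n))) l) (subst (_ ∈_) (sym (map-∘ (allFin n))) r)
  }
  where
  a b : Fin n → Fin (2 ℕ.* n)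
  a i = i Fin.↑ˡ (n ℕ.+ 0)
  b i = n Fin.↑ʳ (i Fin.↑ˡ 0)
  a<b : ∀ i j → a i Fin.< b j
  a<b i j = subst₂ ℕ._<_ (sym (Fin.toℕ-↑ˡ i (n ℕ.+ 0))) (sym (Fin.toℕ-↑ʳ n (j Fin.↑ˡ 0)))
    (ℕ.<-≤-trans (Fin.toℕ<n i) (ℕ.m≤m+n n _))
  apart : ∀ {v} {A : Set} → v ∈ map a (allFin n) → v ∈ map b (allFin n) → A
  apart p q with ∈-map⁻ a p | ∈-map⁻ b q
  ... | i , _ , refl | j , _ , eq = contradiction (cong Fin.toℕ eq) (ℕ.<⇒≢ (a<b i j))

-- The proportion of matchings satisfying P, each being enumerated exactly
-- once.  It does not depend on which decision procedure for P is given.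
Pr : ∀ n {P : Pred (List (Edge (2 ℕ.* n))) 0ℓ} → Decidable P → ℚ
Pr n P? = + length (filter P? (matchings n)) ℚ./ length (matchings n)
  where instance matchings-nonEmpty = ℕ.>-nonZero (∈-length (∈-matchings n (canonical-isMatching n)))

{-# OPTIONS --safe #-}
module Submission where

-- Expose the partners of vertices one at a time, always asking whether the
-- partner lies in a window of t unexposed vertices; the partner is uniform, so
-- this succeeds with probability at least t / 2n whatever happened before.
-- Each structure has a strategy in which every success extends it by an edge:
-- * for waves and stacks, expose the vertices below 2m from right to left and
--   let the window move through the other vertices, leftwards for a wave and
--   rightwards for a stack;
-- * for lines, expose from right to left and take as window the t unexposed
--   vertices next to the current one.
-- If k successes are missing when m partners remain, the weight 2 ^ k has
-- expectation at most 2 ^ K (1 - t / 4n) ^ m in the end, which bounds the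
-- probability of falling short of K successes.  With t = n / K and m about n / 3
-- this tends to 0 provided K tends to infinity and 12 K² < n stays true with a
-- margin.  As 2 e² > 14 > 13, K = √n / (e √2) qualifies, and it exceeds √n / 8.

open import Data.Bool.Base using (true; false)
open import Data.Fin.Base as Fin using (Fin)
import Data.Fin.Properties as Fin
open import Data.Integer.Base as ℤ using (+_)
import Data.Integer.Properties as ℤ
open import Data.List.Base
  using (List; []; _∷_; _++_; length; map; filter; reverse; tabulate; allFin; cartesianProduct)
open import Data.List.Membership.Propositional using (_∈_; _∉_)
open import Data.List.Membership.Propositional.Properties
  using (∈-allFin; ∈-filter⁺; ∈-filter⁻; ∈-length; ∈-map⁺; ∈-++⁺ˡ; ∈-++⁺ʳ; ∈-tabulate⁻)
open import Data.List.Properties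
  using (length-map; length-tabulate; length-++; length-filter; filter-none; map-cong; unfold-reverse; ∷-injective)
open import Data.List.Relation.Binary.Permutation.Propositional as ↭ using (_↭_; ↭⇒↭ₛ)
import Data.List.Relation.Binary.Permutation.Propositional.Properties as ↭
import Data.List.Relation.Binary.Permutation.Setoid.Properties as ↭ₛ
open import Data.List.Relation.Binary.Pointwise using (Pointwise-≡⇒≡)
open import Data.List.Relation.Binary.Sublist.Heterogeneous.Properties using (toPointwise)
open import Data.List.Relation.Binary.Sublist.Propositional using (_⊆_; []; _∷_; _∷ʳ_; minimum)
open import Data.List.Relation.Unary.All as All using (All; []; _∷_)
import Data.List.Relation.Unary.All.Properties as All
open import Data.List.Relation.Unary.AllPairs as AllPairs using (AllPairs; []; _∷_)
import Data.List.Relation.Unary.AllPairs.Properties as AllPairs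
open import Data.List.Relation.Unary.Any using (here; there)
open import Data.List.Relation.Unary.Linked as Linked using (Linked; []; [-]; _∷_)
import Data.List.Relation.Unary.Linked.Properties as Linked
open import Data.List.Relation.Unary.Unique.Propositional using (Unique)
import Data.List.Relation.Unary.Unique.Propositional.Properties as Unique
import Data.List.Sort as Sort
open import Data.Nat.Base as ℕ using (ℕ; zero; suc; s≤s; z≤n)
import Data.Nat.DivMod as ℕ
open import Data.Nat.ListAction using (sum)
import Data.Nat.Properties as ℕ
open import Algebra.Properties.CommutativeSemigroup ℕ.+-commutativeSemigroup using (interchange)
open import Data.Nat.Solver using (module +-*-Solver)
open import Data.Product.Base using (Σ-syntax; ∃-syntax; _×_; _,_; proj₁; proj₂; uncurry)
open import Data.Product.Properties using (≡-dec)
open import Data.Rational.Base as ℚ using (ℚ; 0ℚ; 1ℚ; ½; _/_)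
import Data.Rational.Properties as ℚ
import Data.Rational.Solver as ℚS
open import Data.Rational.Unnormalised.Base as ℚᵘ using (mkℚᵘ)
import Data.Rational.Unnormalised.Properties as ℚᵘ
open import Data.Sum.Base as Sum using (_⊎_; inj₁; inj₂)
open import Data.Unit.Base using (⊤; tt)
open import Function.Base using (_∘_; id; flip; _on_)
open import Level using (0ℓ)
open import Relation.Binary.Core using (Rel)
import Relation.Binary.Construct.On as On
open import Relation.Binary.Definitions using (Irreflexive; Transitive)
open import Relation.Binary.PropositionalEquality
  using (_≡_; _≢_; refl; sym; trans; cong; cong₂; subst; subst₂; setoid; module ≡-Reasoning)
open import Relation.Nullary
  using (Dec; yes; no; ¬_; ¬?; _because_; _×-dec_; _⊎-dec_; contradiction)
open import Relation.Nullary.Decidable using (map′; from-yes)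
open import Relation.Unary using (Pred; Decidable)
open import Defs

-- The constant 12 comes from a budget of vertices. A success halves the weight, so a success
-- probability p multiplies its expectation by 1 - p/2. With p = t / 2n and t = n / K, about 4K
-- exposures halve it, hence about 4K² exposures outweigh the initial 2 ^ K. For waves and stacks an
-- exposure may use up two vertices on the left and one on the right, and a success a window of t,
-- so 3m + Kt ≤ 2n is required; Kt = n leaves n for 3m = 12K². The strategies know nothing of e: the
-- numerical fit needs only 8/3 ≤ e ≤ 3 and 7/5 ≤ √2 ≤ 2. Conditional probabilities become counts,
-- because the number of matchings containing given disjoint edges depends only on how many edges
-- are given. A further obstacle is constructive: the event must come with a decision procedure,
-- although comparing an arbitrary Cauchy real with an integer is undecidable. The freedom in ε is
-- spent on making the first threshold an integer, and √n / 8 ≤ L is equivalent to n ≤ 64L².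

private variable
  A B : Set

-- Counting in lists

𝟙 : {P : Set} → Dec P → ℕ
𝟙 (true  because _) = 1
𝟙 (false because _) = 0

𝟙-yes : {P : Set} (p? : Dec P) → P → 𝟙 p? ≡ 1
𝟙-yes (yes _) _ = refl
𝟙-yes (no ¬p) p = contradiction p ¬p

𝟙-no : {P : Set} (p? : Dec P) → ¬ P → 𝟙 p? ≡ 0
𝟙-no (yes p) ¬p = contradiction p ¬p
𝟙-no (no _)  _  = refl

∑ : (A → ℕ) → List A → ℕ
∑ f = sum ∘ map f

∑-+ : ∀ (f g : A → ℕ) xs → ∑ (λ x → f x ℕ.+ g x) xs ≡ ∑ f xs ℕ.+ ∑ g xs
∑-+ f g []       = refl
∑-+ f g (x ∷ xs) = trans (cong (f x ℕ.+ g x ℕ.+_) (∑-+ f g xs)) (interchange (f x) (g x) _ _)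

∑-*ʳ : ∀ (f : A → ℕ) c xs → ∑ (λ x → f x ℕ.* c) xs ≡ ∑ f xs ℕ.* c
∑-*ʳ f c []       = refl
∑-*ʳ f c (x ∷ xs) = trans (cong (f x ℕ.* c ℕ.+_) (∑-*ʳ f c xs)) (sym (ℕ.*-distribʳ-+ c (f x) _))

∑-mono : ∀ {f g : A → ℕ} → (∀ x → f x ℕ.≤ g x) → ∀ xs → ∑ f xs ℕ.≤ ∑ g xs
∑-mono h []       = z≤n
∑-mono h (x ∷ xs) = ℕ.+-mono-≤ (h x) (∑-mono h xs)

∑-const : ∀ {f : A → ℕ} {c} → (∀ x → f x ≡ c) → ∀ xs → ∑ f xs ≡ length xs ℕ.* c
∑-const h []       = refl
∑-const h (x ∷ xs) = cong₂ ℕ._+_ (h x) (∑-const h xs)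

count : {P : Pred A 0ℓ} → Decidable P → List A → ℕ
count P? = length ∘ filter P?

count-∷ : {P : Pred A 0ℓ} (P? : Decidable P) → ∀ x xs → count P? (x ∷ xs) ≡ 𝟙 (P? x) ℕ.+ count P? xs
count-∷ P? x xs with P? x
... | yes _ = refl
... | no  _ = refl

count-∑ : {P : Pred A 0ℓ} (P? : Decidable P) → ∀ xs → count P? xs ≡ ∑ (𝟙 ∘ P?) xs
count-∑ P? []       = refl
count-∑ P? (x ∷ xs) = trans (count-∷ P? x xs) (cong (𝟙 (P? x) ℕ.+_) (count-∑ P? xs))

count-none : {P : Pred A 0ℓ} (P? : Decidable P) → ∀ {xs} → (∀ x → x ∈ xs → ¬ P x) → count P? xs ≡ 0
count-none P? h = cong length (filter-none P? (All.tabulate λ {x} → h x))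

count-complement : {P : Pred A 0ℓ} (P? : Decidable P) → ∀ xs → count P? xs ℕ.+ count (¬? ∘ P?) xs ≡ length xs
count-complement P? [] = refl
count-complement P? (x ∷ xs) with P? x
... | yes _ = cong suc (count-complement P? xs)
... | no  _ = trans (ℕ.+-suc _ _) (cong suc (count-complement P? xs))

count-unique : {P : Pred A 0ℓ} (P? : Decidable P) → ∀ {x xs} → Unique xs → x ∈ xs → P x →
  (∀ y → y ∈ xs → P y → y ≡ x) → count P? xs ≡ 1
count-unique P? {x} (x∉xs ∷ _) (here refl) p h =
  trans (count-∷ P? x _) (cong₂ ℕ._+_ (𝟙-yes (P? x) p)
    (count-none P? λ y y∈xs q → All.lookup x∉xs y∈xs (sym (h y (there y∈xs) q))))
count-unique P? (y∉xs ∷ xs!) (there x∈xs) p h =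
  trans (count-∷ P? _ _) (cong₂ ℕ._+_
    (𝟙-no (P? _) λ q → All.lookup y∉xs x∈xs (h _ (here refl) q))
    (count-unique P? xs! x∈xs p λ z z∈xs → h z (there z∈xs)))

-- Interchange of the two summations over the relation `R`. In both uses an element satisfying `P`
-- is related to exactly one `y`, so this splits a count into classes.
double-count : {R : B → A → Set} {P : Pred A 0ℓ} (P? : Decidable P) (R? : ∀ y x → Dec (R y x)) →
  ∀ xs ys → (∀ x → x ∈ xs → 𝟙 (P? x) ≡ count (λ y → R? y x) ys) →
  count P? xs ≡ ∑ (λ y → count (R? y) xs) ys
double-count P? R? [] ys h = sym (trans (∑-const (λ _ → refl) ys) (ℕ.*-zeroʳ (length ys)))
double-count P? R? (x ∷ xs) ys h = begin
  count P? (x ∷ xs)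
    ≡⟨ count-∷ P? x xs ⟩
  𝟙 (P? x) ℕ.+ count P? xs
    ≡⟨ cong₂ ℕ._+_ (trans (h x (here refl)) (count-∑ _ ys))
         (double-count P? R? xs ys λ y y∈xs → h y (there y∈xs)) ⟩
  ∑ (λ y → 𝟙 (R? y x)) ys ℕ.+ ∑ (λ y → count (R? y) xs) ys
    ≡⟨ ∑-+ _ _ ys ⟨
  ∑ (λ y → 𝟙 (R? y x) ℕ.+ count (R? y) xs) ys
    ≡⟨ cong sum (map-cong (λ y → count-∷ (R? y) x xs) ys) ⟨
  ∑ (λ y → count (R? y) (x ∷ xs)) ys ∎
  where open ≡-Reasoning

module _ {v : ℕ} where

  open import Data.List.Membership.DecPropositional (Fin._≟_ {v}) public using (_∈?_; _∉?_)

  count-∈ : ∀ {xs} → Unique xs → count (_∈? xs) (allFin v) ≡ length xs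
  count-∈ {xs} xs! = begin
    count (_∈? xs) (allFin v)
      ≡⟨ double-count (_∈? xs) (λ x w → w Fin.≟ x) (allFin v) xs (λ w _ → once w) ⟩
    ∑ (λ x → count (Fin._≟ x) (allFin v)) xs
      ≡⟨ ∑-const (λ x → count-unique (Fin._≟ x) (Unique.allFin⁺ v) (∈-allFin x) refl λ _ _ → id) xs ⟩
    length xs ℕ.* 1
      ≡⟨ ℕ.*-identityʳ (length xs) ⟩
    length xs ∎
    where
    open ≡-Reasoning
    once : ∀ w → 𝟙 (w ∈? xs) ≡ count (w Fin.≟_) xs
    once w with w ∈? xs
    ... | yes w∈xs = sym (count-unique (w Fin.≟_) xs! w∈xs refl λ _ _ → sym)
    ... | no  w∉xs = sym (count-none (w Fin.≟_) λ { _ y∈xs refl → w∉xs y∈xs })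

  count-∉ : ∀ {xs} → Unique xs → length xs ℕ.+ count (_∉? xs) (allFin v) ≡ v
  count-∉ {xs} xs! = begin
    length xs ℕ.+ count (_∉? xs) (allFin v)
      ≡⟨ cong (ℕ._+ count (_∉? xs) (allFin v)) (count-∈ xs!) ⟨
    count (_∈? xs) (allFin v) ℕ.+ count (_∉? xs) (allFin v)
      ≡⟨ count-complement (_∈? xs) (allFin v) ⟩
    length (allFin v)
      ≡⟨ length-tabulate id ⟩
    v ∎
    where open ≡-Reasoning

  unique-full : ∀ {xs} → Unique xs → length xs ≡ v → ∀ w → w ∈ xs
  unique-full {xs} xs! eq w with w ∈? xs
  ... | yes w∈xs = w∈xs
  ... | no  w∉xs = contradiction (∈-length (∈-filter⁺ (_∉? xs) (∈-allFin w) w∉xs))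
    (ℕ.≤⇒≯ (ℕ.≤-reflexive (ℕ.+-cancelˡ-≡ v (count (_∉? xs) (allFin v)) 0
      (trans (trans (cong (ℕ._+ count (_∉? xs) (allFin v)) (sym eq)) (count-∉ xs!)) (sym (ℕ.+-identityʳ v))))))

  unique-not-full : ∀ {xs} → Unique xs → length xs ℕ.< v → ∃[ w ] w ∉ xs
  unique-not-full {xs} xs! lt with Fin.all? (_∈? xs)
  ... | no  ¬all = Fin.¬∀⟶∃¬ v _ (_∈? xs) ¬all
  ... | yes all  = contradiction
    (trans (sym (ℕ.+-identityʳ _)) (trans
      (cong (length xs ℕ.+_) (sym (count-none (_∉? xs) {allFin v} λ w _ w∉xs → w∉xs (all w))))
      (count-∉ xs!)))
    (ℕ.<⇒≢ lt)

-- Matchings containing given edges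

Unique-resp-↭ : ∀ {xs ys : List A} → xs ↭ ys → Unique xs → Unique ys
Unique-resp-↭ xs↭ys = ↭ₛ.Unique-resp-↭ (setoid _) (↭⇒↭ₛ xs↭ys)

-- A strictly sorted list is determined by its elements, so membership alone yields the sublist
-- relation by which sub-matchings are defined.
sorted-⊆ : {R : Rel A 0ℓ} → Irreflexive _≡_ R → Transitive R → ∀ {xs ys} →
  AllPairs R xs → AllPairs R ys → All (_∈ ys) xs → xs ⊆ ys
sorted-⊆ irr tr {[]} {ys} _ _ _ = minimum ys
sorted-⊆ {R = R} irr tr {x ∷ xs} {y ∷ ys} (Rx ∷ Rxs) (Ry ∷ Rys) (here refl ∷ xs⊆) =
  refl ∷ sorted-⊆ irr tr Rxs Rys (All.zipWith later (Rx , xs⊆))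
  where
  later : ∀ {z} → R y z × z ∈ y ∷ ys → z ∈ ys
  later (Ryz , here refl)  = contradiction Ryz (irr refl)
  later (Ryz , there z∈ys) = z∈ys
sorted-⊆ {R = R} irr tr {x ∷ xs} {y ∷ ys} (Rx ∷ Rxs) (Ry ∷ Rys) (there x∈ys ∷ xs⊆) =
  y ∷ʳ sorted-⊆ irr tr (Rx ∷ Rxs) Rys (x∈ys ∷ All.zipWith later (Rx , xs⊆))
  where
  later : ∀ {z} → R x z × z ∈ y ∷ ys → z ∈ ys
  later (Rxz , here refl)  = contradiction (tr (All.lookup Ry x∈ys) Rxz) (irr refl)
  later (Rxz , there z∈ys) = z∈ys

module _ {v : ℕ} where

  Joins : List (Edge v) → Fin v → Fin v → Set
  Joins M u w = (u , w) ∈ M ⊎ (w , u) ∈ M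

  joins? : ∀ M u w → Dec (Joins M u w)
  joins? M u w = ((u , w) ∈E? M) ⊎-dec ((w , u) ∈E? M)
    where open import Data.List.Membership.DecPropositional (≡-dec (Fin._≟_ {v}) (Fin._≟_ {v})) renaming (_∈?_ to _∈E?_)

  -- The edges of C are unoriented.
  Contains : List (Edge v) → Pred (List (Edge v)) 0ℓ
  Contains C M = All (uncurry (Joins M)) C

  contains? : ∀ C → Decidable (Contains C)
  contains? C M = All.all? (uncurry (joins? M)) C

  -- Endpoints are interleaved so that exposing one more edge only puts two vertices in front;
  -- `ends-↭` leads back to the arrangement in `IsMatching`.
  ends : List (Edge v) → List (Fin v)
  ends []            = []
  ends ((a , b) ∷ C) = a ∷ b ∷ ends C

  length-ends : ∀ C → length (ends C) ≡ 2 ℕ.* length C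
  length-ends []      = refl
  length-ends (_ ∷ C) = trans (cong (2 ℕ.+_) (length-ends C)) (sym (ℕ.*-suc 2 (length C)))

  ends-↭ : ∀ C → ends C ↭ map left C ++ map right C
  ends-↭ []            = ↭.refl
  ends-↭ ((a , b) ∷ C) = ↭.prep a (↭.trans (↭.prep b (ends-↭ C))
    (↭.↭-sym (↭.shift b (map left C) (map right C))))

  ∈-endsˡ : ∀ {a b C} → (a , b) ∈ C → a ∈ ends C
  ∈-endsˡ (here refl) = here refl
  ∈-endsˡ (there e∈C) = there (there (∈-endsˡ e∈C))

  ∈-endsʳ : ∀ {a b C} → (a , b) ∈ C → b ∈ ends C
  ∈-endsʳ (here refl) = there (here refl)
  ∈-endsʳ (there e∈C) = there (there (∈-endsʳ e∈C))

  -- The partner is read off from `C` before `M` is chosen, so one vertex serves all completions of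
  -- `C`. With `C` a matching itself it also gives `partner`.
  ends⇒joins : ∀ {u} C → u ∈ ends C → ∃[ w ] w ∈ ends C × (∀ {M} → Contains C M → Joins M u w)
  ends⇒joins ((a , b) ∷ C) (here refl)         = b , there (here refl) , All.head
  ends⇒joins ((a , b) ∷ C) (there (here refl)) = a , here refl , Sum.swap ∘ All.head
  ends⇒joins ((a , b) ∷ C) (there (there u∈C)) with ends⇒joins C u∈C
  ... | w , w∈C , joins = w , there (there w∈C) , joins ∘ All.tail

  contains-self : ∀ C → Contains C C
  contains-self C = All.tabulate inj₁

  joins-ends : ∀ {M u w} → Joins M u w → u ∈ ends M
  joins-ends (inj₁ e∈M) = ∈-endsˡ e∈M
  joins-ends (inj₂ e∈M) = ∈-endsʳ e∈M

  joins-unique : ∀ {M u w w′} → Unique (ends M) → Joins M u w → Joins M u w′ → w ≡ w′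
  joins-unique {[]} _ (inj₁ ())
  joins-unique {[]} _ (inj₂ ())
  joins-unique {(a , b) ∷ M} {u} ((_ ∷ a∉) ∷ b∉ ∷ M!) j j′ with split j | split j′
    where
    split : ∀ {w} → Joins ((a , b) ∷ M) u w →
      (u ≡ a × w ≡ b) ⊎ (w ≡ a × u ≡ b) ⊎ Joins M u w
    split (inj₁ (here refl)) = inj₁ (refl , refl)
    split (inj₁ (there e∈M)) = inj₂ (inj₂ (inj₁ e∈M))
    split (inj₂ (here refl)) = inj₂ (inj₁ (refl , refl))
    split (inj₂ (there e∈M)) = inj₂ (inj₂ (inj₂ e∈M))
  ... | inj₁ (_ , refl)           | inj₁ (_ , refl)           = refl
  ... | inj₁ (refl , refl)        | inj₂ (inj₁ (refl , refl)) = refl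
  ... | inj₁ (refl , _)           | inj₂ (inj₂ k)             = contradiction refl (All.lookup a∉ (joins-ends k))
  ... | inj₂ (inj₁ (refl , refl)) | inj₁ (refl , refl)        = refl
  ... | inj₂ (inj₁ (refl , _))    | inj₂ (inj₁ (refl , _))    = refl
  ... | inj₂ (inj₁ (_ , refl))    | inj₂ (inj₂ k)             = contradiction refl (All.lookup b∉ (joins-ends k))
  ... | inj₂ (inj₂ k)             | inj₁ (refl , _)           = contradiction refl (All.lookup a∉ (joins-ends k))
  ... | inj₂ (inj₂ k)             | inj₂ (inj₁ (_ , refl))    = contradiction refl (All.lookup b∉ (joins-ends k))
  ... | inj₂ (inj₂ k)             | inj₂ (inj₂ k′)            = joins-unique M! k k′

  Oriented : Pred (Edge v) 0ℓ
  Oriented (a , b) = a Fin.< b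

  orient : Edge v → Edge v
  orient (a , b) with a Fin.<? b
  ... | yes _ = a , b
  ... | no  _ = b , a

  orient-oriented : ∀ a b → a ≢ b → Oriented (orient (a , b))
  orient-oriented a b a≢b with a Fin.<? b
  ... | yes a<b = a<b
  ... | no  a≮b = ℕ.≤∧≢⇒< (ℕ.≮⇒≥ a≮b) (a≢b ∘ sym ∘ Fin.toℕ-injective)

  orient-∈⇒joins : ∀ {M} a b → orient (a , b) ∈ M → Joins M a b
  orient-∈⇒joins a b e∈M with a Fin.<? b
  ... | yes _ = inj₁ e∈M
  ... | no  _ = inj₂ e∈M

  joins⇒orient-∈ : ∀ {M a b} → All Oriented M → Joins M a b → orient (a , b) ∈ M
  joins⇒orient-∈ {a = a} {b} o j with a Fin.<? b | j
  ... | yes _   | inj₁ e∈M = e∈M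
  ... | yes a<b | inj₂ e∈M = contradiction a<b (ℕ.<⇒≯ (All.lookup o e∈M))
  ... | no  a≮b | inj₁ e∈M = contradiction (All.lookup o e∈M) a≮b
  ... | no  _   | inj₂ e∈M = e∈M

  ends-orient : ∀ C → ends (map orient C) ↭ ends C
  ends-orient [] = ↭.refl
  ends-orient ((a , b) ∷ C) with a Fin.<? b
  ... | yes _ = ↭.prep a (↭.prep b (ends-orient C))
  ... | no  _ = ↭.swap b a (ends-orient C)

  distinct-ends : ∀ {C} → Unique (ends C) → All (λ (a , b) → a ≢ b) C
  distinct-ends {[]}    _                     = []
  distinct-ends {_ ∷ C} ((a≢b ∷ _) ∷ _ ∷ C!) = a≢b ∷ distinct-ends C!

joins-oriented : ∀ {v} {M : List (Edge v)} {a b} → All Oriented M → a Fin.< b → Joins M a b → (a , b) ∈ M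
joins-oriented o a<b (inj₁ e∈M) = e∈M
joins-oriented o a<b (inj₂ e∈M) = contradiction a<b (ℕ.<⇒≯ (All.lookup o e∈M))

unique-∷ : {x : A} {xs : List A} → x ∉ xs → Unique xs → Unique (x ∷ xs)
unique-∷ x∉xs xs! = All.¬Any⇒All¬ _ x∉xs ∷ xs!

expose-unique : ∀ {v u w} {C : List (Edge v)} → u ∉ ends C → w ∉ u ∷ ends C →
  Unique (ends C) → Unique (u ∷ w ∷ ends C)
expose-unique u∉C w∉ C! = unique-∷ (λ { (here u≡w) → w∉ (here (sym u≡w)) ; (there u∈C) → u∉C u∈C })
  (unique-∷ (w∉ ∘ there) C!)

-- This is (2r - 1)!!, the number of matchings on 2r vertices.
double-factorial : ℕ → ℕ
double-factorial zero    = 1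
double-factorial (suc r) = suc (2 ℕ.* r) ℕ.* double-factorial r

module _ {n : ℕ} where

  module _ {M : List (Edge (2 ℕ.* n))} (m : IsMatching n M) where

    open IsMatching m

    matching-ends-unique : Unique (ends M)
    matching-ends-unique = Unique-resp-↭ (↭.↭-sym (ends-↭ M)) disjoint

    matching-sorted : AllPairs (Fin._<_ on left) M
    matching-sorted = Linked.Linked⇒AllPairs ℕ.<-trans (Linked.map⁻ numbered)

    partner : ∀ u → ∃[ w ] Joins M u w
    partner u with ends⇒joins M (unique-full matching-ends-unique
      (trans (length-ends M) (cong (2 ℕ.*_) size)) u)
    ... | w , _ , joins = w , joins (contains-self M)

    ⊆-matching : ∀ {S} → AllPairs (Fin._<_ on left) S → All (_∈ M) S → S ⊆ M
    ⊆-matching S< = sorted-⊆ (λ { refl → ℕ.<-irrefl refl }) ℕ.<-trans S< matching-sorted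

module _ (n : ℕ) where

  ∈-matchings⇒ : ∀ {M} → M ∈ matchings n → IsMatching n M
  ∈-matchings⇒ = λ M∈ → proj₂ (∈-filter⁻ (isMatching? n)
    {xs = listsOver (cartesianProduct (allFin _) (allFin _)) n} M∈)

  listsOver-unique : {xs : List A} → Unique xs → ∀ k → Unique (listsOver xs k)
  listsOver-unique xs! zero    = [] ∷ []
  listsOver-unique xs! (suc k) = Unique.cartesianProductWith⁺ _∷_ ∷-injective xs! (listsOver-unique xs! k)

  matchings-unique : Unique (matchings n)
  matchings-unique = Unique.filter⁺ (isMatching? n)
    (listsOver-unique (Unique.cartesianProduct⁺ (Unique.allFin⁺ _) (Unique.allFin⁺ _)) n)

  -- The unnormalised probability of `P` conditioned on the exposed edges. By `completions-total`
  -- the normalising factor depends only on the length of `C`, so no division is made.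
  completions : {P : Pred (List (Edge (2 ℕ.* n))) 0ℓ} → Decidable P → List (Edge (2 ℕ.* n)) → ℕ
  completions P? C = count (λ M → contains? C M ×-dec P? M) (matchings n)

  module _ {P : Pred (List (Edge (2 ℕ.* n))) 0ℓ} (P? : Decidable P) where

    -- Law of total probability: every matching gives `u` exactly one partner.
    expose-partner : ∀ u C → completions P? C ≡ ∑ (λ w → completions P? ((u , w) ∷ C)) (allFin (2 ℕ.* n))
    expose-partner u C = double-count _ (λ w M → contains? ((u , w) ∷ C) M ×-dec P? M)
      (matchings n) (allFin _) λ M M∈ → once M (∈-matchings⇒ M∈)
      where
      once : ∀ M → IsMatching n M → 𝟙 (contains? C M ×-dec P? M) ≡
        count (λ w → contains? ((u , w) ∷ C) M ×-dec P? M) (allFin _)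
      once M m with contains? C M ×-dec P? M
      ... | yes (c , p) = let w , j = partner m u in
        sym (count-unique (λ w → contains? ((u , w) ∷ C) M ×-dec P? M) (Unique.allFin⁺ _) (∈-allFin w) (j ∷ c , p)
          λ { w′ _ (j′ ∷ _ , _) → joins-unique (matching-ends-unique m) j′ j })
      ... | no ¬cp = sym (count-none (λ w → contains? ((u , w) ∷ C) M ×-dec P? M) {allFin _}
          λ { w _ (_ ∷ c , p) → ¬cp (c , p) })

    not-exposed-twice : ∀ {u w C} → u ∉ ends C → w ∈ u ∷ ends C → completions P? ((u , w) ∷ C) ≡ 0
    not-exposed-twice {u} {w} {C} u∉C w∈ = count-none (λ M → contains? ((u , w) ∷ C) M ×-dec P? M) 
      λ { M M∈ (j ∷ c , _) → clash (∈-matchings⇒ M∈) w∈ j c }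
      where
      clash : ∀ {M} → IsMatching n M → w ∈ u ∷ ends C → Joins M u w → ¬ Contains C M
      clash m (here refl) (inj₁ e∈M) c = ℕ.<-irrefl refl (All.lookup (IsMatching.oriented m) e∈M)
      clash m (here refl) (inj₂ e∈M) c = ℕ.<-irrefl refl (All.lookup (IsMatching.oriented m) e∈M)
      clash m (there w∈C) j c with ends⇒joins C w∈C
      ... | x , x∈C , k with joins-unique (matching-ends-unique m) (Sum.swap j) (k c)
      ...   | refl = u∉C x∈C

    completions-none : ∀ {C} → (∀ {M} → IsMatching n M → Contains C M → ¬ P M) → completions P? C ≡ 0
    completions-none {C} h = count-none (λ M → contains? C M ×-dec P? M)
      λ M M∈ (c , p) → h (∈-matchings⇒ M∈) c p

  private
    decTotalOrder = On.decTotalOrder (Fin.≤-decTotalOrder (2 ℕ.* n)) left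
    module S = Sort decTotalOrder

  -- The canonical list of a complete set of unoriented edges; it will be the only matching
  -- containing them.
  assemble : List (Edge (2 ℕ.* n)) → List (Edge (2 ℕ.* n))
  assemble C = S.sort (map orient C)

  module _ {C : List (Edge (2 ℕ.* n))} (C! : Unique (ends C)) (size : length C ≡ n) where

    private
      assemble-ends : Unique (map left (assemble C) ++ map right (assemble C))
      assemble-ends = Unique-resp-↭
        (↭.trans (↭.↭-sym (ends-orient C)) (↭.trans (ends-↭ (map orient C))
          (↭.↭-sym (↭.++⁺ (↭.map⁺ left s) (↭.map⁺ right s)))))
        C!
        where s = S.sort-↭ (map orient C)

      assemble-size : length (assemble C) ≡ n
      assemble-size = trans (↭.↭-length (S.sort-↭ (map orient C))) (trans (length-map orient C) size)

    assemble-isMatching : IsMatching n (assemble C)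
    assemble-isMatching = record
      { size     = assemble-size
      ; oriented = ↭.All-resp-↭ (↭.↭-sym (S.sort-↭ (map orient C)))
          (All.map⁺ (All.map (λ {e} → orient-oriented (proj₁ e) (proj₂ e)) (distinct-ends C!)))
      -- Sorting gives only ≤ between neighbours; distinctness of the endpoints makes it strict.
      ; numbered = Linked.zipWith (λ (x≤y , x≢y) → ℕ.≤∧≢⇒< x≤y (x≢y ∘ Fin.toℕ-injective))
          ( Linked.map⁺ (S.sort-↗ (map orient C))
          , Linked.AllPairs⇒Linked (AllPairs-++ˡ (map left (assemble C)) assemble-ends))
      ; disjoint = assemble-ends
      }
      where
      AllPairs-++ˡ : ∀ xs {ys : List (Fin (2 ℕ.* n))} → Unique (xs ++ ys) → Unique xs
      AllPairs-++ˡ []       _         = []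
      AllPairs-++ˡ (x ∷ xs) (x∉ ∷ xs!) = All.++⁻ˡ xs x∉ ∷ AllPairs-++ˡ xs xs!

    assemble-contains : Contains C (assemble C)
    assemble-contains = All.tabulate λ {e} e∈C → orient-∈⇒joins (proj₁ e) (proj₂ e)
      (↭.∈-resp-↭ (↭.↭-sym (S.sort-↭ (map orient C))) (∈-map⁺ orient e∈C))

    assemble-only : ∀ {M} → IsMatching n M → Contains C M → M ≡ assemble C
    -- A sublist as long as the whole list is equal to it.
    assemble-only {M} m c = sym (Pointwise-≡⇒≡ (toPointwise
      (trans assemble-size (sym (IsMatching.size m)))
      (⊆-matching m (matching-sorted assemble-isMatching)
        (↭.All-resp-↭ (↭.↭-sym (S.sort-↭ (map orient C)))
          (All.map⁺ (All.map (joins⇒orient-∈ (IsMatching.oriented m)) c))))))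

  expose-length : ∀ r (C : List (Edge (2 ℕ.* n))) → length C ℕ.+ suc r ≡ n → suc (length C) ℕ.+ r ≡ n
  expose-length r C = trans (sym (ℕ.+-suc (length C) r))

  ends-not-full : ∀ (C : List (Edge (2 ℕ.* n))) r → length C ℕ.+ suc r ≡ n → length (ends C) ℕ.< 2 ℕ.* n
  ends-not-full C r eq = ℕ.≤-<-trans (ℕ.≤-reflexive (length-ends C))
    (ℕ.*-monoʳ-< 2 (ℕ.<-≤-trans (ℕ.m<m+n (length C) ℕ.z<s) (ℕ.≤-reflexive eq)))

  free-partners : ∀ r {u C} → u ∉ ends C → Unique (ends C) → length C ℕ.+ suc r ≡ n →
    ∑ (λ w → 𝟙 (w ∉? u ∷ ends C)) (allFin (2 ℕ.* n)) ≡ suc (2 ℕ.* r)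
  free-partners r {u} {C} u∉C C! eq = trans (sym (count-∑ (_∉? u ∷ ends C) (allFin _)))
    (ℕ.+-cancelˡ-≡ (suc (2 ℕ.* length C)) _ _ (begin
      suc (2 ℕ.* length C) ℕ.+ count (_∉? u ∷ ends C) (allFin (2 ℕ.* n))
        ≡⟨ cong (λ l → suc l ℕ.+ count (_∉? u ∷ ends C) (allFin (2 ℕ.* n))) (length-ends C) ⟨
      suc (length (ends C)) ℕ.+ count (_∉? u ∷ ends C) (allFin (2 ℕ.* n))
        ≡⟨ count-∉ (unique-∷ u∉C C!) ⟩
      2 ℕ.* n
        ≡⟨ cong (2 ℕ.*_) eq ⟨
      2 ℕ.* (length C ℕ.+ suc r)
        ≡⟨ solve 2 (λ c r → con 2 :* (c :+ (con 1 :+ r)) := con 1 :+ con 2 :* c :+ (con 1 :+ con 2 :* r))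
             refl (length C) r ⟩
      suc (2 ℕ.* length C) ℕ.+ suc (2 ℕ.* r) ∎))
    where
    open ≡-Reasoning
    open +-*-Solver

  all? : Decidable {A = List (Edge (2 ℕ.* n))} (λ _ → ⊤)
  all? _ = yes tt

  -- This is the uniformity of the partner whatever was exposed before: an unexposed vertex has 2r +
  -- 1 free candidates, and by induction each leaves equally many completions.
  completions-total : ∀ r {C} → Unique (ends C) → length C ℕ.+ r ≡ n →
    completions all? C ≡ double-factorial r
  completions-total zero {C} C! eq = count-unique (λ M → contains? C M ×-dec all? M) matchings-unique
    (∈-matchings n (assemble-isMatching C! size)) (assemble-contains C! size , tt)
    λ M M∈ (c , _) → assemble-only C! size (∈-matchings⇒ M∈) c
    where size = trans (sym (ℕ.+-identityʳ _)) eq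
  completions-total (suc r) {C} C! eq with unique-not-full C! (ends-not-full C r eq)
  ... | u , u∉C = begin
    completions all? C
      ≡⟨ expose-partner all? u C ⟩
    ∑ (λ w → completions all? ((u , w) ∷ C)) (allFin _)
      ≡⟨ cong sum (map-cong each (allFin _)) ⟩
    ∑ (λ w → 𝟙 (w ∉? u ∷ ends C) ℕ.* double-factorial r) (allFin _)
      ≡⟨ ∑-*ʳ (λ w → 𝟙 (w ∉? u ∷ ends C)) (double-factorial r) (allFin _) ⟩
    ∑ (λ w → 𝟙 (w ∉? u ∷ ends C)) (allFin _) ℕ.* double-factorial r
      ≡⟨ cong (ℕ._* double-factorial r) (free-partners r u∉C C! eq) ⟩
    suc (2 ℕ.* r) ℕ.* double-factorial r ∎
    where
    open ≡-Reasoning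
    each : ∀ w → completions all? ((u , w) ∷ C) ≡ 𝟙 (w ∉? u ∷ ends C) ℕ.* double-factorial r
    each w with w ∈? u ∷ ends C
    ... | no  w∉ = trans (completions-total r (expose-unique u∉C w∉ C!) (expose-length r C eq))
      (sym (ℕ.+-identityʳ _))
    ... | yes w∈ = not-exposed-twice all? {C = C} u∉C w∈

-- Exposing partners one at a time

count-mono : {P Q : Pred A 0ℓ} (P? : Decidable P) (Q? : Decidable Q) →
  (∀ {x} → P x → Q x) → ∀ xs → count P? xs ℕ.≤ count Q? xs
count-mono P? Q? h [] = z≤n
count-mono P? Q? h (x ∷ xs) with P? x | Q? x
... | yes _ | yes _ = s≤s (count-mono P? Q? h xs)
... | yes p | no ¬q = contradiction (h p) ¬q
... | no _  | yes _ = ℕ.m≤n⇒m≤1+n (count-mono P? Q? h xs)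
... | no _  | no _  = count-mono P? Q? h xs

module _ (n : ℕ) (P : Pred (List (Edge (2 ℕ.* n))) 0ℓ) (t : ℕ) where

  -- Forces k m C: once the edges of C have been exposed, P can be forced by
  -- exposing partners one at a time, as soon as k of the next m partners fall
  -- into a prescribed window of t unexposed vertices.
  data Forces : ℕ → ℕ → List (Edge (2 ℕ.* n)) → Set where
    won    : ∀ {m C} → (∀ {M} → IsMatching n M → Contains C M → P M) → Forces 0 m C
    -- Nothing is claimed about `P` here: the remaining weight 2 ^ k ≥ 1 pays for every completion.
    lapsed : ∀ {k C} → Forces k 0 C
    expose : ∀ {k m C} u W → u ∉ ends C → Unique W → length W ≡ t →
      (∀ {w} → w ∈ W → w ∉ u ∷ ends C) →
      (∀ w → w ∉ u ∷ ends C → Forces (suc k) m ((u , w) ∷ C)) →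
      (∀ w → w ∈ W → Forces k m ((u , w) ∷ C)) →
      Forces (suc k) (suc m) C

module _ (n : ℕ) {P : Pred (List (Edge (2 ℕ.* n))) 0ℓ} (P? : Decidable P) where

  exceptional : List (Edge (2 ℕ.* n)) → ℕ
  exceptional = completions n (¬? ∘ P?)

  exceptional≤total : ∀ r {C} → Unique (ends C) → length C ℕ.+ r ≡ n →
    exceptional C ℕ.≤ double-factorial r
  exceptional≤total r {C} C! eq = ℕ.≤-trans
    (count-mono (λ M → contains? C M ×-dec ¬? (P? M)) (λ M → contains? C M ×-dec all? n M)
      (λ (c , _) → c , tt) (matchings n))
    (ℕ.≤-reflexive (completions-total n r C! eq))

  -- Markov's inequality for the weight 2 ^ k, whose expectation each step
  -- multiplies by at most 1 - t / 4n = E / (E + t).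
  exceptional-bound : ∀ {E t} → E ℕ.+ t ≡ 4 ℕ.* n → ∀ {k m C} → Forces n P t k m C →
    ∀ r → Unique (ends C) → length C ℕ.+ r ≡ n →
    exceptional C ℕ.* (E ℕ.+ t) ℕ.^ m ℕ.≤ 2 ℕ.^ k ℕ.* E ℕ.^ m ℕ.* double-factorial r
  exceptional-bound {E} {t} D≡4n (won {m} {C} h) r C! eq = ℕ.≤-trans
    (ℕ.≤-reflexive (cong (ℕ._* (E ℕ.+ t) ℕ.^ m) (completions-none n (¬? ∘ P?) {C} λ m c ¬p → ¬p (h m c))))
    z≤n
  exceptional-bound {E} {t} D≡4n (lapsed {k} {C}) r C! eq = begin
    exceptional C ℕ.* 1            ≡⟨ ℕ.*-identityʳ _ ⟩
    exceptional C                ≤⟨ exceptional≤total r C! eq ⟩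
    double-factorial r           ≤⟨ ℕ.m≤n*m (double-factorial r) (2 ℕ.^ k ℕ.* 1) {{ℕ.m*n≢0 (2 ℕ.^ k) 1 {{ℕ.m^n≢0 2 k}}}} ⟩
    2 ℕ.^ k ℕ.* 1 ℕ.* double-factorial r ∎
    where open ℕ.≤-Reasoning
  exceptional-bound {E} {t} D≡4n (expose {C = C} u W u∉C W! W≡t W-free fail succeed) zero C! eq =
    contradiction (unique-full C! (trans (length-ends C) (cong (2 ℕ.*_) (trans (sym (ℕ.+-identityʳ _)) eq))) u) u∉C
  exceptional-bound {E} {t} D≡4n (expose {k} {m} {C} u W u∉C W! W≡t W-free fail succeed) (suc r) C! eq =
    -- With E = D - t the point is D (2R - t) ≤ 2R (D - t); D t β is added on both sides to avoid
    -- subtraction. It reduces to 2R ≤ D = 4n, that is, to the success probability t / R being at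
    -- least t / 2n.
    ℕ.+-cancelʳ-≤ (D ℕ.* (t ℕ.* β)) _ _ (begin
      exceptional C ℕ.* (D ℕ.* D ℕ.^ m) ℕ.+ D ℕ.* (t ℕ.* β)
        ≡⟨ solve 4 (λ x D y z → x :* (D :* y) :+ D :* z := D :* (x :* y :+ z)) refl
             (exceptional C) D (D ℕ.^ m) (t ℕ.* β) ⟩
      D ℕ.* (exceptional C ℕ.* D ℕ.^ m ℕ.+ t ℕ.* β)
        ≤⟨ ℕ.*-monoʳ-≤ D step ⟩
      (E ℕ.+ t) ℕ.* (R ℕ.* (2 ℕ.* β))
        ≡⟨ solve 4 (λ E t R β → (E :+ t) :* (R :* (con 2 :* β)) := con 2 :* (E :* R) :* β :+ con 2 :* R :* (t :* β))
             refl E t R β ⟩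
      2 ℕ.* (E ℕ.* R) ℕ.* β ℕ.+ 2 ℕ.* R ℕ.* (t ℕ.* β)
        ≤⟨ ℕ.+-monoʳ-≤ (2 ℕ.* (E ℕ.* R) ℕ.* β) (ℕ.*-monoˡ-≤ (t ℕ.* β) 2R≤D) ⟩
      2 ℕ.* (E ℕ.* R) ℕ.* β ℕ.+ D ℕ.* (t ℕ.* β)
        ≡⟨ cong (ℕ._+ D ℕ.* (t ℕ.* β)) (solve 5 (λ E R x y z →
             con 2 :* (E :* R) :* (x :* y :* z) := con 2 :* x :* (E :* y) :* (R :* z))
             refl E R (2 ℕ.^ k) (E ℕ.^ m) (double-factorial r)) ⟩
      2 ℕ.* 2 ℕ.^ k ℕ.* (E ℕ.* E ℕ.^ m) ℕ.* (R ℕ.* double-factorial r) ℕ.+ D ℕ.* (t ℕ.* β) ∎)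
    where
    open ℕ.≤-Reasoning
    open +-*-Solver
    D = E ℕ.+ t
    R = suc (2 ℕ.* r)
    vertices = allFin (2 ℕ.* n)
    β = 2 ℕ.^ k ℕ.* E ℕ.^ m ℕ.* double-factorial r

    2R≤D : 2 ℕ.* R ℕ.≤ D
    2R≤D = begin
      2 ℕ.* suc (2 ℕ.* r)             ≤⟨ ℕ.*-monoʳ-≤ 2 (ℕ.n≤1+n (suc (2 ℕ.* r))) ⟩
      2 ℕ.* suc (suc (2 ℕ.* r))       ≡⟨ solve 1 (λ r → con 2 :* (con 2 :+ con 2 :* r) := con 4 :* (con 1 :+ r)) refl r ⟩
      4 ℕ.* suc r                   ≤⟨ ℕ.*-monoʳ-≤ 4 (ℕ.≤-trans (ℕ.m≤n+m (suc r) (length C)) (ℕ.≤-reflexive eq)) ⟩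
      4 ℕ.* n                       ≡⟨ D≡4n ⟨
      D                           ∎

    -- A free vertex is allowed 2β, the share of a failure. A success needs only β, so each vertex
    -- of the window returns β; exposed vertices contribute nothing.
    pointwise : ∀ w → exceptional ((u , w) ∷ C) ℕ.* D ℕ.^ m ℕ.+ 𝟙 (w ∈? W) ℕ.* β ℕ.≤ 𝟙 (w ∉? u ∷ ends C) ℕ.* (2 ℕ.* β)
    pointwise w with w ∈? u ∷ ends C | w ∈? W
    ... | yes w∈C | yes w∈W = contradiction w∈C (W-free w∈W)
    ... | yes w∈C | no _    = ℕ.≤-reflexive (trans (ℕ.+-identityʳ _)
      (cong (ℕ._* D ℕ.^ m) (not-exposed-twice n (¬? ∘ P?) {C = C} u∉C w∈C)))
    ... | no  w∉C | yes w∈W = begin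
      exceptional ((u , w) ∷ C) ℕ.* D ℕ.^ m ℕ.+ (β ℕ.+ 0)
        ≤⟨ ℕ.+-monoˡ-≤ (β ℕ.+ 0) (exceptional-bound D≡4n (succeed w w∈W) r
             (expose-unique u∉C w∉C C!) (expose-length n r C eq)) ⟩
      2 ℕ.* β
        ≡⟨ ℕ.+-identityʳ (2 ℕ.* β) ⟨
      2 ℕ.* β ℕ.+ 0 ∎
    ... | no  w∉C | no _    = begin
      exceptional ((u , w) ∷ C) ℕ.* D ℕ.^ m ℕ.+ 0
        ≤⟨ ℕ.+-monoˡ-≤ 0 (exceptional-bound D≡4n (fail w w∉C) r
             (expose-unique u∉C w∉C C!) (expose-length n r C eq)) ⟩
      2 ℕ.* 2 ℕ.^ k ℕ.* E ℕ.^ m ℕ.* double-factorial r ℕ.+ 0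
        ≡⟨ cong (ℕ._+ 0) (solve 3 (λ x y z → con 2 :* x :* y :* z := con 2 :* (x :* y :* z))
             refl (2 ℕ.^ k) (E ℕ.^ m) (double-factorial r)) ⟩
      2 ℕ.* β ℕ.+ 0 ∎

    step : exceptional C ℕ.* D ℕ.^ m ℕ.+ t ℕ.* β ℕ.≤ R ℕ.* (2 ℕ.* β)
    step = begin
      exceptional C ℕ.* D ℕ.^ m ℕ.+ t ℕ.* β
        ≡⟨ cong₂ (λ x y → x ℕ.* D ℕ.^ m ℕ.+ y ℕ.* β) (expose-partner n (¬? ∘ P?) u C)
             (trans (sym W≡t) (trans (sym (count-∈ W!)) (count-∑ (_∈? W) vertices))) ⟩
      ∑ (λ w → exceptional ((u , w) ∷ C)) vertices ℕ.* D ℕ.^ m ℕ.+ ∑ (λ w → 𝟙 (w ∈? W)) vertices ℕ.* β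
        ≡⟨ cong₂ ℕ._+_ (∑-*ʳ (λ w → exceptional ((u , w) ∷ C)) (D ℕ.^ m) vertices) (∑-*ʳ (λ w → 𝟙 (w ∈? W)) β vertices) ⟨
      ∑ (λ w → exceptional ((u , w) ∷ C) ℕ.* D ℕ.^ m) vertices ℕ.+ ∑ (λ w → 𝟙 (w ∈? W) ℕ.* β) vertices
        ≡⟨ ∑-+ (λ w → exceptional ((u , w) ∷ C) ℕ.* D ℕ.^ m) (λ w → 𝟙 (w ∈? W) ℕ.* β) vertices ⟨
      ∑ (λ w → exceptional ((u , w) ∷ C) ℕ.* D ℕ.^ m ℕ.+ 𝟙 (w ∈? W) ℕ.* β) vertices
        ≤⟨ ∑-mono pointwise vertices ⟩
      ∑ (λ w → 𝟙 (w ∉? u ∷ ends C) ℕ.* (2 ℕ.* β)) vertices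
        ≡⟨ ∑-*ʳ (λ w → 𝟙 (w ∉? u ∷ ends C)) (2 ℕ.* β) vertices ⟩
      ∑ (λ w → 𝟙 (w ∉? u ∷ ends C)) vertices ℕ.* (2 ℕ.* β)
        ≡⟨ cong (ℕ._* (2 ℕ.* β)) (free-partners n r u∉C C! eq) ⟩
      R ℕ.* (2 ℕ.* β) ∎

-- Waves and stacks

count-≤1 : {P : Pred A 0ℓ} (P? : Decidable P) → ∀ {xs} → Unique xs →
  (∀ {x y} → P x → P y → x ≡ y) → count P? xs ℕ.≤ 1
count-≤1 P? [] h = z≤n
count-≤1 P? {x ∷ xs} (x∉xs ∷ xs!) h with P? x
... | no  _ = count-≤1 P? xs! h
... | yes p = s≤s (ℕ.≤-reflexive (count-none P? λ y y∈xs q → All.lookup x∉xs y∈xs (h p q)))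

module _ {v : ℕ} where

  infixl 5 _∖_

  _∖_ : List (Fin v) → Fin v → List (Fin v)
  xs ∖ w = filter (¬? ∘ (Fin._≟ w)) xs

  length-∖ : ∀ {xs k} → Unique xs → ∀ w → suc k ℕ.≤ length xs → k ℕ.≤ length (xs ∖ w)
  length-∖ {xs} xs! w le = ℕ.+-cancelˡ-≤ 1 _ _ (ℕ.≤-trans le (ℕ.≤-trans
    (ℕ.≤-reflexive (sym (count-complement (Fin._≟ w) xs)))
    (ℕ.+-monoˡ-≤ _ (count-≤1 (Fin._≟ w) xs! λ { refl refl → refl }))))

  ∈-∖⁻ : ∀ {x w} xs → x ∈ xs ∖ w → x ∈ xs × x ≢ w
  ∈-∖⁻ {w = w} xs = ∈-filter⁻ (¬? ∘ (Fin._≟ w)) {xs = xs}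

AllPairs-++⁻ : {R : Rel A 0ℓ} → ∀ xs {ys} → AllPairs R (xs ++ ys) →
  AllPairs R xs × AllPairs R ys × (∀ {x y} → x ∈ xs → y ∈ ys → R x y)
AllPairs-++⁻ []       Rys = [] , Rys , λ ()
AllPairs-++⁻ (x ∷ xs) (Rx ∷ Rxsys) with AllPairs-++⁻ xs Rxsys
... | Rxs , Rys , Rxy = All.++⁻ˡ xs Rx ∷ Rxs , Rys , λ where
  (here refl)  y∈ys → All.lookup (All.++⁻ʳ xs Rx) y∈ys
  (there x∈xs) y∈ys → Rxy x∈xs y∈ys

AllPairs-reverse⁺ : {R : Rel A 0ℓ} → ∀ {xs} → AllPairs (flip R) xs → AllPairs R (reverse xs)
AllPairs-reverse⁺ [] = []
AllPairs-reverse⁺ {R = R} {x ∷ xs} (Rx ∷ Rxs) = subst (AllPairs R) (sym (unfold-reverse x xs))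
  (AllPairs.++⁺ (AllPairs-reverse⁺ Rxs) ([] ∷ [])
    (↭.All-resp-↭ (↭.↭-sym (↭.↭-reverse xs)) (All.map (_∷ []) Rx)))

split-at : ∀ t (xs : List A) → t ℕ.≤ length xs → ∃[ ys ] ∃[ zs ] xs ≡ ys ++ zs × length ys ≡ t
split-at zero    xs       _       = [] , xs , refl , refl
split-at (suc t) (x ∷ xs) (s≤s h) with split-at t xs h
... | ys , zs , refl , eq = x ∷ ys , zs , refl , cong suc eq

module _ {n : ℕ} where

  Forced : List (Edge (2 ℕ.* n)) → Pred (Edge (2 ℕ.* n)) 0ℓ
  Forced C e = ∀ {M} → IsMatching n M → Contains C M → e ∈ M

  weaken-forced : ∀ {C e f} → Forced C e → Forced (f ∷ C) e
  weaken-forced h m (_ ∷ c) = h m c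

-- The counterpart of `ContainsOfSizeAtLeast` for integer sizes, which keeps real numbers out of the
-- combinatorics.
Attains : ∀ {v} → Pred (List (Edge v)) 0ℓ → ℕ → Pred (List (Edge v)) 0ℓ
Attains Q k M = ∃[ S ] (S ⊆ M) × Q S × (k ℕ.≤ length S)

-- Waves and stacks differ only in the order of the right endpoints, so one strategy serves both,
-- with `◁` being < for waves and > for stacks. The number ℓ separates left endpoints from right
-- ones.
module Nested {n : ℕ} (t K ℓ : ℕ) (_◁_ : Rel (Fin (2 ℕ.* n)) 0ℓ) (◁⇒≢ : ∀ {x y} → x ◁ y → x ≢ y)
  (P : Pred (List (Edge (2 ℕ.* n))) 0ℓ) where

  private
    V = Fin (2 ℕ.* n)

  IsNested : Pred (List (Edge (2 ℕ.* n))) 0ℓ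
  IsNested S = AllPairs (λ e f → left e Fin.< left f × right e ◁ right f) S ×
    All (λ e → Fin.toℕ (left e) ℕ.< ℓ × ℓ ℕ.≤ Fin.toℕ (right e)) S

  -- `C` holds the exposed edges and `S` the structure built so far, latest edge first. The vertices
  -- of `A` are still to be exposed and those of `B` still to be offered as partners, each in order
  -- of use, so the next window is an initial segment of `B`.
  record State (C S : List (Edge (2 ℕ.* n))) (A B : List V) : Set where
    field
      nested  : IsNested S
      forced  : All (Forced {n} C) S
      A-free  : ∀ {x} → x ∈ A → x ∉ ends C
      B-free  : ∀ {x} → x ∈ B → x ∉ ends C
      A-order : AllPairs Fin._>_ A
      B-order : AllPairs (flip _◁_) B
      A-left  : ∀ {x} → x ∈ A → Fin.toℕ x ℕ.< ℓ
      B-right : ∀ {x} → x ∈ B → ℓ ℕ.≤ Fin.toℕ x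
      A-inner : ∀ {x e} → x ∈ A → e ∈ S → x Fin.< left e
      B-inner : ∀ {x e} → x ∈ B → e ∈ S → x ◁ right e

    A! : Unique A
    A! = AllPairs.map (λ { x>x refl → ℕ.<-irrefl refl x>x }) A-order

    B! : Unique B
    B! = AllPairs.map (λ y◁x → ◁⇒≢ y◁x ∘ sym) B-order

    left≢right : ∀ {x y} → x ∈ A → y ∈ B → x ≢ y
    left≢right x∈A y∈B refl = ℕ.<⇒≱ (A-left x∈A) (B-right y∈B)

  discard : ∀ {C S u A B} w → State C S (u ∷ A) B → State ((u , w) ∷ C) S (A ∖ w) (B ∖ w)
  discard {C} {S} {u} {A} {B} w s = record
    { nested  = nested
    ; forced  = All.map weaken-forced forced
    ; A-free  = λ x∈ → let x∈A , x≢w = ∈-∖⁻ A x∈ in λ where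
        (here refl)         → All.lookup (AllPairs.head A!) x∈A refl
        (there (here x≡w))  → x≢w x≡w
        (there (there x∈C)) → A-free (there x∈A) x∈C
    ; B-free  = λ x∈ → let x∈B , x≢w = ∈-∖⁻ B x∈ in λ where
        (here refl)         → left≢right (here refl) x∈B refl
        (there (here x≡w))  → x≢w x≡w
        (there (there x∈C)) → B-free x∈B x∈C
    ; A-order = AllPairs.filter⁺ _ (AllPairs.tail A-order)
    ; B-order = AllPairs.filter⁺ _ B-order
    ; A-left  = A-left ∘ there ∘ proj₁ ∘ ∈-∖⁻ A
    ; B-right = B-right ∘ proj₁ ∘ ∈-∖⁻ B
    ; A-inner = A-inner ∘ there ∘ proj₁ ∘ ∈-∖⁻ A
    ; B-inner = B-inner ∘ proj₁ ∘ ∈-∖⁻ B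
    }
    where open State s

  -- The whole window is given up, since its other vertices may lie on the wrong side of `w` for the
  -- edges to come.
  extend : ∀ {C S u A W B w} → State C S (u ∷ A) (W ++ B) → w ∈ W →
    State ((u , w) ∷ C) ((u , w) ∷ S) (A ∖ w) (B ∖ w)
  extend {C} {S} {u} {A} {W} {B} {w} s w∈W = record
    { nested  = All.tabulate (λ e∈S → A-inner (here refl) e∈S , B-inner (∈-++⁺ˡ w∈W) e∈S) ∷ proj₁ nested
              , (A-left (here refl) , B-right (∈-++⁺ˡ w∈W)) ∷ proj₂ nested
    ; forced  = (λ { m (j ∷ _) → joins-oriented (IsMatching.oriented m)
                  (ℕ.<-≤-trans (A-left (here refl)) (B-right (∈-++⁺ˡ w∈W))) j })
              ∷ State.forced d
    ; A-free  = State.A-free d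
    ; B-free  = State.B-free d ∘ grow
    ; A-order = State.A-order d
    ; B-order = AllPairs.filter⁺ _ B-ordered
    ; A-left  = State.A-left d
    ; B-right = State.B-right d ∘ grow
    ; A-inner = λ where
        x∈ (here refl) → All.lookup (AllPairs.head A-order) (proj₁ (∈-∖⁻ A x∈))
        x∈ (there e∈S) → State.A-inner d x∈ e∈S
    ; B-inner = λ where
        x∈ (here refl) → W◁B w∈W (proj₁ (∈-∖⁻ B x∈))
        x∈ (there e∈S) → State.B-inner d (grow x∈) e∈S
    }
    where
    open State s
    d = discard w s
    B-ordered = proj₁ (proj₂ (AllPairs-++⁻ W B-order))
    W◁B = proj₂ (proj₂ (AllPairs-++⁻ W B-order))
    grow : ∀ {x} → x ∈ B ∖ w → x ∈ (W ++ B) ∖ w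
    grow x∈ with ∈-∖⁻ B x∈
    ... | x∈B , x≢w = ∈-filter⁺ (¬? ∘ (Fin._≟ w)) (∈-++⁺ʳ W x∈B) x≢w

  module _ (win : ∀ {M S} → IsMatching n M → All (_∈ M) S → IsNested S → K ℕ.≤ length S → P M) where

    -- An exposure removes at most two vertices from `A`, namely `u` and possibly its partner. It
    -- costs `B` at most one vertex on failure, and on success a window of t besides. So 2m and m +
    -- kt vertices last for m exposures with k successes.
    forces : ∀ k m {C S A B} → State C S A B → 2 ℕ.* m ℕ.≤ length A → m ℕ.+ k ℕ.* t ℕ.≤ length B →
      K ℕ.≤ length S ℕ.+ k → Forces n P t k m C
    forces zero m s _ _ K≤ = won λ m c → win m (All.map (λ h → h m c) (State.forced s))
      (State.nested s) (ℕ.≤-trans K≤ (ℕ.≤-reflexive (ℕ.+-identityʳ _)))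
    forces (suc k) zero s _ _ _ = lapsed
    forces (suc k) (suc m) {A = []} s () _ _
    forces (suc k) (suc m) {C} {S} {u ∷ A} {B} s A≥ B≥ K≤
      with split-at t B (ℕ.≤-trans (ℕ.≤-trans (ℕ.m≤m+n t (k ℕ.* t)) (ℕ.m≤n+m _ (suc m))) B≥)
    ... | W , B′ , refl , refl = expose u W (A-free (here refl)) (proj₁ (AllPairs-++⁻ W B!)) refl
      (λ w∈W → λ where
        (here refl) → left≢right (here refl) (∈-++⁺ˡ w∈W) refl
        (there w∈C) → B-free (∈-++⁺ˡ w∈W) w∈C)
      (λ w _ → forces (suc k) m (discard w s) (A≥′ w) (length-∖ B! w B≥) K≤)
      (λ w w∈W → forces k m (extend s w∈W) (A≥′ w)
        (length-∖ (proj₁ (proj₂ (AllPairs-++⁻ W B!))) w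
          (ℕ.+-cancelˡ-≤ t _ _ (ℕ.≤-trans
            (ℕ.≤-reflexive (solve 3 (λ t m x → t :+ (con 1 :+ (m :+ x)) := con 1 :+ m :+ (t :+ x)) refl t m (k ℕ.* t)))
            (ℕ.≤-trans B≥ (ℕ.≤-reflexive (length-++ W))))))
        (ℕ.≤-trans K≤ (ℕ.≤-reflexive (ℕ.+-suc (length S) k))))
      where
      open State s
      open +-*-Solver
      A≥′ : ∀ w → 2 ℕ.* m ℕ.≤ length (A ∖ w)
      A≥′ w = length-∖ (AllPairs.tail A!) w (ℕ.+-cancelˡ-≤ 1 _ _
        (ℕ.≤-trans (ℕ.≤-reflexive (sym (ℕ.*-suc 2 m))) A≥))

-- Lines

module Consecutive {n : ℕ} (t K : ℕ) where

  private
    V = Fin (2 ℕ.* n)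

  Separated : Rel (Edge (2 ℕ.* n)) 0ℓ
  Separated e f = right e Fin.< left f

  record State (C S : List (Edge (2 ℕ.* n))) (A : List V) : Set where
    field
      separated : AllPairs Separated S
      oriented  : All Oriented S
      forced    : All (Forced {n} C) S
      A-free    : ∀ {x} → x ∈ A → x ∉ ends C
      A-order   : AllPairs Fin._>_ A
      A-below   : ∀ {x e} → x ∈ A → e ∈ S → x Fin.< left e

    A! : Unique A
    A! = AllPairs.map (λ { x>x refl → ℕ.<-irrefl refl x>x }) A-order

  discard : ∀ {C S u A} w → State C S (u ∷ A) → State ((u , w) ∷ C) S (A ∖ w)
  discard {C} {S} {u} {A} w s = record
    { separated = separated
    ; oriented  = oriented
    ; forced    = All.map weaken-forced forced
    ; A-free    = λ x∈ → let x∈A , x≢w = ∈-∖⁻ A x∈ in λ where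
        (here refl)         → All.lookup (AllPairs.head A!) x∈A refl
        (there (here x≡w))  → x≢w x≡w
        (there (there x∈C)) → A-free (there x∈A) x∈C
    ; A-order   = AllPairs.filter⁺ _ (AllPairs.tail A-order)
    ; A-below   = A-below ∘ there ∘ proj₁ ∘ ∈-∖⁻ A
    }
    where open State s

  -- The window lies directly below `u` in the list; dropping all of it leaves only vertices to the
  -- left of the new edge.
  extend : ∀ {C S u W A w} → State C S (u ∷ W ++ A) → w ∈ W → State ((u , w) ∷ C) ((w , u) ∷ S) A
  extend {C} {S} {u} {W} {A} {w} s w∈W = record
    { separated = All.tabulate (A-below (here refl)) ∷ separated
    ; oriented  = w<u ∷ oriented
    ; forced    = (λ { m (inj₁ uw ∷ _) → contradiction w<u (ℕ.<⇒≯ (All.lookup (IsMatching.oriented m) uw))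
                     ; m (inj₂ wu ∷ _) → wu })
                ∷ All.map weaken-forced forced
    ; A-free    = λ x∈A → λ where
        (here refl)         → All.lookup (AllPairs.head A!) (∈-++⁺ʳ W x∈A) refl
        (there (here refl)) → ℕ.<-irrefl refl (W>A w∈W x∈A)
        (there (there x∈C)) → A-free (there (∈-++⁺ʳ W x∈A)) x∈C
    ; A-order   = proj₁ (proj₂ (AllPairs-++⁻ W (AllPairs.tail A-order)))
    ; A-below   = λ where
        x∈A (here refl) → W>A w∈W x∈A
        x∈A (there e∈S) → A-below (there (∈-++⁺ʳ W x∈A)) e∈S
    }
    where
    open State s
    w<u = All.lookup (AllPairs.head A-order) (∈-++⁺ˡ w∈W)
    W>A = proj₂ (proj₂ (AllPairs-++⁻ W (AllPairs.tail A-order)))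

  line : ∀ {S} → AllPairs Separated S → All Oriented S → Line S
  line []                             []                  = []
  line ([] ∷ [])                      (a<b ∷ [])          = a<b ∷ [-]
  line ((b<c ∷ _) ∷ sep@(_ ∷ _))      (a<b ∷ o@(_ ∷ _))   = a<b ∷ b<c ∷ line sep o

  -- A failure removes `u` and possibly its partner; a success removes `u` and the window containing
  -- the partner. Hence the budget 2m + k (t + 1).
  forces : ∀ k m {C S A} → State C S A → 2 ℕ.* m ℕ.+ k ℕ.* suc t ℕ.≤ length A →
    K ℕ.≤ length S ℕ.+ k → Forces n (Attains Line K) t k m C
  forces zero m {S = S} s _ K≤ = won λ m c →
    S , ⊆-matching m (sorted oriented separated) (All.map (λ h → h m c) forced)
      , line separated oriented , ℕ.≤-trans K≤ (ℕ.≤-reflexive (ℕ.+-identityʳ _))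
    where
    open State s
    sorted : ∀ {S} → All Oriented S → AllPairs Separated S → AllPairs (Fin._<_ on left) S
    sorted []        []          = []
    sorted (a<b ∷ o) (b< ∷ sep) = All.map (ℕ.<-trans a<b) b< ∷ sorted o sep
  forces (suc k) zero s _ _ = lapsed
  forces (suc k) (suc m) {A = []} s () _
  forces (suc k) (suc m) {C} {S} {u ∷ A} s A≥ K≤
    with split-at t A (ℕ.≤-trans (ℕ.≤-trans (ℕ.m≤m+n t _) (ℕ.≤-reflexive (sym (rearrange t)))) (ℕ.s≤s⁻¹ A≥))
    where
    open +-*-Solver
    rearrange : ∀ t → m ℕ.+ suc (m ℕ.+ 0) ℕ.+ suc k ℕ.* suc t ≡ t ℕ.+ (2 ℕ.* m ℕ.+ (2 ℕ.+ k ℕ.* suc t))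
    rearrange t = solve 3 (λ m k t → m :+ (con 1 :+ (m :+ con 0)) :+ (con 1 :+ k) :* (con 1 :+ t)
      := t :+ (con 2 :* m :+ (con 2 :+ k :* (con 1 :+ t)))) refl m k t
  ... | W , A′ , refl , refl = expose u W (A-free (here refl)) (proj₁ (AllPairs-++⁻ W (AllPairs.tail A!))) refl
    (λ w∈W → λ where
      (here refl) → All.lookup (AllPairs.head A!) (∈-++⁺ˡ w∈W) refl
      (there w∈C) → A-free (there (∈-++⁺ˡ w∈W)) w∈C)
    (λ w _ → forces (suc k) m (discard w s)
      (length-∖ (AllPairs.tail A!) w (ℕ.+-cancelˡ-≤ 1 _ _ (ℕ.≤-trans (ℕ.≤-reflexive
        (solve 3 (λ m k t → con 2 :+ (con 2 :* m :+ (con 1 :+ k) :* (con 1 :+ t))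
          := con 2 :* (con 1 :+ m) :+ (con 1 :+ k) :* (con 1 :+ t)) refl m k t′)) A≥))) K≤)
    (λ w w∈W → forces k m (extend s w∈W)
      (ℕ.+-cancelˡ-≤ (suc t′) _ _ (ℕ.≤-trans (ℕ.≤-trans (ℕ.m≤n+m _ 2) (ℕ.≤-reflexive
        (solve 3 (λ m k t → con 2 :+ (con 1 :+ t :+ (con 2 :* m :+ k :* (con 1 :+ t)))
          := con 2 :* (con 1 :+ m) :+ (con 1 :+ k) :* (con 1 :+ t)) refl m k t′)))
        (ℕ.≤-trans A≥ (ℕ.≤-reflexive (cong suc (length-++ W))))))
      (ℕ.≤-trans K≤ (ℕ.≤-reflexive (ℕ.+-suc (length S) k))))
    where
    open State s
    open +-*-Solver
    t′ = length W

-- Intervals of vertices and starting positions of the strategies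

module _ {v : ℕ} (a b : ℕ) (a+b≤v : a ℕ.+ b ℕ.≤ v) where

  private
    bound : (i : Fin b) → a ℕ.+ Fin.toℕ i ℕ.< v
    bound i = ℕ.<-≤-trans (ℕ.+-monoʳ-< a (Fin.toℕ<n i)) a+b≤v

    vertex : Fin b → Fin v
    vertex i = Fin.fromℕ< (bound i)

    toℕ-vertex : ∀ i → Fin.toℕ (vertex i) ≡ a ℕ.+ Fin.toℕ i
    toℕ-vertex i = Fin.toℕ-fromℕ< (bound i)

    vertex-mono-< : ∀ {i j} → i Fin.< j → vertex i Fin.< vertex j
    vertex-mono-< {i} {j} i<j = subst₂ ℕ._<_ (sym (toℕ-vertex i)) (sym (toℕ-vertex j)) (ℕ.+-monoʳ-< a i<j)

    in-range : (σ : Fin b → Fin b) → ∀ {x} → x ∈ tabulate (vertex ∘ σ) → a ℕ.≤ Fin.toℕ x × Fin.toℕ x ℕ.< a ℕ.+ b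
    in-range σ x∈ with ∈-tabulate⁻ x∈
    ... | i , refl = subst (a ℕ.≤_) (sym (toℕ-vertex (σ i))) (ℕ.m≤m+n a _)
                   , subst (ℕ._< a ℕ.+ b) (sym (toℕ-vertex (σ i))) (ℕ.+-monoʳ-< a (Fin.toℕ<n (σ i)))

  ascending descending : List (Fin v)
  ascending  = tabulate vertex
  descending = tabulate (vertex ∘ Fin.opposite)

  length-ascending : length ascending ≡ b
  length-ascending = length-tabulate vertex

  length-descending : length descending ≡ b
  length-descending = length-tabulate (vertex ∘ Fin.opposite)

  ascending-order : AllPairs Fin._<_ ascending
  ascending-order = AllPairs.tabulate⁺-< vertex-mono-<

  descending-order : AllPairs Fin._>_ descending
  descending-order = AllPairs.tabulate⁺-< λ {i} {j} i<j → vertex-mono-< (subst₂ ℕ._<_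
    (sym (Fin.opposite-prop j)) (sym (Fin.opposite-prop i)) (ℕ.∸-monoʳ-< (s≤s i<j) (Fin.toℕ<n j)))

  ∈-ascending : ∀ {x} → x ∈ ascending → a ℕ.≤ Fin.toℕ x × Fin.toℕ x ℕ.< a ℕ.+ b
  ∈-ascending = in-range id

  ∈-descending : ∀ {x} → x ∈ descending → a ℕ.≤ Fin.toℕ x × Fin.toℕ x ℕ.< a ℕ.+ b
  ∈-descending = in-range Fin.opposite

module _ {n : ℕ} (t K m : ℕ) where

  private
    module N = Nested {n} t K (2 ℕ.* m)

    cross : ∀ {S : List (Edge (2 ℕ.* n))} → All (λ e → Fin.toℕ (left e) ℕ.< 2 ℕ.* m × 2 ℕ.* m ℕ.≤ Fin.toℕ (right e)) S →
      All (λ a → All (a Fin.<_) (map right S)) (map left S)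
    cross s = All.map⁺ (All.map (λ (l< , _) → All.map⁺ (All.map (λ (_ , ≤r) → ℕ.<-≤-trans l< ≤r) s)) s)

  module _ (enough : 3 ℕ.* m ℕ.+ K ℕ.* t ℕ.≤ 2 ℕ.* n) where

    private
      enough′ : 2 ℕ.* m ℕ.+ (m ℕ.+ K ℕ.* t) ℕ.≤ 2 ℕ.* n
      enough′ = ℕ.≤-trans (ℕ.≤-reflexive (solve 2 (λ m x → con 2 :* m :+ (m :+ x) := con 3 :* m :+ x) refl m (K ℕ.* t)))
        enough
        where open +-*-Solver
      2m≤2n : 0 ℕ.+ 2 ℕ.* m ℕ.≤ 2 ℕ.* n
      2m≤2n = ℕ.≤-trans (ℕ.m≤m+n (2 ℕ.* m) _) enough′

      left-part = descending 0 (2 ℕ.* m) 2m≤2n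

    forces-wave : Forces n (Attains Wave K) t K m []
    forces-wave = N.forces Fin._<_ (λ { x<x refl → ℕ.<-irrefl refl x<x }) (Attains Wave K)
      (λ {_} {S} M S⊆M (chain , split) K≤ → S
        , ⊆-matching M (AllPairs.map proj₁ chain) S⊆M
        , Linked.AllPairs⇒Linked (AllPairs.++⁺ (AllPairs.map⁺ (AllPairs.map proj₁ chain))
            (AllPairs.map⁺ (AllPairs.map proj₂ chain)) (cross split))
        , K≤)
      K m {[]} {[]} {left-part} {right-part}
      record
        { nested  = [] , []
        ; forced  = []
        ; A-free  = λ _ ()
        ; B-free  = λ _ ()
        ; A-order = descending-order 0 (2 ℕ.* m) 2m≤2n
        ; B-order = descending-order (2 ℕ.* m) (m ℕ.+ K ℕ.* t) enough′
        ; A-left  = proj₂ ∘ ∈-descending 0 (2 ℕ.* m) 2m≤2n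
        ; B-right = proj₁ ∘ ∈-descending (2 ℕ.* m) (m ℕ.+ K ℕ.* t) enough′
        ; A-inner = λ _ ()
        ; B-inner = λ _ ()
        }
      (ℕ.≤-reflexive (sym (length-descending 0 (2 ℕ.* m) 2m≤2n)))
      (ℕ.≤-reflexive (sym (length-descending (2 ℕ.* m) (m ℕ.+ K ℕ.* t) enough′)))
      ℕ.≤-refl
      where
      right-part = descending (2 ℕ.* m) (m ℕ.+ K ℕ.* t) enough′

    forces-stack : Forces n (Attains Stack K) t K m []
    forces-stack = N.forces Fin._>_ (λ { x>x refl → ℕ.<-irrefl refl x>x }) (Attains Stack K)
      (λ {_} {S} M S⊆M (chain , split) K≤ → S
        , ⊆-matching M (AllPairs.map proj₁ chain) S⊆M
        , Linked.AllPairs⇒Linked (AllPairs.++⁺ (AllPairs.map⁺ (AllPairs.map proj₁ chain))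
            (AllPairs-reverse⁺ (AllPairs.map⁺ (AllPairs.map proj₂ chain)))
            (All.map (↭.All-resp-↭ (↭.↭-sym (↭.↭-reverse (map right S)))) (cross split)))
        , K≤)
      K m {[]} {[]} {left-part} {right-part}
      record
        { nested  = [] , []
        ; forced  = []
        ; A-free  = λ _ ()
        ; B-free  = λ _ ()
        ; A-order = descending-order 0 (2 ℕ.* m) 2m≤2n
        ; B-order = ascending-order (2 ℕ.* m) (m ℕ.+ K ℕ.* t) enough′
        ; A-left  = proj₂ ∘ ∈-descending 0 (2 ℕ.* m) 2m≤2n
        ; B-right = proj₁ ∘ ∈-ascending (2 ℕ.* m) (m ℕ.+ K ℕ.* t) enough′
        ; A-inner = λ _ ()
        ; B-inner = λ _ ()
        }
      (ℕ.≤-reflexive (sym (length-descending 0 (2 ℕ.* m) 2m≤2n)))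
      (ℕ.≤-reflexive (sym (length-ascending (2 ℕ.* m) (m ℕ.+ K ℕ.* t) enough′)))
      ℕ.≤-refl
      where
      right-part = ascending (2 ℕ.* m) (m ℕ.+ K ℕ.* t) enough′

  forces-line : 2 ℕ.* m ℕ.+ K ℕ.* suc t ℕ.≤ 2 ℕ.* n → Forces n (Attains Line K) t K m []
  forces-line enough = Consecutive.forces {n} t K K m {[]} {[]} {descending 0 (2 ℕ.* n) ℕ.≤-refl}
    record
      { separated = []
      ; oriented  = []
      ; forced    = []
      ; A-free    = λ _ ()
      ; A-order   = descending-order 0 (2 ℕ.* n) ℕ.≤-refl
      ; A-below   = λ _ ()
      }
    (ℕ.≤-trans enough (ℕ.≤-reflexive (sym (length-descending 0 (2 ℕ.* n) ℕ.≤-refl))))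
    ℕ.≤-refl

-- Deciding the existence of sublists

sublist? : {Q : Pred (List A) 0ℓ} → Decidable Q → Decidable (λ xs → ∃[ ys ] (ys ⊆ xs) × Q ys)
sublist? Q? [] = map′ (λ q → [] , [] , q) (λ { (.[] , [] , q) → q }) (Q? [])
sublist? {Q = Q} Q? (x ∷ xs) = map′ to from
  (sublist? (λ ys → Q? (x ∷ ys)) xs ⊎-dec sublist? Q? xs)
  where
  Found : Pred (List _) 0ℓ → List _ → Set
  Found R zs = ∃[ ys ] (ys ⊆ zs) × R ys
  to : Found (λ ys → Q (x ∷ ys)) xs ⊎ Found Q xs → Found Q (x ∷ xs)
  to (inj₁ (ys , ys⊆xs , q)) = x ∷ ys , refl ∷ ys⊆xs , q
  to (inj₂ (ys , ys⊆xs , q)) = ys , x ∷ʳ ys⊆xs , q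
  from : Found Q (x ∷ xs) → Found (λ ys → Q (x ∷ ys)) xs ⊎ Found Q xs
  from (_ , refl ∷ ys⊆xs , q)  = inj₁ (_ , ys⊆xs , q)
  from (ys , _ ∷ʳ ys⊆xs , q) = inj₂ (ys , ys⊆xs , q)

-- Concentration

count-cover : {P Q R : Pred A 0ℓ} (P? : Decidable P) (Q? : Decidable Q) (R? : Decidable R) →
  (∀ {x} → P x → Q x ⊎ R x) → ∀ xs → count P? xs ℕ.≤ count Q? xs ℕ.+ count R? xs
count-cover P? Q? R? h [] = z≤n
count-cover P? Q? R? h (x ∷ xs) = begin
  count P? (x ∷ xs)
    ≡⟨ count-∷ P? x xs ⟩
  𝟙 (P? x) ℕ.+ count P? xs
    ≤⟨ ℕ.+-mono-≤ pointwise (count-cover P? Q? R? h xs) ⟩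
  𝟙 (Q? x) ℕ.+ 𝟙 (R? x) ℕ.+ (count Q? xs ℕ.+ count R? xs)
    ≡⟨ interchange (𝟙 (Q? x)) (𝟙 (R? x)) (count Q? xs) (count R? xs) ⟩
  𝟙 (Q? x) ℕ.+ count Q? xs ℕ.+ (𝟙 (R? x) ℕ.+ count R? xs)
    ≡⟨ cong₂ ℕ._+_ (count-∷ Q? x xs) (count-∷ R? x xs) ⟨
  count Q? (x ∷ xs) ℕ.+ count R? (x ∷ xs) ∎
  where
  open ℕ.≤-Reasoning
  pointwise : 𝟙 (P? x) ℕ.≤ 𝟙 (Q? x) ℕ.+ 𝟙 (R? x)
  pointwise with P? x | Q? x | R? x
  ... | no _  | _     | _     = z≤n
  ... | yes _ | yes _ | _     = s≤s z≤n
  ... | yes _ | no _  | yes _ = s≤s z≤n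
  ... | yes p | no ¬q | no ¬r = contradiction (h p) λ { (inj₁ q) → ¬q q ; (inj₂ r) → ¬r r }

-- With x = t / (E + t) this is (1 - x)^L (1 + Lx) ≤ 1, cleared of denominators. The induction rests
-- on (1 - x)(1 + (L + 1)x) ≤ 1 + Lx, where the difference is x² (L + 1).
bernoulli : ∀ E t L → E ℕ.^ L ℕ.* (E ℕ.+ t ℕ.+ L ℕ.* t) ℕ.≤ (E ℕ.+ t) ℕ.^ L ℕ.* (E ℕ.+ t)
bernoulli E t zero    = ℕ.≤-reflexive (cong (1 ℕ.*_) (ℕ.+-identityʳ (E ℕ.+ t)))
bernoulli E t (suc L) = begin
  E ℕ.* E ℕ.^ L ℕ.* (E ℕ.+ t ℕ.+ (t ℕ.+ L ℕ.* t))
    ≡⟨ solve 4 (λ E t x y → E :* x :* (E :+ t :+ (t :+ y)) := x :* (E :* (E :+ t :+ (t :+ y))))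
         refl E t (E ℕ.^ L) (L ℕ.* t) ⟩
  E ℕ.^ L ℕ.* (E ℕ.* (E ℕ.+ t ℕ.+ (t ℕ.+ L ℕ.* t)))
    ≤⟨ ℕ.*-monoʳ-≤ (E ℕ.^ L) (ℕ.≤-trans (ℕ.m≤m+n _ (t ℕ.* (t ℕ.+ L ℕ.* t))) (ℕ.≤-reflexive
         (solve 3 (λ E t y → E :* (E :+ t :+ (t :+ y)) :+ t :* (t :+ y) := (E :+ t) :* (E :+ t :+ y))
           refl E t (L ℕ.* t)))) ⟩
  E ℕ.^ L ℕ.* ((E ℕ.+ t) ℕ.* (E ℕ.+ t ℕ.+ L ℕ.* t))
    ≡⟨ solve 3 (λ x D y → x :* (D :* y) := D :* (x :* y)) refl (E ℕ.^ L) (E ℕ.+ t) (E ℕ.+ t ℕ.+ L ℕ.* t) ⟩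
  (E ℕ.+ t) ℕ.* (E ℕ.^ L ℕ.* (E ℕ.+ t ℕ.+ L ℕ.* t))
    ≤⟨ ℕ.*-monoʳ-≤ (E ℕ.+ t) (bernoulli E t L) ⟩
  (E ℕ.+ t) ℕ.* ((E ℕ.+ t) ℕ.^ L ℕ.* (E ℕ.+ t))
    ≡⟨ ℕ.*-assoc (E ℕ.+ t) ((E ℕ.+ t) ℕ.^ L) (E ℕ.+ t) ⟨
  (E ℕ.+ t) ℕ.* (E ℕ.+ t) ℕ.^ L ℕ.* (E ℕ.+ t) ∎
  where
  open ℕ.≤-Reasoning
  open +-*-Solver

-- Once Lx ≥ 1, the factor 1 + Lx in `bernoulli` is at least 2.
halving : ∀ E t L .{{_ : ℕ.NonZero (E ℕ.+ t)}} → E ℕ.+ t ℕ.≤ L ℕ.* t → E ℕ.^ L ℕ.* 2 ℕ.≤ (E ℕ.+ t) ℕ.^ L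
halving E t L h = ℕ.*-cancelʳ-≤ _ _ (E ℕ.+ t) (begin
  E ℕ.^ L ℕ.* 2 ℕ.* (E ℕ.+ t)
    ≡⟨ solve 2 (λ x D → x :* con 2 :* D := x :* (D :+ D)) refl (E ℕ.^ L) (E ℕ.+ t) ⟩
  E ℕ.^ L ℕ.* (E ℕ.+ t ℕ.+ (E ℕ.+ t))
    ≤⟨ ℕ.*-monoʳ-≤ (E ℕ.^ L) (ℕ.+-monoʳ-≤ (E ℕ.+ t) h) ⟩
  E ℕ.^ L ℕ.* (E ℕ.+ t ℕ.+ L ℕ.* t)
    ≤⟨ bernoulli E t L ⟩
  (E ℕ.+ t) ℕ.^ L ℕ.* (E ℕ.+ t) ∎)
  where
  open ℕ.≤-Reasoning
  open +-*-Solver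

halvings : ∀ {x y} → x ℕ.* 2 ℕ.≤ y → ∀ s → 2 ℕ.^ s ℕ.* x ℕ.^ s ℕ.≤ y ℕ.^ s
halvings         h zero    = ℕ.≤-refl
halvings {x} {y} h (suc s) = begin
  2 ℕ.* 2 ℕ.^ s ℕ.* (x ℕ.* x ℕ.^ s)
    ≡⟨ solve 3 (λ x a b → con 2 :* a :* (x :* b) := x :* con 2 :* (a :* b)) refl x (2 ℕ.^ s) (x ℕ.^ s) ⟩
  x ℕ.* 2 ℕ.* (2 ℕ.^ s ℕ.* x ℕ.^ s)
    ≤⟨ ℕ.*-mono-≤ h (halvings h s) ⟩
  y ℕ.* y ℕ.^ s ∎
  where
  open ℕ.≤-Reasoning
  open +-*-Solver

matchings-total : ∀ n → length (matchings n) ≡ double-factorial n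
matchings-total n = trans (everything (matchings n)) (completions-total n n {[]} [] refl)
  where
  everything : ∀ Ms → length Ms ≡ count (λ M → contains? [] M ×-dec all? n M) Ms
  everything []       = refl
  everything (M ∷ Ms) = cong suc (everything Ms)

module _ (n : ℕ) .{{_ : ℕ.NonZero n}} {P : Pred (List (Edge (2 ℕ.* n))) 0ℓ} (P? : Decidable P) where

  -- The exposures form K + j blocks of length L, each of which halves the weight. K of the halvings
  -- cancel the initial 2 ^ K, and the other j give the bound.
  exceptions-rare : ∀ {t K} L j → t ℕ.≤ 4 ℕ.* n → 4 ℕ.* n ℕ.≤ L ℕ.* t → Forces n P t K (L ℕ.* (K ℕ.+ j)) [] →
    count (¬? ∘ P?) (matchings n) ℕ.* 2 ℕ.^ j ℕ.≤ length (matchings n)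
  exceptions-rare {t} {K} L j t≤4n 4n≤Lt forces =
    ℕ.*-cancelʳ-≤ _ _ ((E ℕ.+ t) ℕ.^ m) {{ℕ.m^n≢0 (E ℕ.+ t) m}} (begin
      count (¬? ∘ P?) (matchings n) ℕ.* 2 ℕ.^ j ℕ.* (E ℕ.+ t) ℕ.^ m
        ≤⟨ ℕ.*-monoˡ-≤ ((E ℕ.+ t) ℕ.^ m) (ℕ.*-monoˡ-≤ (2 ℕ.^ j)
             (count-mono (¬? ∘ P?) (λ M → contains? [] M ×-dec ¬? (P? M)) ([] ,_) (matchings n))) ⟩
      X ℕ.* 2 ℕ.^ j ℕ.* (E ℕ.+ t) ℕ.^ m
        ≡⟨ solve 3 (λ x y z → x :* y :* z := y :* (x :* z)) refl X (2 ℕ.^ j) ((E ℕ.+ t) ℕ.^ m) ⟩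
      2 ℕ.^ j ℕ.* (X ℕ.* (E ℕ.+ t) ℕ.^ m)
        ≤⟨ ℕ.*-monoʳ-≤ (2 ℕ.^ j) (exceptional-bound n P? D≡4n forces n [] refl) ⟩
      2 ℕ.^ j ℕ.* (2 ℕ.^ K ℕ.* E ℕ.^ m ℕ.* double-factorial n)
        ≡⟨ solve 4 (λ x y z w → x :* (y :* z :* w) := w :* (y :* x :* z)) refl
             (2 ℕ.^ j) (2 ℕ.^ K) (E ℕ.^ m) (double-factorial n) ⟩
      double-factorial n ℕ.* (2 ℕ.^ K ℕ.* 2 ℕ.^ j ℕ.* E ℕ.^ m)
        ≡⟨ cong (λ x → double-factorial n ℕ.* (x ℕ.* E ℕ.^ m)) (ℕ.^-distribˡ-+-* 2 K j) ⟨
      double-factorial n ℕ.* (2 ℕ.^ (K ℕ.+ j) ℕ.* E ℕ.^ m)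
        ≤⟨ ℕ.*-monoʳ-≤ (double-factorial n) decay ⟩
      double-factorial n ℕ.* (E ℕ.+ t) ℕ.^ m
        ≡⟨ cong (ℕ._* (E ℕ.+ t) ℕ.^ m) (matchings-total n) ⟨
      length (matchings n) ℕ.* (E ℕ.+ t) ℕ.^ m ∎)
    where
    open ℕ.≤-Reasoning
    open +-*-Solver
    E = 4 ℕ.* n ℕ.∸ t
    instance
      D≢0 : ℕ.NonZero (E ℕ.+ t)
      D≢0 = ℕ.≢-nonZero λ eq → ℕ.≢-nonZero⁻¹ (4 ℕ.* n) {{ℕ.m*n≢0 4 n}} (trans (sym (ℕ.m∸n+n≡m t≤4n)) eq)
    m = L ℕ.* (K ℕ.+ j)
    X = exceptional n P? []
    D≡4n : E ℕ.+ t ≡ 4 ℕ.* n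
    D≡4n = ℕ.m∸n+n≡m t≤4n
    decay : 2 ℕ.^ (K ℕ.+ j) ℕ.* E ℕ.^ m ℕ.≤ (E ℕ.+ t) ℕ.^ m
    decay = begin
      2 ℕ.^ (K ℕ.+ j) ℕ.* E ℕ.^ m            ≡⟨ cong (2 ℕ.^ (K ℕ.+ j) ℕ.*_) (ℕ.^-*-assoc E L (K ℕ.+ j)) ⟨
      2 ℕ.^ (K ℕ.+ j) ℕ.* (E ℕ.^ L) ℕ.^ (K ℕ.+ j)  ≤⟨ halvings (halving E t L (ℕ.≤-trans (ℕ.≤-reflexive D≡4n) 4n≤Lt)) (K ℕ.+ j) ⟩
      ((E ℕ.+ t) ℕ.^ L) ℕ.^ (K ℕ.+ j)        ≡⟨ ℕ.^-*-assoc (E ℕ.+ t) L (K ℕ.+ j) ⟩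
      (E ℕ.+ t) ℕ.^ m ∎

-- Choice of the parameters

module _ (n K j : ℕ) (13K²≤n : 13 ℕ.* (K ℕ.* K) ℕ.≤ n) (j≪K : 15 ℕ.* j ℕ.+ 3 ℕ.≤ K) where

  -- With L steps halving the weight, m steps reduce it by 2 ^ (K + j).  The
  -- vertices suffice because 3 m = 12 K² + O(K) is at most 13 K².
  private
    instance
      K≢0 : ℕ.NonZero K
      K≢0 = ℕ.>-nonZero (ℕ.≤-trans (ℕ.≤-trans (s≤s z≤n) (ℕ.m≤n+m 3 (15 ℕ.* j))) j≪K)

      n≢0 : ℕ.NonZero n
      n≢0 = ℕ.>-nonZero (ℕ.≤-trans (ℕ.>-nonZero⁻¹ (13 ℕ.* (K ℕ.* K)) {{ℕ.m*n≢0 13 (K ℕ.* K) {{_}} {{ℕ.m*n≢0 K K}}}})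
        13K²≤n)

    t = n ℕ./ K
    -- 4K exposures would halve the weight if K divided n; one more makes up for rounding t down,
    -- because 4K ≤ t.
    L = 4 ℕ.* K ℕ.+ 1
    m = L ℕ.* (K ℕ.+ j)

    open ℕ.≤-Reasoning
    open +-*-Solver

    Kt≤n : K ℕ.* t ℕ.≤ n
    Kt≤n = ℕ.≤-trans (ℕ.≤-reflexive (ℕ.*-comm K t)) (ℕ.m/n*n≤m n K)

    t≤4n : t ℕ.≤ 4 ℕ.* n
    t≤4n = ℕ.≤-trans (ℕ.m/n≤m n K) (ℕ.m≤n*m n 4)

    4n≤Lt : 4 ℕ.* n ℕ.≤ L ℕ.* t
    4n≤Lt = begin
      4 ℕ.* n
        ≤⟨ ℕ.*-monoʳ-≤ 4 (ℕ.≤-trans (ℕ.≤-reflexive (ℕ.m≡m%n+[m/n]*n n K))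
             (ℕ.+-monoˡ-≤ (t ℕ.* K) (ℕ.<⇒≤ (ℕ.m%n<n n K)))) ⟩
      4 ℕ.* (suc t ℕ.* K)
        ≡⟨ solve 2 (λ t K → con 4 :* ((con 1 :+ t) :* K) := con 4 :* K :* t :+ con 4 :* K) refl t K ⟩
      4 ℕ.* K ℕ.* t ℕ.+ 4 ℕ.* K
        ≤⟨ ℕ.+-monoʳ-≤ (4 ℕ.* K ℕ.* t) (ℕ.*-monoˡ-≤ K (ℕ.m≤m+n 4 9)) ⟩
      4 ℕ.* K ℕ.* t ℕ.+ 13 ℕ.* K
        ≤⟨ ℕ.+-monoʳ-≤ (4 ℕ.* K ℕ.* t) 13K≤t ⟩
      4 ℕ.* K ℕ.* t ℕ.+ t
        ≡⟨ solve 2 (λ t K → con 4 :* K :* t :+ t := (con 4 :* K :+ con 1) :* t) refl t K ⟩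
      L ℕ.* t ∎
      where
      13K≤t : 13 ℕ.* K ℕ.≤ t
      13K≤t = ℕ.≤-trans (ℕ.≤-reflexive (sym (ℕ.m*n/n≡m (13 ℕ.* K) K)))
        (ℕ./-monoˡ-≤ K (ℕ.≤-trans (ℕ.≤-reflexive (ℕ.*-assoc 13 K K)) 13K²≤n))

    3m≤n : 3 ℕ.* m ℕ.≤ n
    3m≤n = begin
      3 ℕ.* m
        ≡⟨ solve 2 (λ K j → con 3 :* ((con 4 :* K :+ con 1) :* (K :+ j))
             := con 12 :* (K :* K) :+ (con 12 :* j :+ con 3) :* K :+ con 3 :* j) refl K j ⟩
      12 ℕ.* (K ℕ.* K) ℕ.+ (12 ℕ.* j ℕ.+ 3) ℕ.* K ℕ.+ 3 ℕ.* j
        -- Weakening 3j to 3jK makes the lower-order terms (15j + 3)K, which is where the hypothesis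
        -- `j≪K` gets its constants.
        ≤⟨ ℕ.+-monoʳ-≤ (12 ℕ.* (K ℕ.* K) ℕ.+ (12 ℕ.* j ℕ.+ 3) ℕ.* K) (ℕ.m≤m*n (3 ℕ.* j) K) ⟩
      12 ℕ.* (K ℕ.* K) ℕ.+ (12 ℕ.* j ℕ.+ 3) ℕ.* K ℕ.+ 3 ℕ.* j ℕ.* K
        ≡⟨ solve 2 (λ K j → con 12 :* (K :* K) :+ (con 12 :* j :+ con 3) :* K :+ con 3 :* j :* K
             := con 12 :* (K :* K) :+ (con 15 :* j :+ con 3) :* K) refl K j ⟩
      12 ℕ.* (K ℕ.* K) ℕ.+ (15 ℕ.* j ℕ.+ 3) ℕ.* K
        ≤⟨ ℕ.+-monoʳ-≤ (12 ℕ.* (K ℕ.* K)) (ℕ.*-monoˡ-≤ K j≪K) ⟩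
      12 ℕ.* (K ℕ.* K) ℕ.+ K ℕ.* K
        ≡⟨ ℕ.+-comm (12 ℕ.* (K ℕ.* K)) (K ℕ.* K) ⟩
      13 ℕ.* (K ℕ.* K)
        ≤⟨ 13K²≤n ⟩
      n ∎

    nested-fits : 3 ℕ.* m ℕ.+ K ℕ.* t ℕ.≤ 2 ℕ.* n
    nested-fits = ℕ.≤-trans (ℕ.+-mono-≤ 3m≤n Kt≤n) (ℕ.≤-reflexive (cong (n ℕ.+_) (sym (ℕ.+-identityʳ n))))

    line-fits : 2 ℕ.* m ℕ.+ K ℕ.* suc t ℕ.≤ 2 ℕ.* n
    line-fits = begin
      2 ℕ.* m ℕ.+ K ℕ.* suc t
        ≡⟨ solve 3 (λ m K t → con 2 :* m :+ K :* (con 1 :+ t) := con 2 :* m :+ K :+ K :* t) refl m K t ⟩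
      2 ℕ.* m ℕ.+ K ℕ.+ K ℕ.* t
        -- Lines use one m less than waves and stacks but K vertices more, and K ≤ m.
        ≤⟨ ℕ.+-monoˡ-≤ (K ℕ.* t) (ℕ.+-monoʳ-≤ (2 ℕ.* m) (ℕ.≤-trans (ℕ.m≤m+n K j)
             (ℕ.m≤n*m (K ℕ.+ j) L {{ℕ.≢-nonZero (ℕ.m+1+n≢0 (4 ℕ.* K))}}))) ⟩
      2 ℕ.* m ℕ.+ m ℕ.+ K ℕ.* t
        ≡⟨ cong (ℕ._+ K ℕ.* t) (ℕ.+-comm (2 ℕ.* m) m) ⟩
      3 ℕ.* m ℕ.+ K ℕ.* t
        ≤⟨ nested-fits ⟩
      2 ℕ.* n ∎

  attains? : ∀ {Q : Pred (List (Edge (2 ℕ.* n))) 0ℓ} → Decidable Q → Decidable (Attains Q K)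
  attains? Q? = sublist? (λ S → Q? S ×-dec (K ℕ.≤? length S))

  -- A union bound over the three failures, each of probability at most 2 ^ (-j). `E` is arbitrary
  -- so that the event with real sizes can be inserted later.
  most-matchings : ∀ {E : Pred (List (Edge (2 ℕ.* n))) 0ℓ} (E? : Decidable E) →
    (∀ {M} → Attains Stack K M → Attains Wave K M → Attains Line K M → E M) →
    length (matchings n) ℕ.* 2 ℕ.^ j ℕ.≤ count E? (matchings n) ℕ.* 2 ℕ.^ j ℕ.+ 3 ℕ.* length (matchings n)
  most-matchings {E} E? h = begin
    N ℕ.* 2 ℕ.^ j
      ≤⟨ ℕ.*-monoˡ-≤ (2 ℕ.^ j) (union (matchings n)) ⟩
    (count E? (matchings n) ℕ.+ (s ℕ.+ (w ℕ.+ l))) ℕ.* 2 ℕ.^ j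
      ≡⟨ solve 5 (λ g s w l x → (g :+ (s :+ (w :+ l))) :* x := g :* x :+ (s :* x :+ (w :* x :+ l :* x)))
           refl (count E? (matchings n)) s w l (2 ℕ.^ j) ⟩
    count E? (matchings n) ℕ.* 2 ℕ.^ j ℕ.+ (s ℕ.* 2 ℕ.^ j ℕ.+ (w ℕ.* 2 ℕ.^ j ℕ.+ l ℕ.* 2 ℕ.^ j))
      ≤⟨ ℕ.+-monoʳ-≤ (count E? (matchings n) ℕ.* 2 ℕ.^ j) (ℕ.+-mono-≤
           (exceptions-rare n stack? L j t≤4n 4n≤Lt (forces-stack t K m nested-fits)) (ℕ.+-mono-≤
           (exceptions-rare n wave? L j t≤4n 4n≤Lt (forces-wave t K m nested-fits))
           (exceptions-rare n line? L j t≤4n 4n≤Lt (forces-line t K m line-fits)))) ⟩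
    count E? (matchings n) ℕ.* 2 ℕ.^ j ℕ.+ (N ℕ.+ (N ℕ.+ N))
      ≡⟨ cong (λ x → count E? (matchings n) ℕ.* 2 ℕ.^ j ℕ.+ (N ℕ.+ (N ℕ.+ x))) (ℕ.+-identityʳ N) ⟨
    count E? (matchings n) ℕ.* 2 ℕ.^ j ℕ.+ 3 ℕ.* N ∎
    where
    N = length (matchings n)
    stack? = attains? (λ S → Linked.linked? Fin._<?_ _)
    wave?  = attains? (λ S → Linked.linked? Fin._<?_ _)
    line?  = attains? (λ S → Linked.linked? Fin._<?_ _)
    s = count (¬? ∘ stack?) (matchings n)
    w = count (¬? ∘ wave?) (matchings n)
    l = count (¬? ∘ line?) (matchings n)

    union : ∀ Ms → length Ms ℕ.≤ count E? Ms ℕ.+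
      (count (¬? ∘ stack?) Ms ℕ.+ (count (¬? ∘ wave?) Ms ℕ.+ count (¬? ∘ line?) Ms))
    union Ms = begin
      length Ms
        ≡⟨ count-complement stack? Ms ⟨
      count stack? Ms ℕ.+ count (¬? ∘ stack?) Ms
        ≤⟨ ℕ.+-monoˡ-≤ _ (count-cover stack? sw? (¬? ∘ wave?) both Ms) ⟩
      count sw? Ms ℕ.+ count (¬? ∘ wave?) Ms ℕ.+ count (¬? ∘ stack?) Ms
        ≤⟨ ℕ.+-monoˡ-≤ _ (ℕ.+-monoˡ-≤ _ (count-cover sw? E? (¬? ∘ line?) good Ms)) ⟩
      count E? Ms ℕ.+ count (¬? ∘ line?) Ms ℕ.+ count (¬? ∘ wave?) Ms ℕ.+ count (¬? ∘ stack?) Ms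
        ≡⟨ solve 4 (λ e l w s → e :+ l :+ w :+ s := e :+ (s :+ (w :+ l))) refl
             (count E? Ms) (count (¬? ∘ line?) Ms) (count (¬? ∘ wave?) Ms) (count (¬? ∘ stack?) Ms) ⟩
      count E? Ms ℕ.+ (count (¬? ∘ stack?) Ms ℕ.+ (count (¬? ∘ wave?) Ms ℕ.+ count (¬? ∘ line?) Ms)) ∎
      where
      sw? = λ M → stack? M ×-dec wave? M
      both : ∀ {M} → Attains Stack K M → (Attains Stack K M × Attains Wave K M) ⊎ ¬ Attains Wave K M
      both {M} s with wave? M
      ... | yes w = inj₁ (s , w)
      ... | no ¬w = inj₂ ¬w
      good : ∀ {M} → Attains Stack K M × Attains Wave K M → E M ⊎ ¬ Attains Line K M
      good {M} (s , w) with line? M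
      ... | yes l = inj₁ (h s w l)
      ... | no ¬l = inj₂ ¬l

-- Real estimates

open Rational

⌊√⌋-greatest : ∀ k m → k ℕ.* k ℕ.≤ m → k ℕ.≤ ⌊√ m ⌋
⌊√⌋-greatest k m h with k ℕ.≤? ⌊√ m ⌋
... | yes k≤r = k≤r
... | no  k≰r = contradiction
  (ℕ.<-≤-trans (⌊√⌋-upper m) (ℕ.*-mono-≤ (ℕ.≰⇒> k≰r) (ℕ.≰⇒> k≰r)))
  (ℕ.≤⇒≯ h)

⌊√⌋≤ : ∀ n → ⌊√ n ⌋ ℕ.≤ n
⌊√⌋≤ n = ℕ.≤-trans (m≤m² ⌊√ n ⌋) (⌊√⌋-lower n)
  where
  m≤m² : ∀ m → m ℕ.≤ m ℕ.* m
  m≤m² zero    = z≤n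
  m≤m² (suc m) = ℕ.m≤m*n (suc m) (suc m)

p≤p+q : ∀ p {q} → 0ℚ ℚ.≤ q → p ℚ.≤ p ℚ.+ q
p≤p+q p h = ℚ.≤-trans (ℚ.≤-reflexive (sym (ℚ.+-identityʳ p))) (ℚ.+-monoʳ-≤ p h)

-- ι is opaque because type checking would otherwise unfold the gcds in
-- normalised fractions.
opaque

  ι : ℕ → ℚ
  ι k = + k / 1

  ι-def : ∀ k → + k / 1 ≡ ι k
  ι-def k = refl

  ι-0 : ι 0 ≡ 0ℚ
  ι-0 = refl

  ι-1 : ι 1 ≡ 1ℚ
  ι-1 = refl

  ι-*-/ : ∀ a b m .{{_ : ℕ.NonZero m}} → ι a ℚ.* (+ b / m) ≡ + (a ℕ.* b) / m
  ι-*-/ a b (suc m) = ℚ.toℚᵘ-injective (ℚᵘ.≃-trans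
    (ℚ.toℚᵘ-homo-* (ι a) (+ b / suc m)) (ℚᵘ.≃-trans
    (ℚᵘ.*-cong (ℚ.toℚᵘ-fromℚᵘ (mkℚᵘ (+ a) 0)) (ℚ.toℚᵘ-fromℚᵘ (mkℚᵘ (+ b) m))) (ℚᵘ.≃-trans
    (ℚᵘ.*≡* (cong₂ ℤ._*_ (sym (ℤ.pos-* a b)) (sym (ℤ.*-identityˡ (+ suc m)))))
    (ℚᵘ.≃-sym (ℚ.toℚᵘ-fromℚᵘ (mkℚᵘ (+ (a ℕ.* b)) m))))))

  ι-* : ∀ a b → ι a ℚ.* ι b ≡ ι (a ℕ.* b)
  ι-* a b = ι-*-/ a b 1

  ι-+ : ∀ a b → ι a ℚ.+ ι b ≡ ι (a ℕ.+ b)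
  ι-+ a b = /-+ a b 1

  ι-mono : ∀ {a b} → a ℕ.≤ b → ι a ℚ.≤ ι b
  ι-mono {a} {b} a≤b = /-mono-≤ a b 1 1 (ℕ.*-monoˡ-≤ 1 a≤b)

  /-≤-ι : ∀ {a b c} m .{{_ : ℕ.NonZero m}} → c ℕ.* a ℕ.≤ b ℕ.* m → ι c ℚ.* (+ a / m) ℚ.≤ ι b
  /-≤-ι {a} {b} {c} m h = ℚ.≤-trans (ℚ.≤-reflexive (ι-*-/ c a m))
    (/-mono-≤ (c ℕ.* a) b m 1 (ℕ.≤-trans (ℕ.≤-reflexive (ℕ.*-identityʳ (c ℕ.* a))) h))

  ι-≤-/ : ∀ {a b c} m .{{_ : ℕ.NonZero m}} → b ℕ.* m ℕ.≤ c ℕ.* a → ι b ℚ.≤ ι c ℚ.* (+ a / m)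
  ι-≤-/ {a} {b} {c} m h = ℚ.≤-trans
    (/-mono-≤ b (c ℕ.* a) 1 m (ℕ.≤-trans h (ℕ.≤-reflexive (sym (ℕ.*-identityʳ (c ℕ.* a))))))
    (ℚ.≤-reflexive (sym (ι-*-/ c a m)))

0≤ι : ∀ k → 0ℚ ℚ.≤ ι k
0≤ι k = ℚ.≤-trans (ℚ.≤-reflexive (sym ι-0)) (ι-mono {0} {k} z≤n)

ι-suc : ∀ k → ι (suc k) ≡ ι k ℚ.+ 1ℚ
ι-suc k = trans (cong ι (ℕ.+-comm 1 k)) (trans (sym (ι-+ k 1)) (cong (ι k ℚ.+_) ι-1))

0<ι : ∀ k → 0ℚ ℚ.< ι (suc k)
0<ι k = ℚ.<-≤-trans (ℚ.positive⁻¹ 1ℚ) (ℚ.≤-trans (ℚ.≤-reflexive (sym ι-1)) (ι-mono {1} {suc k} (s≤s z≤n)))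

ι-*-monoʳ : ∀ k {p q} → p ℚ.≤ q → ι k ℚ.* p ℚ.≤ ι k ℚ.* q
ι-*-monoʳ k = ℚ.*-monoˡ-≤-nonNeg (ι k) {{ℚ.nonNegative (0≤ι k)}}

ι-*-cancelˡ : ∀ k {p q} → ι (suc k) ℚ.* p ℚ.≤ ι (suc k) ℚ.* q → p ℚ.≤ q
ι-*-cancelˡ k = ℚ.*-cancelˡ-≤-pos (ι (suc k)) {{ℚ.positive (0<ι k)}}

-- Comparing up to ½ suffices since both sides are integers.
ι-cancel-½ : ∀ {a b} → ι a ℚ.≤ ι b ℚ.+ ½ → a ℕ.≤ b
ι-cancel-½ {a} {b} h with a ℕ.≤? b
... | yes a≤b = a≤b
... | no  a≰b = contradiction
  (ℚ.<-≤-trans (ℚ.+-monoʳ-< (ι b) (from-yes (½ ℚ.<? 1ℚ)))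
    (ℚ.≤-trans (ℚ.≤-reflexive (sym (ι-suc b))) (ℚ.≤-trans (ι-mono (ℕ.≰⇒> a≰b)) h)))
  (ℚ.<-irrefl refl)

ι-cancel : ∀ {a b} → ι a ℚ.≤ ι b → a ℕ.≤ b
ι-cancel {a} {b} h = ι-cancel-½ (ℚ.≤-trans h (p≤p+q (ι b) (from-yes (0ℚ ℚ.≤? ½))))

ι-cancel-< : ∀ {a b} → ι a ℚ.< ι b → a ℕ.< b
ι-cancel-< {a} {b} h with a ℕ.<? b
... | yes a<b = a<b
... | no  a≮b = contradiction (ℚ.<-≤-trans h (ι-mono (ℕ.≮⇒≥ a≮b))) (ℚ.<-irrefl refl)

-- Division with remainder by a rational. As q ≥ 1, raising r by one raises the quotient by at most
-- one.
quotient : ∀ {q} → 1ℚ ℚ.≤ q → ∀ r → ∃[ k ] (ι k ℚ.* q ℚ.≤ ι r) × (ι r ℚ.< ι k ℚ.* q ℚ.+ q)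
quotient {q} 1≤q zero = 0
  , ℚ.≤-reflexive (trans (cong (ℚ._* q) ι-0) (trans (ℚ.*-zeroˡ q) (sym ι-0)))
  , ℚ.≤-<-trans (ℚ.≤-reflexive ι-0) (ℚ.<-≤-trans (ℚ.positive⁻¹ 1ℚ) (ℚ.≤-trans 1≤q (ℚ.≤-reflexive
      (sym (trans (cong (λ x → x ℚ.* q ℚ.+ q) ι-0) (trans (cong (ℚ._+ q) (ℚ.*-zeroˡ q)) (ℚ.+-identityˡ q)))))))
quotient {q} 1≤q (suc r) with quotient 1≤q r
... | k , lower , upper with ι k ℚ.* q ℚ.+ q ℚ.≤? ι (suc r)
...   | no  above = k , ℚ.≤-trans lower (ι-mono (ℕ.n≤1+n r)) , ℚ.≰⇒> above
...   | yes below = suc k , ℚ.≤-trans (ℚ.≤-reflexive eq) below , (begin-strict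
  ι (suc r)                     ≡⟨ ι-suc r ⟩
  ι r ℚ.+ 1ℚ                    <⟨ ℚ.+-mono-<-≤ upper 1≤q ⟩
  ι k ℚ.* q ℚ.+ q ℚ.+ q         ≡⟨ cong (ℚ._+ q) eq ⟨
  ι (suc k) ℚ.* q ℚ.+ q         ∎)
  where
  open ℚ.≤-Reasoning
  eq : ι (suc k) ℚ.* q ≡ ι k ℚ.* q ℚ.+ q
  eq = trans (cong (ℚ._* q) (ι-suc k)) (trans (ℚ.*-distribʳ-+ q (ι k) 1ℚ) (cong (ι k ℚ.* q ℚ.+_) (ℚ.*-identityˡ q)))

archimedean-ι : ∀ δ → 0ℚ ℚ.< δ → ∃[ d ] ι 1 ℚ.≤ ι (suc d) ℚ.* δ
archimedean-ι δ 0<δ with archimedean δ 0<δ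
... | d , 1/d≤δ = d , ℚ.≤-trans (ι-≤-/ {1} {1} {suc d} (suc d) (ℕ.≤-reflexive (ℕ.*-comm 1 (suc d))))
  (ι-*-monoʳ (suc d) 1/d≤δ)

-- These hold by computation.  Used as rewriting steps they keep rational
-- arithmetic from being unfolded when types are compared.
seq-* : ∀ x y j → seq (x * y) j ≡ seq x j ℚ.* seq y j
seq-* x y j = refl

seq-- : ∀ x y j → seq (x - y) j ≡ seq x j ℚ.- seq y j
seq-- x y j = refl

seq-÷ : ∀ x y {{y>0 : Positive y}} j → seq (x ÷ y) j ≡ seq x j ℚ.* reciprocal (seq y j)
seq-÷ x y j = refl

seq-fromℕ : ∀ k j → seq (fromℕ k) j ≡ ι k
seq-fromℕ k j = ι-def k

seq-√ : ∀ n j → seq (√ n) j ≡ + ⌊√ n ℕ.* (suc j ℕ.* suc j) ⌋ / suc j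
seq-√ n j = refl

-- Numerical bounds for √n, e and e √2

module _ (n : ℕ) where

  open ℕ.≤-Reasoning
  open +-*-Solver

  √-upper : ∀ a j → n ℕ.≤ a ℕ.* a → seq (√ n) j ℚ.≤ ι a
  √-upper a j n≤a² = ℚ.≤-trans
    (ℚ.≤-reflexive (trans (seq-√ n j) (trans (sym (ℚ.*-identityˡ _)) (cong (ℚ._* (+ r / J)) (sym ι-1)))))
    (/-≤-ι {r} {a} {1} J (ℕ.≤-trans (ℕ.≤-reflexive (ℕ.*-identityˡ r)) (square-cancel-≤ (begin
    r ℕ.* r                          ≤⟨ ⌊√⌋-lower (n ℕ.* (J ℕ.* J)) ⟩
    n ℕ.* (J ℕ.* J)                  ≤⟨ ℕ.*-monoˡ-≤ (J ℕ.* J) n≤a² ⟩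
    (a ℕ.* a) ℕ.* (J ℕ.* J)          ≡⟨ solve 2 (λ a J → (a :* a) :* (J :* J) := (a :* J) :* (a :* J)) refl a J ⟩
    (a ℕ.* J) ℕ.* (a ℕ.* J)          ∎))))
    where
    J = suc j
    r = ⌊√ n ℕ.* (J ℕ.* J) ⌋

  -- The approximations of √n with denominator a multiple of b are exact
  -- enough to see every a/b below √n.
  √-lower : ∀ a b i j → suc j ≡ b ℕ.* i → a ℕ.* a ℕ.≤ n ℕ.* (b ℕ.* b) →
    ι a ℚ.≤ ι b ℚ.* seq (√ n) j
  √-lower a b i j eq a²≤nb² = ℚ.≤-trans (ι-≤-/ {r} {a} {b} J (begin
    a ℕ.* J                  ≡⟨ cong (a ℕ.*_) eq ⟩
    a ℕ.* (b ℕ.* i)          ≡⟨ solve 3 (λ a b i → a :* (b :* i) := b :* (a :* i)) refl a b i ⟩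
    b ℕ.* (a ℕ.* i)          ≤⟨ ℕ.*-monoʳ-≤ b (⌊√⌋-greatest (a ℕ.* i) _ (begin
      (a ℕ.* i) ℕ.* (a ℕ.* i)          ≡⟨ solve 2 (λ a i → (a :* i) :* (a :* i) := (a :* a) :* (i :* i)) refl a i ⟩
      (a ℕ.* a) ℕ.* (i ℕ.* i)          ≤⟨ ℕ.*-monoˡ-≤ (i ℕ.* i) a²≤nb² ⟩
      n ℕ.* (b ℕ.* b) ℕ.* (i ℕ.* i)    ≡⟨ solve 3 (λ n b i → n :* (b :* b) :* (i :* i) := n :* ((b :* i) :* (b :* i))) refl n b i ⟩
      n ℕ.* ((b ℕ.* i) ℕ.* (b ℕ.* i))  ≡⟨ cong (λ x → n ℕ.* (x ℕ.* x)) eq ⟨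
      n ℕ.* (J ℕ.* J)                  ∎)) ⟩
    b ℕ.* r                  ∎)) (ℚ.≤-reflexive (cong (ι b ℚ.*_) (sym (seq-√ n j))))
    where
    J = suc j
    r = ⌊√ n ℕ.* (J ℕ.* J) ⌋

  √-lower₁ : ∀ a j → a ℕ.* a ℕ.≤ n → ι a ℚ.≤ seq (√ n) j
  √-lower₁ a j a²≤n = ℚ.≤-trans (√-lower a 1 (suc j) j (sym (ℕ.+-identityʳ (suc j)))
      (ℕ.≤-trans a²≤n (ℕ.≤-reflexive (sym (ℕ.*-identityʳ n)))))
    (ℚ.≤-reflexive (trans (cong (ℚ._* seq (√ n) j) ι-1) (ℚ.*-identityˡ (seq (√ n) j))))

-- The denominator of seq (√ 2) (sample N) is a multiple of 5, so that
-- √-lower applies with 7/5 < √2.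
sample : ℕ → ℕ
sample N = suc (N ℕ.* 5) ℕ.+ 3

≤-sample : ∀ N → N ℕ.≤ sample N
≤-sample N = ℕ.≤-trans (ℕ.m≤m*n N 5) (ℕ.≤-trans (ℕ.n≤1+n _) (ℕ.m≤m+n _ 3))

-- 8/3 is the partial sum up to 1/3!, and partial sums increase.
e-lower : ∀ k → ι 8 ℚ.≤ ι 3 ℚ.* ∑1/ k ℕ.+ 3 !
e-lower k = ℚ.≤-trans (ι-≤-/ {8} {8} {3} 3 ℕ.≤-refl) (ι-*-monoʳ 3 (∑1/!-increases 3 k))

-- A partial sum plus its last term does not increase from index 1 on, where it is 2 + 1.
e-upper : ∀ k → ∑1/ k ℕ.+ 1 ! ℚ.≤ ι 3
e-upper k = ℚ.≤-trans (p≤p+q (∑1/ k ℕ.+ 1 !) (0≤1/ (k ℕ.+ 1) !))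
  (ℚ.≤-trans (∑1/!-tail 1 k ℕ.≤-refl) (ℚ.≤-reflexive (ι-def 3)))

suc-sample : ∀ N → suc (sample N) ≡ 5 ℕ.* suc N
suc-sample = solve 1 (λ N → con 2 :+ (N :* con 5 :+ con 3) := con 5 :* (con 1 :+ N)) refl
  where open +-*-Solver

module _ (N : ℕ) where

  -- 56/15 is 8/3 times 7/5, just accurate enough: its square still exceeds 13.
  e√2-lower : ι 56 ℚ.≤ ι 15 ℚ.* seq (e * √ 2) (sample N)
  e√2-lower = begin
    ι 56
      ≡⟨ ι-* 8 7 ⟨
    ι 8 ℚ.* ι 7
      ≤⟨ *-mono-≤ (ℚ.≤-trans (0≤ι 8) (e-lower (suc (N ℕ.* 5)))) (0≤ι 7) (e-lower (suc (N ℕ.* 5)))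
           (√-lower 2 7 5 (suc N) (sample N) (suc-sample N) (ℕ.≤ᵇ⇒≤ 49 50 _)) ⟩
    ι 3 ℚ.* seq e (sample N) ℚ.* (ι 5 ℚ.* seq (√ 2) (sample N))
      ≡⟨ solve 4 (λ a b x y → a :* x :* (b :* y) := a :* b :* (x :* y)) refl
           (ι 3) (ι 5) (seq e (sample N)) (seq (√ 2) (sample N)) ⟩
    ι 3 ℚ.* ι 5 ℚ.* (seq e (sample N) ℚ.* seq (√ 2) (sample N))
      ≡⟨ cong₂ ℚ._*_ (ι-* 3 5) (sym (seq-* e (√ 2) (sample N))) ⟩
    ι 15 ℚ.* seq (e * √ 2) (sample N) ∎
    where
    open ℚ.≤-Reasoning
    open ℚS.+-*-Solver

  e√2-upper : seq (e * √ 2) (sample N) ℚ.≤ ι 6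
  e√2-upper = ℚ.≤-trans (ℚ.≤-reflexive (seq-* e (√ 2) (sample N)))
    (ℚ.≤-trans (*-mono-≤ (0≤ι 3) (ℚ.≤-trans (0≤ι 0) (√-lower₁ 2 0 (sample N) z≤n))
      (subst (λ J → seq e J ℚ.≤ ι 3) (ℕ.+-assoc (suc (N ℕ.* 5)) 2 1) (e-upper (suc (N ℕ.* 5) ℕ.+ 2)))
      (√-upper 2 2 (sample N) (ℕ.≤ᵇ⇒≤ 2 4 _)))
    (ℚ.≤-reflexive (ι-* 3 2)))

-- Rounding √n / (e √2) to an integer

module _ {k r : ℕ} {q : ℚ} (kq≤r : ι k ℚ.* q ℚ.≤ ι r) where

  open ℚ.≤-Reasoning

  quotient-small : ι 56 ℚ.≤ ι 15 ℚ.* q → 56 ℕ.* k ℕ.≤ 15 ℕ.* r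
  quotient-small 56≤15q = ι-cancel (begin
    ι (56 ℕ.* k)                  ≡⟨ trans (cong ι (ℕ.*-comm 56 k)) (sym (ι-* k 56)) ⟩
    ι k ℚ.* ι 56                  ≤⟨ ι-*-monoʳ k 56≤15q ⟩
    ι k ℚ.* (ι 15 ℚ.* q)          ≡⟨ solve 3 (λ k a q → k :* (a :* q) := a :* (k :* q)) refl (ι k) (ι 15) q ⟩
    ι 15 ℚ.* (ι k ℚ.* q)          ≤⟨ ι-*-monoʳ 15 kq≤r ⟩
    ι 15 ℚ.* ι r                  ≡⟨ ι-* 15 r ⟩
    ι (15 ℕ.* r)                  ∎)
    where open ℚS.+-*-Solver

  module _ (r<kq+q : ι r ℚ.< ι k ℚ.* q ℚ.+ q) (q≤6 : q ℚ.≤ ι 6) where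

    quotient-large : r ℕ.< 6 ℕ.* suc k
    quotient-large = ι-cancel-< (begin-strict
      ι r                          <⟨ r<kq+q ⟩
      ι k ℚ.* q ℚ.+ q              ≤⟨ ℚ.+-mono-≤ (ι-*-monoʳ k q≤6) q≤6 ⟩
      ι k ℚ.* ι 6 ℚ.+ ι 6          ≡⟨ cong (ℚ._+ ι 6) (ι-* k 6) ⟩
      ι (k ℕ.* 6) ℚ.+ ι 6          ≡⟨ ι-+ (k ℕ.* 6) 6 ⟩
      ι (k ℕ.* 6 ℕ.+ 6)            ≡⟨ cong ι (solve 1 (λ k → k :* con 6 :+ con 6 := con 6 :* (con 1 :+ k)) refl k) ⟩
      ι (6 ℕ.* suc k)              ∎)
      where open +-*-Solver

    -- Passing from the rational q to a nearby term y of e √2 costs kη ≤ 1, which will hold for η =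
    -- 1 / (n + 1) because k ≤ n. Rounding the quotient down costs at most q ≤ 6 more.
    quotient-close : ∀ {y η} → ι k ℚ.* η ℚ.≤ ι 1 → y ℚ.≤ q ℚ.+ η → q ℚ.≤ y ℚ.+ η →
      (ι k ℚ.* y ℚ.≤ ι r ℚ.+ ι 1) × (ι r ℚ.≤ ι k ℚ.* y ℚ.+ ι 7)
    quotient-close {y} {η} kη≤1 y≤q+η q≤y+η =
      (begin
        ι k ℚ.* y                       ≤⟨ ι-*-monoʳ k y≤q+η ⟩
        ι k ℚ.* (q ℚ.+ η)               ≡⟨ ℚ.*-distribˡ-+ (ι k) q η ⟩
        ι k ℚ.* q ℚ.+ ι k ℚ.* η         ≤⟨ ℚ.+-mono-≤ kq≤r kη≤1 ⟩
        ι r ℚ.+ ι 1                     ∎)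
      , (begin
        ι r                             ≤⟨ ℚ.<⇒≤ r<kq+q ⟩
        ι k ℚ.* q ℚ.+ q                 ≤⟨ ℚ.+-mono-≤ (ι-*-monoʳ k q≤y+η) q≤6 ⟩
        ι k ℚ.* (y ℚ.+ η) ℚ.+ ι 6       ≡⟨ cong (ℚ._+ ι 6) (ℚ.*-distribˡ-+ (ι k) y η) ⟩
        ι k ℚ.* y ℚ.+ ι k ℚ.* η ℚ.+ ι 6 ≤⟨ ℚ.+-monoˡ-≤ (ι 6) (ℚ.+-monoʳ-≤ (ι k ℚ.* y) kη≤1) ⟩
        ι k ℚ.* y ℚ.+ ι 1 ℚ.+ ι 6       ≡⟨ ℚ.+-assoc (ι k ℚ.* y) (ι 1) (ι 6) ⟩
        ι k ℚ.* y ℚ.+ (ι 1 ℚ.+ ι 6)     ≡⟨ cong (ι k ℚ.* y ℚ.+_) (ι-+ 1 6) ⟩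
        ι k ℚ.* y ℚ.+ ι 7               ∎)

-- `small` yields 13K² ≤ n for the strategies, `large` makes the size unbounded and eventually at
-- least √n / 8, and `close` makes the relative error vanish.
record Approximation (n : ℕ) : Set where
  field
    size  : ℕ
    small : 56 ℕ.* size ℕ.≤ 15 ℕ.* ⌊√ n ⌋
    large : ⌊√ n ⌋ ℕ.< 6 ℕ.* suc size
    close : Eventually (λ j → (ι size ℚ.* seq (e * √ 2) j ℚ.≤ ι ⌊√ n ⌋ ℚ.+ ι 1)
                            × (ι ⌊√ n ⌋ ℚ.≤ ι size ℚ.* seq (e * √ 2) j ℚ.+ ι 7))

module _ {n : ℕ} {η : ℚ} (0<η : 0ℚ ℚ.< η) (nη≡1 : ι (suc n) ℚ.* η ≡ 1ℚ) where

  approximate : ∀ {q N} → ι 56 ℚ.≤ ι 15 ℚ.* q → q ℚ.≤ ι 6 →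
    (∀ j → N ℕ.≤ j → (seq (e * √ 2) j ℚ.≤ q ℚ.+ η) × (q ℚ.≤ seq (e * √ 2) j ℚ.+ η)) → Approximation n
  approximate {q} {N} 56≤15q q≤6 near = from-quotient (quotient 1≤q ⌊√ n ⌋)
    where
    1≤q : 1ℚ ℚ.≤ q
    1≤q = ι-*-cancelˡ 14 (ℚ.≤-trans (ℚ.≤-trans (ℚ.≤-reflexive (ℚ.*-identityʳ (ι 15))) (ι-mono (ℕ.≤ᵇ⇒≤ 15 56 _))) 56≤15q)

    from-quotient : ∃[ k ] (ι k ℚ.* q ℚ.≤ ι ⌊√ n ⌋) × (ι ⌊√ n ⌋ ℚ.< ι k ℚ.* q ℚ.+ q) → Approximation n
    from-quotient (k , kq≤r , r<kq+q) = record
      { size  = k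
      ; small = small
      ; large = quotient-large {k} kq≤r r<kq+q q≤6
      ; close = N , λ j N≤j → quotient-close {k} kq≤r r<kq+q q≤6 kη≤1 (proj₁ (near j N≤j)) (proj₂ (near j N≤j))
      }
      where
      small : 56 ℕ.* k ℕ.≤ 15 ℕ.* ⌊√ n ⌋
      small = quotient-small {k} kq≤r 56≤15q

      k≤n : k ℕ.≤ n
      k≤n = ℕ.≤-trans (ℕ.*-cancelˡ-≤ 15 (ℕ.≤-trans (ℕ.*-monoˡ-≤ k (ℕ.m≤m+n 15 41)) small)) (⌊√⌋≤ n)

      kη≤1 : ι k ℚ.* η ℚ.≤ ι 1
      kη≤1 = ℚ.≤-trans (ℚ.*-monoʳ-≤-nonNeg η {{ℚ.nonNegative (ℚ.<⇒≤ 0<η)}} (ι-mono (ℕ.m≤n⇒m≤1+n k≤n)))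
        (ℚ.≤-reflexive (trans nη≡1 (sym ι-1)))

  approximate-from : (∃[ N ] ∀ i j → N ℕ.≤ i → N ℕ.≤ j → ℚ.∣ seq (e * √ 2) i ℚ.- seq (e * √ 2) j ∣ ℚ.≤ η) →
    Approximation n
  approximate-from (N , near) = approximate {seq (e * √ 2) (sample N)} {N} (e√2-lower N) (e√2-upper N) λ j N≤j →
      p≤q+r {seq (e * √ 2) j} {seq (e * √ 2) (sample N)} (near j (sample N) N≤j (≤-sample N))
    , p≤q+r {seq (e * √ 2) (sample N)} {seq (e * √ 2) j} (near (sample N) j (≤-sample N) N≤j)

approximate-at : ∀ {n} → (∃[ η ] (0ℚ ℚ.< η) × (ι (suc n) ℚ.* η ≡ 1ℚ)) → Approximation n
approximate-at (η , 0<η , nη≡1) = approximate-from 0<η nη≡1 (cauchy (e * √ 2) η 0<η)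

opaque

  -- size is √n / (e √2), up to an error bounded independently of n.
  approximation : ∀ n → Approximation n
  approximation n = approximate-at (split 1ℚ (ι (suc n)) (ℚ.positive⁻¹ 1ℚ) (0<ι n))

-- The error sequence and its integer threshold

target : ℕ → ℕ
target n = Approximation.size (approximation n)

-- Chosen so that (1 - ε n) / (e √2) · √n is the integer target n.
ε : ℕ → ℝ
ε zero    = 0ℝ
ε (suc n) = 1ℝ - fromℕ (target (suc n)) * (e * √ 2) ÷ √ (suc n)

ε-seq : ∀ n j → seq (ε (suc n)) j ≡ 1ℚ ℚ.- ι (target (suc n)) ℚ.* seq (e * √ 2) j ℚ.* reciprocal (seq (√ suc n) j)
ε-seq n j = trans (seq-- 1ℝ (fromℕ (target (suc n)) * (e * √ 2) ÷ √ (suc n)) j)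
  (cong (λ x → 1ℚ ℚ.- x) (trans (seq-÷ (fromℕ (target (suc n)) * (e * √ 2)) (√ suc n) j)
    (cong (ℚ._* reciprocal (seq (√ suc n) j)) (trans (seq-* (fromℕ (target (suc n))) (e * √ 2) j)
      (cong (ℚ._* seq (e * √ 2) j) (seq-fromℕ (target (suc n)) j))))))

eventually-positive : ∀ {x} → Positive x → Eventually (λ j → 0ℚ ℚ.< seq x j)
eventually-positive p = proj₁ (Positive.bound≤ p) , λ j N≤j →
  ℚ.<-≤-trans (Positive.bound>0 p) (proj₂ (Positive.bound≤ p) j N≤j)

∣-∣-intro : ∀ a l δ → Eventually (λ j → ℚ.∣ seq a j ℚ.- seq l j ∣ ℚ.≤ δ) → ∣ a - l ∣ ≤ fromℚ δ
∣-∣-intro a l δ (N , h) δ′ 0<δ′ = N , λ j N≤j → ℚ.≤-trans (h j N≤j) (p≤p+q δ (ℚ.<⇒≤ 0<δ′))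

module _ {r ρ : ℚ} (rρ≡1 : r ℚ.* ρ ≡ 1ℚ) where

  open ℚS.+-*-Solver

  module _ {y υ : ℚ} (yυ≡1 : y ℚ.* υ ≡ 1ℚ) where

    open ≡-Reasoning

    unscale : ∀ x → (1ℚ ℚ.- (1ℚ ℚ.- x ℚ.* y ℚ.* ρ)) ℚ.* υ ℚ.* r ≡ x
    unscale x = begin
      (1ℚ ℚ.- (1ℚ ℚ.- x ℚ.* y ℚ.* ρ)) ℚ.* υ ℚ.* r
        ≡⟨ solve 5 (λ x y ρ υ r → (con 1ℚ :- (con 1ℚ :- x :* y :* ρ)) :* υ :* r := x :* (y :* υ) :* (r :* ρ))
             refl x y ρ υ r ⟩
      x ℚ.* (y ℚ.* υ) ℚ.* (r ℚ.* ρ)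
        ≡⟨ cong₂ (λ a b → x ℚ.* a ℚ.* b) yυ≡1 rρ≡1 ⟩
      x ℚ.* 1ℚ ℚ.* 1ℚ
        ≡⟨ trans (ℚ.*-identityʳ (x ℚ.* 1ℚ)) (ℚ.*-identityʳ x) ⟩
      x ∎

  module _ (0<r : 0ℚ ℚ.< r) {R x δ : ℚ}
    (R≤r : R ℚ.≤ r) (r≤R+1 : r ℚ.≤ R ℚ.+ ι 1)
    (x≤R+1 : x ℚ.≤ R ℚ.+ ι 1) (R≤x+7 : R ℚ.≤ x ℚ.+ ι 7)
    (8≤rδ : ι 8 ℚ.≤ r ℚ.* δ) where

    open ℚ.≤-Reasoning

    -- After multiplication by r it remains to see |r - x| ≤ 8 ≤ rδ. Rounding r to R contributes 1,
    -- and the distance from R to x at most 7.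
    relative-error : ℚ.∣ (1ℚ ℚ.- x ℚ.* ρ) ℚ.- 0ℚ ∣ ℚ.≤ δ
    relative-error = ∣p-q∣≤r {1ℚ ℚ.- x ℚ.* ρ} {0ℚ} {δ} upper lower
      where
      instance r>0 = ℚ.positive 0<r

      upper : 1ℚ ℚ.- x ℚ.* ρ ℚ.≤ 0ℚ ℚ.+ δ
      upper = ℚ.*-cancelˡ-≤-pos r (begin
        r ℚ.* (1ℚ ℚ.- x ℚ.* ρ)
          ≡⟨ solve 3 (λ r x ρ → r :* (con 1ℚ :- x :* ρ) := r :- x :* (r :* ρ)) refl r x ρ ⟩
        r ℚ.- x ℚ.* (r ℚ.* ρ)
          ≡⟨ cong (λ z → r ℚ.- z) (trans (cong (x ℚ.*_) rρ≡1) (ℚ.*-identityʳ x)) ⟩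
        r ℚ.- x
          ≤⟨ p-q≤r {r} {x} (ℚ.≤-trans r≤R+1 (ℚ.≤-trans (ℚ.+-monoˡ-≤ (ι 1) R≤x+7)
               (ℚ.≤-reflexive (trans (ℚ.+-assoc x (ι 7) (ι 1)) (cong (x ℚ.+_) (ι-+ 7 1)))))) ⟩
        ι 8
          ≤⟨ 8≤rδ ⟩
        r ℚ.* δ
          ≡⟨ cong (r ℚ.*_) (ℚ.+-identityˡ δ) ⟨
        r ℚ.* (0ℚ ℚ.+ δ) ∎)

      lower : 0ℚ ℚ.≤ 1ℚ ℚ.- x ℚ.* ρ ℚ.+ δ
      lower = ℚ.*-cancelˡ-≤-pos r (begin
        r ℚ.* 0ℚ
          ≡⟨ trans (ℚ.*-zeroʳ r) (sym (ℚ.+-inverseˡ (ι 8))) ⟩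
        ℚ.- ι 8 ℚ.+ ι 8
          ≤⟨ ℚ.+-mono-≤ (ℚ.neg-antimono-≤ (p-q≤r {x} {r} (ℚ.≤-trans x≤R+1 (ℚ.≤-trans
               (ℚ.+-monoˡ-≤ (ι 1) R≤r) (ℚ.+-monoʳ-≤ r (ι-mono {1} {8} (s≤s z≤n))))))) 8≤rδ ⟩
        ℚ.- (x ℚ.- r) ℚ.+ r ℚ.* δ
          ≡⟨ cong (λ z → ℚ.- (z ℚ.- r) ℚ.+ r ℚ.* δ)
               (trans (sym (ℚ.*-identityʳ x)) (cong (x ℚ.*_) (sym rρ≡1))) ⟩
        ℚ.- (x ℚ.* (r ℚ.* ρ) ℚ.- r) ℚ.+ r ℚ.* δ
          ≡⟨ solve 4 (λ r x ρ δ → :- (x :* (r :* ρ) :- r) :+ r :* δ := r :* (con 1ℚ :- x :* ρ :+ δ))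
               refl r x ρ δ ⟩
        r ℚ.* (1ℚ ℚ.- x ℚ.* ρ ℚ.+ δ) ∎)

threshold : ℕ → ℝ
threshold n = (1ℝ - ε n) ÷ (e * √ 2) * √ n

-- Once the terms of e √2 and √n are positive, their reciprocals are genuine and everything except
-- `target n` cancels. For n = 0 the terms of √0 are 0, and `small` forces `target 0` to be 0.
threshold-seq : ∀ n → Eventually (λ j → seq (threshold n) j ≡ ι (target n))
threshold-seq zero = 0 , λ j _ → trans (trans (seq-* ((1ℝ - ε 0) ÷ (e * √ 2)) (√ 0) j)
  (trans (cong (seq ((1ℝ - ε 0) ÷ (e * √ 2)) j ℚ.*_) (trans (seq-√ 0 j) (ℚ.0/n≡0 (suc j))))
    (ℚ.*-zeroʳ (seq ((1ℝ - ε 0) ÷ (e * √ 2)) j))))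
  (trans (sym ι-0) (cong ι (sym (ℕ.n≤0⇒n≡0 (ℕ.≤-trans (ℕ.m≤n*m (target 0) 56) (Approximation.small (approximation 0)))))))
threshold-seq (suc n) = proj₁ both , λ j N≤j → let 0<y , 0<r = proj₂ both j N≤j in begin
  seq (threshold (suc n)) j
    ≡⟨ seq-* ((1ℝ - ε (suc n)) ÷ (e * √ 2)) (√ suc n) j ⟩
  seq ((1ℝ - ε (suc n)) ÷ (e * √ 2)) j ℚ.* seq (√ suc n) j
    ≡⟨ cong (ℚ._* seq (√ suc n) j) (seq-÷ (1ℝ - ε (suc n)) (e * √ 2) j) ⟩
  seq (1ℝ - ε (suc n)) j ℚ.* reciprocal (seq (e * √ 2) j) ℚ.* seq (√ suc n) j
    ≡⟨ cong (λ x → x ℚ.* reciprocal (seq (e * √ 2) j) ℚ.* seq (√ suc n) j) (seq-- 1ℝ (ε (suc n)) j) ⟩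
  (1ℚ ℚ.- seq (ε (suc n)) j) ℚ.* reciprocal (seq (e * √ 2) j) ℚ.* seq (√ suc n) j
    ≡⟨ cong (λ x → (1ℚ ℚ.- x) ℚ.* reciprocal (seq (e * √ 2) j) ℚ.* seq (√ suc n) j) (ε-seq n j) ⟩
  (1ℚ ℚ.- (1ℚ ℚ.- ι (target (suc n)) ℚ.* seq (e * √ 2) j ℚ.* reciprocal (seq (√ suc n) j)))
      ℚ.* reciprocal (seq (e * √ 2) j) ℚ.* seq (√ suc n) j
    ≡⟨ unscale (*-reciprocal 0<r) (*-reciprocal 0<y) (ι (target (suc n))) ⟩
  ι (target (suc n)) ∎
  where
  open ≡-Reasoning
  both = eventually-positive {e * √ 2} *-positive ∧ eventually-positive {√ suc n} √-positive

module _ {x : ℝ} {k : ℕ} (x≡k : Eventually (λ j → seq x j ≡ ι k)) (L : ℕ) where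

  eventually-integer-≤ : k ℕ.≤ L → x ≤ fromℕ L
  eventually-integer-≤ h δ 0<δ = proj₁ x≡k , λ j N≤j → ℚ.≤-trans (ℚ.≤-reflexive (proj₂ x≡k j N≤j)) (ℚ.≤-trans (ι-mono h)
    (ℚ.≤-trans (p≤p+q (ι L) (ℚ.<⇒≤ 0<δ)) (ℚ.≤-reflexive (cong (ℚ._+ δ) (sym (seq-fromℕ L j))))))

  eventually-integer-≤⁻ : x ≤ fromℕ L → k ℕ.≤ L
  eventually-integer-≤⁻ h = ι-cancel-½ (ℚ.≤-trans (ℚ.≤-reflexive (sym (proj₂ x≡k N (ℕ.m≤m⊔n _ _))))
    (ℚ.≤-trans (proj₂ x≤L N (ℕ.m≤n⊔m _ _)) (ℚ.≤-reflexive (cong (ℚ._+ ½) (seq-fromℕ L N)))))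
    where
    x≤L = h ½ (from-yes (0ℚ ℚ.<? ½))
    N = proj₁ x≡k ℕ.⊔ proj₁ x≤L

threshold≤ : ∀ n L → target n ℕ.≤ L → threshold n ≤ fromℕ L
threshold≤ n = eventually-integer-≤ {threshold n} (threshold-seq n)

-- Decidable because the threshold agrees with an integer; this is what the choice of `ε` was for.
threshold? : ∀ n L → Dec (threshold n ≤ fromℕ L)
threshold? n L = map′ (threshold≤ n L) (eventually-integer-≤⁻ {threshold n} (threshold-seq n) L) (target n ℕ.≤? L)

module _ {d : ℕ} {δ : ℚ} (0<δ : 0ℚ ℚ.< δ) (1≤dδ : ι 1 ℚ.≤ ι (suc d) ℚ.* δ) where

  private
    -- X is at least 8 / δ, and X² ≤ n puts every term of √n above X; the 8 is the error in
    -- `relative-error`.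
    X = 8 ℕ.* suc d

  8≤rδ : ∀ {r} → ι X ℚ.≤ r → ι 8 ℚ.≤ r ℚ.* δ
  8≤rδ {r} X≤r = begin
    ι 8                           ≡⟨ ι-* 8 1 ⟨
    ι 8 ℚ.* ι 1                   ≤⟨ ι-*-monoʳ 8 1≤dδ ⟩
    ι 8 ℚ.* (ι (suc d) ℚ.* δ)     ≡⟨ ℚ.*-assoc (ι 8) (ι (suc d)) δ ⟨
    ι 8 ℚ.* ι (suc d) ℚ.* δ       ≡⟨ cong (ℚ._* δ) (ι-* 8 (suc d)) ⟩
    ι X ℚ.* δ                     ≤⟨ ℚ.*-monoʳ-≤-nonNeg δ {{ℚ.nonNegative (ℚ.<⇒≤ 0<δ)}} X≤r ⟩
    r ℚ.* δ                       ∎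
    where open ℚ.≤-Reasoning

  ε-small : ∀ n → X ℕ.* X ℕ.≤ n → ∣ ε n - 0ℝ ∣ ≤ fromℚ δ
  ε-small (suc n) X²≤n = ∣-∣-intro (ε (suc n)) 0ℝ δ (proj₁ both , λ j M≤j →
    let (x≤R+1 , R≤x+7) , 0<r = proj₂ both j M≤j in
    subst (λ x → ℚ.∣ x ℚ.- 0ℚ ∣ ℚ.≤ δ) (sym (ε-seq n j))
      (relative-error (*-reciprocal 0<r) 0<r (√-lower₁ (suc n) R j (⌊√⌋-lower (suc n))) (r≤R+1 j) x≤R+1 R≤x+7
        (8≤rδ (√-lower₁ (suc n) X j X²≤n))))
    where
    both = Approximation.close (approximation (suc n)) ∧ eventually-positive {√ suc n} √-positive
    R = ⌊√ suc n ⌋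

    r≤R+1 : ∀ j → seq (√ suc n) j ℚ.≤ ι R ℚ.+ ι 1
    r≤R+1 j = ℚ.≤-trans (√-upper (suc n) (suc R) j (ℕ.<⇒≤ (⌊√⌋-upper (suc n))))
      (ℚ.≤-reflexive (trans (ι-suc R) (cong (ι R ℚ.+_) (sym ι-1))))

ε⟶0 : ε ⟶ 0ℝ
ε⟶0 δ 0<δ = _ , ε-small 0<δ (proj₂ (archimedean-ι δ 0<δ))

-- Comparing √n / 8 with integers

⅛ : ℝ
⅛ = fromℚ (+ 1 / 8)

8*⅛ : ι 8 ℚ.* (+ 1 / 8) ≡ 1ℚ
8*⅛ = ℚ.≤-antisym
  (ℚ.≤-trans (/-≤-ι {1} {1} {8} 8 ℕ.≤-refl) (ℚ.≤-reflexive ι-1))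
  (ℚ.≤-trans (ℚ.≤-reflexive (sym ι-1)) (ι-≤-/ {1} {1} {8} 8 ℕ.≤-refl))

module _ {c s : ℚ} (8c≡1 : ι 8 ℚ.* c ≡ 1ℚ) (L : ℕ) where

  open ℚ.≤-Reasoning
  open ℚS.+-*-Solver

  eighth-≤ : s ℚ.≤ ι (8 ℕ.* L) → c ℚ.* s ℚ.≤ ι L
  eighth-≤ s≤8L = ι-*-cancelˡ 7 (begin
    ι 8 ℚ.* (c ℚ.* s)     ≡⟨ ℚ.*-assoc (ι 8) c s ⟨
    ι 8 ℚ.* c ℚ.* s       ≡⟨ cong (ℚ._* s) 8c≡1 ⟩
    1ℚ ℚ.* s              ≡⟨ ℚ.*-identityˡ s ⟩
    s                     ≤⟨ s≤8L ⟩
    ι (8 ℕ.* L)           ≡⟨ ι-* 8 L ⟨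
    ι 8 ℚ.* ι L           ∎)

  eighth-≤⁻ : ∀ i {η} → ι (8 ℕ.* i) ℚ.* η ≡ ½ → c ℚ.* s ℚ.≤ ι L ℚ.+ η →
    ι i ℚ.* s ℚ.≤ ι (8 ℕ.* i ℕ.* L) ℚ.+ ½
  eighth-≤⁻ i {η} 8iη≡½ h = begin
    ι i ℚ.* s                              ≡⟨ cong (ι i ℚ.*_) (trans (sym (ℚ.*-identityˡ s)) (cong (ℚ._* s) (sym 8c≡1))) ⟩
    ι i ℚ.* (ι 8 ℚ.* c ℚ.* s)              ≡⟨ solve 4 (λ i a c s → i :* (a :* c :* s) := a :* i :* (c :* s)) refl (ι i) (ι 8) c s ⟩
    ι 8 ℚ.* ι i ℚ.* (c ℚ.* s)              ≡⟨ cong (ℚ._* (c ℚ.* s)) (ι-* 8 i) ⟩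
    ι (8 ℕ.* i) ℚ.* (c ℚ.* s)              ≤⟨ ι-*-monoʳ (8 ℕ.* i) h ⟩
    ι (8 ℕ.* i) ℚ.* (ι L ℚ.+ η)            ≡⟨ ℚ.*-distribˡ-+ (ι (8 ℕ.* i)) (ι L) η ⟩
    ι (8 ℕ.* i) ℚ.* ι L ℚ.+ ι (8 ℕ.* i) ℚ.* η
                                           ≡⟨ cong₂ ℚ._+_ (ι-* (8 ℕ.* i) L) 8iη≡½ ⟩
    ι (8 ℕ.* i ℕ.* L) ℚ.+ ½                ∎

√/8≤ : ∀ n L → n ℕ.≤ (8 ℕ.* L) ℕ.* (8 ℕ.* L) → ⅛ * √ n ≤ fromℕ L
√/8≤ n L h δ 0<δ = 0 , λ j _ → ℚ.≤-trans (ℚ.≤-reflexive (seq-* ⅛ (√ n) j))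
  (ℚ.≤-trans (eighth-≤ 8*⅛ L (√-upper n (8 ℕ.* L) j h))
    (ℚ.≤-trans (p≤p+q (ι L) (ℚ.<⇒≤ 0<δ)) (ℚ.≤-reflexive (cong (ℚ._+ δ) (sym (seq-fromℕ L j))))))

module _ (n L : ℕ) (h : ⅛ * √ n ≤ fromℕ L) where

  private
    -- The square of 8L + 1/i is at most 64L² + 1 as soon as 16Li + 1 ≤ i², which i = 16L + 1
    -- satisfies.
    i : ℕ
    i = suc (16 ℕ.* L)

    -- An integer exceeding (8 L)² has a square root exceeding 8 L + 1 / i.
    gap : (8 ℕ.* L) ℕ.* (8 ℕ.* L) ℕ.< n →
      suc (8 ℕ.* i ℕ.* L) ℕ.* suc (8 ℕ.* i ℕ.* L) ℕ.≤ n ℕ.* (i ℕ.* i)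
    gap 64L²<n = begin
      suc (8 ℕ.* i ℕ.* L) ℕ.* suc (8 ℕ.* i ℕ.* L)
        ≡⟨ solve 2 (λ i L → (con 1 :+ con 8 :* i :* L) :* (con 1 :+ con 8 :* i :* L)
             := (con 8 :* L) :* (con 8 :* L) :* (i :* i) :+ (con 1 :+ con 16 :* L :* i)) refl i L ⟩
      (8 ℕ.* L) ℕ.* (8 ℕ.* L) ℕ.* (i ℕ.* i) ℕ.+ suc (16 ℕ.* L ℕ.* i)
        ≤⟨ ℕ.+-monoʳ-≤ _ (ℕ.+-monoˡ-≤ (16 ℕ.* L ℕ.* i) (s≤s (z≤n {16 ℕ.* L}))) ⟩
      (8 ℕ.* L) ℕ.* (8 ℕ.* L) ℕ.* (i ℕ.* i) ℕ.+ i ℕ.* i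
        ≡⟨ ℕ.+-comm _ (i ℕ.* i) ⟩
      suc ((8 ℕ.* L) ℕ.* (8 ℕ.* L)) ℕ.* (i ℕ.* i)
        ≤⟨ ℕ.*-monoˡ-≤ (i ℕ.* i) 64L²<n ⟩
      n ℕ.* (i ℕ.* i) ∎
      where
      open ℕ.≤-Reasoning
      open +-*-Solver

    -- At a term whose denominator is a multiple of i, `gap` gives i√n ≥ 8iL + 1, whereas `h` with
    -- tolerance η = 1 / (16i) allows at most 8iL + 1/2.
    not-above : (∃[ η ] (0ℚ ℚ.< η) × (ι (8 ℕ.* i) ℚ.* η ≡ ½)) → ¬ (8 ℕ.* L) ℕ.* (8 ℕ.* L) ℕ.< n
    not-above (η , 0<η , 8iη≡½) 64L²<n = ℕ.<-irrefl refl (ι-cancel-½ {suc (8 ℕ.* i ℕ.* L)} {8 ℕ.* i ℕ.* L} (ℚ.≤-trans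
      (√-lower n (suc (8 ℕ.* i ℕ.* L)) i (suc N) j refl (gap 64L²<n))
      (eighth-≤⁻ {+ 1 / 8} {seq (√ n) j} 8*⅛ L i 8iη≡½ (ℚ.≤-trans (ℚ.≤-reflexive (sym (seq-* ⅛ (√ n) j)))
        (ℚ.≤-trans (proj₂ (h η 0<η) j (ℕ.m≤m+n N _)) (ℚ.≤-reflexive (cong (ℚ._+ η) (seq-fromℕ L j))))))))
      where
      N = proj₁ (h η 0<η)
      -- Written so that j + 1 computes to i (N + 1).
      j = N ℕ.+ 16 ℕ.* L ℕ.* suc N

  √/8≤⁻ : n ℕ.≤ (8 ℕ.* L) ℕ.* (8 ℕ.* L)
  √/8≤⁻ = ℕ.≮⇒≥ (not-above (split ½ (ι (8 ℕ.* i)) (from-yes (0ℚ ℚ.<? ½)) (0<ι _)))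

-- √n / 8 need not be an integer, but squaring turns the comparison into one of natural numbers.
√/8≤? : ∀ n L → Dec (⅛ * √ n ≤ fromℕ L)
√/8≤? n L = map′ (√/8≤ n L) (√/8≤⁻ n L) (n ℕ.≤? (8 ℕ.* L) ℕ.* (8 ℕ.* L))

-- The event of the theorem

containsOfSizeAtLeast? : ∀ {v} {Q : Pred (List (Edge v)) 0ℓ} x → Decidable Q → (∀ L → Dec (x ≤ fromℕ L)) →
  Decidable (ContainsOfSizeAtLeast Q x)
containsOfSizeAtLeast? x Q? x? = sublist? (λ S → Q? S ×-dec x? (length S))

Event : ∀ n → Pred (List (Edge (2 ℕ.* n))) 0ℓ
Event n M =
  ContainsOfSizeAtLeast Stack (threshold n) M ×
  ContainsOfSizeAtLeast Wave  (threshold n) M ×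
  ContainsOfSizeAtLeast Line  (⅛ * √ n) M

event? : ∀ n → Decidable (Event n)
event? n M =
  containsOfSizeAtLeast? {Q = Stack} (threshold n) (λ S → Linked.linked? Fin._<?_ _) (threshold? n) M ×-dec
  containsOfSizeAtLeast? {Q = Wave}  (threshold n) (λ S → Linked.linked? Fin._<?_ _) (threshold? n) M ×-dec
  containsOfSizeAtLeast? {Q = Line}  (⅛ * √ n) (λ S → Linked.linked? Fin._<?_ _) (√/8≤? n) M

attains⇒contains : ∀ {v} {Q : Pred (List (Edge v)) 0ℓ} {k M} x → (∀ L → k ℕ.≤ L → x ≤ fromℕ L) →
  Attains Q k M → ContainsOfSizeAtLeast Q x M
attains⇒contains x h (S , S⊆M , q , k≤) = S , S⊆M , q , h (length S) k≤

-- Size of the target and convergence of the probability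

module _ (n : ℕ) where

  open Approximation (approximation n) using (small; large)
  open ℕ.≤-Reasoning
  open +-*-Solver

  private
    K = target n
    r = ⌊√ n ⌋

  -- The place where 2e² > 13 is used, in the form 56² = 3136 > 2925 = 13 · 15².
  K-small : 13 ℕ.* (K ℕ.* K) ℕ.≤ n
  K-small = ℕ.*-cancelˡ-≤ 225 (begin
    225 ℕ.* (13 ℕ.* (K ℕ.* K))          ≡⟨ ℕ.*-assoc 225 13 (K ℕ.* K) ⟨
    2925 ℕ.* (K ℕ.* K)                  ≤⟨ ℕ.*-monoˡ-≤ (K ℕ.* K) (ℕ.m≤m+n 2925 211) ⟩
    3136 ℕ.* (K ℕ.* K)                  ≡⟨ solve 1 (λ k → con 3136 :* (k :* k) := (con 56 :* k) :* (con 56 :* k)) refl K ⟩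
    (56 ℕ.* K) ℕ.* (56 ℕ.* K)           ≤⟨ ℕ.*-mono-≤ small small ⟩
    (15 ℕ.* r) ℕ.* (15 ℕ.* r)           ≡⟨ solve 1 (λ r → (con 15 :* r) :* (con 15 :* r) := con 225 :* (r :* r)) refl r ⟩
    225 ℕ.* (r ℕ.* r)                   ≤⟨ ℕ.*-monoʳ-≤ 225 (⌊√⌋-lower n) ⟩
    225 ℕ.* n                           ∎)

  K-unbounded : ∀ X → (6 ℕ.* X) ℕ.* (6 ℕ.* X) ℕ.≤ n → X ℕ.≤ K
  K-unbounded X h = ℕ.s≤s⁻¹ (ℕ.*-cancelˡ-< 6 X (suc K) (ℕ.≤-<-trans (⌊√⌋-greatest (6 ℕ.* X) n h) large))

  -- The crude bound e √2 ≤ 6 leaves 2K to spare below 8K, which covers the rounding by 6 from K = 3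
  -- on.
  K-large : 3 ℕ.≤ K → n ℕ.≤ (8 ℕ.* K) ℕ.* (8 ℕ.* K)
  K-large 3≤K = ℕ.<⇒≤ (ℕ.<-≤-trans (⌊√⌋-upper n) (ℕ.*-mono-≤ r<8K r<8K))
    where
    r<8K : r ℕ.< 8 ℕ.* K
    r<8K = begin-strict
      r                     <⟨ large ⟩
      6 ℕ.* suc K           ≡⟨ solve 1 (λ k → con 6 :* (con 1 :+ k) := con 6 :* k :+ con 2 :* con 3) refl K ⟩
      6 ℕ.* K ℕ.+ 2 ℕ.* 3   ≤⟨ ℕ.+-monoʳ-≤ (6 ℕ.* K) (ℕ.*-monoʳ-≤ 2 3≤K) ⟩
      6 ℕ.* K ℕ.+ 2 ℕ.* K   ≡⟨ ℕ.*-distribʳ-+ K 6 2 ⟨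
      8 ℕ.* K               ∎

n≤2^n : ∀ n → n ℕ.≤ 2 ℕ.^ n
n≤2^n zero    = z≤n
n≤2^n (suc n) = begin
  suc n                       ≤⟨ s≤s (n≤2^n n) ⟩
  1 ℕ.+ 2 ℕ.^ n               ≤⟨ ℕ.+-mono-≤ (ℕ.m^n>0 2 n) (ℕ.m≤m+n (2 ℕ.^ n) 0) ⟩
  2 ℕ.^ n ℕ.+ (2 ℕ.^ n ℕ.+ 0) ∎
  where open ℕ.≤-Reasoning

-- The excluded fraction is at most 3 / 2 ^ (3d), and 3d ≤ 2 ^ (3d).
few-others : ∀ {c N d} → N ℕ.* 2 ℕ.^ (3 ℕ.* d) ℕ.≤ c ℕ.* 2 ℕ.^ (3 ℕ.* d) ℕ.+ 3 ℕ.* N → (N ℕ.∸ c) ℕ.* d ℕ.≤ N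
few-others {c} {N} {d} h = ℕ.*-cancelˡ-≤ 3 (begin
  3 ℕ.* ((N ℕ.∸ c) ℕ.* d)          ≡⟨ solve 2 (λ x d → con 3 :* (x :* d) := x :* (con 3 :* d)) refl (N ℕ.∸ c) d ⟩
  (N ℕ.∸ c) ℕ.* (3 ℕ.* d)          ≤⟨ ℕ.*-monoʳ-≤ (N ℕ.∸ c) (n≤2^n (3 ℕ.* d)) ⟩
  (N ℕ.∸ c) ℕ.* x                  ≡⟨ ℕ.*-distribʳ-∸ x N c ⟩
  N ℕ.* x ℕ.∸ c ℕ.* x              ≤⟨ ℕ.m≤n+o⇒m∸n≤o (N ℕ.* x) (c ℕ.* x) h ⟩
  3 ℕ.* N                          ∎)
  where
  open ℕ.≤-Reasoning
  open +-*-Solver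
  x = 2 ℕ.^ (3 ℕ.* d)

module _ {d : ℕ} {δ : ℚ} (0<δ : 0ℚ ℚ.< δ) (1≤dδ : ι 1 ℚ.≤ ι (suc d) ℚ.* δ) where

  fraction-near-1 : ∀ c N .{{_ : ℕ.NonZero N}} → c ℕ.≤ N → (N ℕ.∸ c) ℕ.* suc d ℕ.≤ N → ℚ.∣ + c / N ℚ.- 1ℚ ∣ ℚ.≤ δ
  fraction-near-1 c N@(suc N-1) c≤N h = ∣p-q∣≤r {+ c / N} {1ℚ} {δ} below above
    where
    open ℚ.≤-Reasoning
    below : + c / N ℚ.≤ 1ℚ ℚ.+ δ
    below = begin
      + c / N               ≡⟨ trans (sym (ℚ.*-identityˡ (+ c / N))) (cong (ℚ._* (+ c / N)) (sym ι-1)) ⟩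
      ι 1 ℚ.* (+ c / N)     ≤⟨ /-≤-ι {c} {1} {1} N (ℕ.*-monoʳ-≤ 1 c≤N) ⟩
      ι 1                   ≡⟨ ι-1 ⟩
      1ℚ                    ≤⟨ p≤p+q 1ℚ (ℚ.<⇒≤ 0<δ) ⟩
      1ℚ ℚ.+ δ              ∎
    above : 1ℚ ℚ.≤ + c / N ℚ.+ δ
    above = ι-*-cancelˡ N-1 (begin
      ι N ℚ.* 1ℚ
        ≡⟨ trans (ℚ.*-identityʳ (ι N)) (cong ι (sym (ℕ.m+[n∸m]≡n c≤N))) ⟩
      ι (c ℕ.+ (N ℕ.∸ c))
        ≡⟨ ι-+ c (N ℕ.∸ c) ⟨
      ι c ℚ.+ ι (N ℕ.∸ c)
        ≤⟨ ℚ.+-mono-≤ (ι-≤-/ {c} {c} {N} N (ℕ.≤-reflexive (ℕ.*-comm c N))) (begin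
          ι (N ℕ.∸ c)                             ≡⟨ trans (cong ι (sym (ℕ.*-identityʳ (N ℕ.∸ c)))) (sym (ι-* (N ℕ.∸ c) 1)) ⟩
          ι (N ℕ.∸ c) ℚ.* ι 1                     ≤⟨ ι-*-monoʳ (N ℕ.∸ c) 1≤dδ ⟩
          ι (N ℕ.∸ c) ℚ.* (ι (suc d) ℚ.* δ)       ≡⟨ ℚ.*-assoc (ι (N ℕ.∸ c)) (ι (suc d)) δ ⟨
          ι (N ℕ.∸ c) ℚ.* ι (suc d) ℚ.* δ         ≡⟨ cong (ℚ._* δ) (ι-* (N ℕ.∸ c) (suc d)) ⟩
          ι ((N ℕ.∸ c) ℕ.* suc d) ℚ.* δ           ≤⟨ ℚ.*-monoʳ-≤-nonNeg δ {{ℚ.nonNegative (ℚ.<⇒≤ 0<δ)}} (ι-mono h) ⟩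
          ι N ℚ.* δ                               ∎) ⟩
      ι N ℚ.* (+ c / N) ℚ.+ ι N ℚ.* δ
        ≡⟨ ℚ.*-distribˡ-+ (ι N) (+ c / N) δ ⟨
      ι N ℚ.* (+ c / N ℚ.+ δ) ∎)

  private
    -- With this j the failure probability 3 / 2 ^ j is at most 1 / (d + 1) ≤ δ; X is the least K
    -- that `most-matchings` accepts for it.
    j = 3 ℕ.* suc d
    X = 15 ℕ.* j ℕ.+ 3

  Pr-near-1 : ∀ n → (6 ℕ.* X) ℕ.* (6 ℕ.* X) ℕ.≤ n → ℚ.∣ Pr n (event? n) ℚ.- 1ℚ ∣ ℚ.≤ δ
  Pr-near-1 n X²≤n = fraction-near-1 (count (event? n) (matchings n)) (length (matchings n))
    {{ℕ.>-nonZero (∈-length (∈-matchings n (canonical-isMatching n)))}}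
    (length-filter (event? n) (matchings n))
    (few-others {count (event? n) (matchings n)} {length (matchings n)} {suc d}
      (most-matchings n (target n) j (K-small n) X≤K (event? n) λ stack wave line →
          attains⇒contains (threshold n) (threshold≤ n) stack
        , attains⇒contains (threshold n) (threshold≤ n) wave
        , attains⇒contains (⅛ * √ n) √/8≤-target line))
    where
    X≤K : X ℕ.≤ target n
    X≤K = K-unbounded n X X²≤n
    √/8≤-target : ∀ L → target n ℕ.≤ L → ⅛ * √ n ≤ fromℕ L
    √/8≤-target L K≤L = √/8≤ n L (ℕ.≤-trans (K-large n (ℕ.≤-trans (ℕ.m≤n+m 3 (15 ℕ.* j)) X≤K))
      (ℕ.*-mono-≤ (ℕ.*-monoʳ-≤ 8 K≤L) (ℕ.*-monoʳ-≤ 8 K≤L)))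

fromℚ-near-1 : ∀ p δ → ℚ.∣ p ℚ.- 1ℚ ∣ ℚ.≤ δ → ∣ fromℚ p - 1ℝ ∣ ≤ fromℚ δ
fromℚ-near-1 p δ h = ∣-∣-intro (fromℚ p) 1ℝ δ (0 , λ _ _ → h)

theorem12 : Σ[ ε ∈ (ℕ → ℝ) ] (ε ⟶ 0ℝ) ×
    (Σ[ event? ∈ ((n : ℕ) → Decidable (λ (M : List (Edge (2 ℕ.* n))) →
    ContainsOfSizeAtLeast Stack ((1ℝ - ε n) ÷ (e * √ 2) * √ n) M ×
    ContainsOfSizeAtLeast Wave  ((1ℝ - ε n) ÷ (e * √ 2) * √ n) M ×
    ContainsOfSizeAtLeast Line  (fromℚ (+ 1 / 8) * √ n) M)) ]
    ((λ n → fromℚ (Pr n (event? n))) ⟶ 1ℝ))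
theorem12 = ε , ε⟶0 , event? , λ δ 0<δ → let d , 1≤dδ = archimedean-ι δ 0<δ in
  _ , λ n X²≤n → fromℚ-near-1 (Pr n (event? n)) δ (Pr-near-1 0<δ 1≤dδ n X²≤n)
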